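{- Let $r\ge2$ and $n\ge1$ be integers and let $A_{r,n}^+(x)$ be the polynomial defined by $$\sum_{m\ge0}\bigl[(rm+1)^n-(rm)^n\bigr]x^m=\frac{A_{r,n}^+(x)}{(1-x)^n}.$$ Then $\mathcal{I}_{n-1}(A_{r,n}^+)\ll A_{r,n}^+$. In particular, $A_{r,n}^+(x)$ is alternatingly increasing.
   Context: $A_{r,n}^+(x)$ is the generating polynomial by descents of the $r$-colored permutations in $\mathbb{Z}_r\wr S_n$ with first coordinate of zero color; it has degree $n-1$. For $p$ of degree at most $d$, $\mathcal{I}_d(p)(x)=x^dp(1/x)$. For real-rooted real polynomials $f,g$ with zeros $\{r_i\}$, $\{s_j\}$ in decreasing order, $g\preceq f$ means either $\deg f=\deg g+1=d$ and $r_d\le s_{d-1}\le\cdots\le s_1\le r_1$, or $\deg f=\deg g=d$ and $s_d\le r_d\le\cdots\le s_1\le r_1$; $g\ll f$ means $g\preceq f$ with leading coefficients of the same sign, or $f\preceq g$ with leading coefficients of opposite sign. A polynomial $p=\sum_{j=0}^dp_jx^j$ of degree $d$ is alternatingly increasing if $0\le p_0\le p_d\le p_1\le p_{d-1}\le\cdots\le p_{\lfloor(d+1)/2\rfloor}$. -}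

module Defs where

open import Data.Nat.Base as ℕ using (ℕ; zero; suc; _∸_)
import Data.Nat.Properties as ℕₚ
open import Data.Integer.Base as ℤ using (ℤ; +_; 0ℤ)
import Data.Integer.Properties as ℤₚ
import Data.Integer.Solver as ℤ-Solver
open import Data.Rational.Base as ℚ using (ℚ; 0ℚ; 1ℚ; ½)
import Data.Rational.Properties as ℚₚ
import Data.Rational.Solver as ℚ-Solver
open import Data.Product.Base using (Σ; ∃-syntax; _×_; _,_)
open import Data.Sum.Base using (_⊎_)
open import Data.Vec.Base using (Vec; []; _∷_; _⋎_)
open import Data.Vec.Relation.Unary.Linked using (Linked)
open import Relation.Nullary.Decidable.Core using (yes; no)
open import Relation.Binary.PropositionalEquality
  using (_≡_; refl; sym; trans; cong; cong₂; subst; subst₂)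

------------------------------------------------------------------------
-- Real numbers: Cauchy sequences of rationals with the setoid equality _≈_.

IsCauchy : (ℕ → ℚ) → Set
IsCauchy x = ∀ ε → 0ℚ ℚ.< ε →
  ∃[ N ] (∀ m n → N ℕ.≤ m → N ℕ.≤ n → ℚ.∣ x m ℚ.- x n ∣ ℚ.≤ ε)

record ℝ : Set where
  constructor mkℝ
  field
    seq    : ℕ → ℚ
    cauchy : IsCauchy seq

open ℝ public

infix 4 _≈_ _≤_ _≥_ _<_ _#_

_≈_ : ℝ → ℝ → Set
x ≈ y = ∀ ε → 0ℚ ℚ.< ε →
  ∃[ N ] (∀ n → N ℕ.≤ n → ℚ.∣ seq x n ℚ.- seq y n ∣ ℚ.≤ ε)

_≤_ : ℝ → ℝ → Set
x ≤ y = ∀ ε → 0ℚ ℚ.< ε →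
  ∃[ N ] (∀ n → N ℕ.≤ n → seq x n ℚ.≤ seq y n ℚ.+ ε)

_≥_ : ℝ → ℝ → Set
x ≥ y = y ≤ x

_<_ : ℝ → ℝ → Set
x < y = ∃[ ε ] 0ℚ ℚ.< ε ×
  (∃[ N ] (∀ n → N ℕ.≤ n → seq x n ℚ.+ ε ℚ.≤ seq y n))

-- Apartness, the constructive form of x ≠ y.
_#_ : ℝ → ℝ → Set
x # y = x < y ⊎ y < x

private
  module _ where
    open ℚ-Solver.+-*-Solver

    sum-diff : ∀ a b c d → (a ℚ.+ b) ℚ.- (c ℚ.+ d) ≡ (a ℚ.- c) ℚ.+ (b ℚ.- d)
    sum-diff = solve 4 (λ a b c d →
      (a :+ b) :- (c :+ d) := (a :- c) :+ (b :- d)) refl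

    prod-diff : ∀ a b c d →
      (a ℚ.* b) ℚ.- (c ℚ.* d) ≡ (a ℚ.* (b ℚ.- d)) ℚ.+ (d ℚ.* (a ℚ.- c))
    prod-diff = solve 4 (λ a b c d →
      (a :* b) :- (c :* d) := (a :* (b :- d)) :+ (d :* (a :- c))) refl

    neg-diff : ∀ a b → (ℚ.- a) ℚ.- (ℚ.- b) ≡ ℚ.- (a ℚ.- b)
    neg-diff = solve 2 (λ a b → (:- a) :- (:- b) := :- (a :- b)) refl

    minus-plus : ∀ a b → (a ℚ.- b) ℚ.+ b ≡ a
    minus-plus = solve 2 (λ a b → (a :- b) :+ b := a) refl

    factor-out : ∀ a b e → (a ℚ.* e) ℚ.+ (b ℚ.* e) ≡ (a ℚ.+ b) ℚ.* e
    factor-out = solve 3 (λ a b e → (a :* e) :+ (b :* e) := (a :+ b) :* e) refl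

    rotate : ∀ s e i → s ℚ.* (e ℚ.* i) ≡ e ℚ.* (s ℚ.* i)
    rotate = solve 3 (λ s e i → s :* (e :* i) := e :* (s :* i)) refl

  0<*-pos : ∀ p q → 0ℚ ℚ.< p → 0ℚ ℚ.< q → 0ℚ ℚ.< p ℚ.* q
  0<*-pos p q 0<p 0<q =
    subst (ℚ._< p ℚ.* q) (ℚₚ.*-zeroʳ p)
      (ℚₚ.*-monoʳ-<-pos p {{ℚ.positive 0<p}} 0<q)

  halves : ∀ ε → (½ ℚ.* ε) ℚ.+ (½ ℚ.* ε) ≡ ε
  halves ε = trans (sym (ℚₚ.*-distribʳ-+ ε ½ ½)) (ℚₚ.*-identityˡ ε)

  0<½ : 0ℚ ℚ.< ½
  0<½ = ℚₚ.positive⁻¹ ½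

  0<1 : 0ℚ ℚ.< 1ℚ
  0<1 = ℚₚ.positive⁻¹ 1ℚ

  *-mono-bound : ∀ a b M e → ℚ.∣ a ∣ ℚ.≤ M → ℚ.∣ b ∣ ℚ.≤ e →
                 ℚ.∣ a ℚ.* b ∣ ℚ.≤ M ℚ.* e
  *-mono-bound a b M e p q =
    subst (ℚ._≤ M ℚ.* e) (sym (ℚₚ.∣p*q∣≡∣p∣*∣q∣ a b))
      (ℚₚ.≤-trans
        (ℚₚ.*-monoʳ-≤-nonNeg ℚ.∣ b ∣ {{ℚₚ.∣-∣-nonNeg b}} p)
        (ℚₚ.*-monoˡ-≤-nonNeg M
          {{ℚ.nonNegative (ℚₚ.≤-trans (ℚₚ.0≤∣p∣ a) p)}} q))

  eventually-bounded : ∀ x → IsCauchy x →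
    ∃[ M ] 0ℚ ℚ.< M × (∃[ N ] (∀ n → N ℕ.≤ n → ℚ.∣ x n ∣ ℚ.≤ M))
  eventually-bounded x c with c 1ℚ 0<1
  ... | N , h = 1ℚ ℚ.+ ℚ.∣ x N ∣ , ℚₚ.+-mono-<-≤ 0<1 (ℚₚ.0≤∣p∣ (x N)) , N ,
    λ n N≤n → ℚₚ.≤-trans
      (subst (λ z → ℚ.∣ z ∣ ℚ.≤ ℚ.∣ x n ℚ.- x N ∣ ℚ.+ ℚ.∣ x N ∣)
        (minus-plus (x n) (x N)) (ℚₚ.∣p+q∣≤∣p∣+∣q∣ (x n ℚ.- x N) (x N)))
      (ℚₚ.+-monoˡ-≤ ℚ.∣ x N ∣ (h n N N≤n ℕₚ.≤-refl))

  +-cauchy : ∀ x y → IsCauchy x → IsCauchy y → IsCauchy (λ n → x n ℚ.+ y n)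
  +-cauchy x y cx cy ε 0<ε
    with cx (½ ℚ.* ε) (0<*-pos ½ ε 0<½ 0<ε)
       | cy (½ ℚ.* ε) (0<*-pos ½ ε 0<½ 0<ε)
  ... | N₁ , h₁ | N₂ , h₂ = N₁ ℕ.⊔ N₂ , λ m n p q →
    subst₂ ℚ._≤_ (cong ℚ.∣_∣ (sym (sum-diff (x m) (y m) (x n) (y n)))) (halves ε)
      (ℚₚ.≤-trans (ℚₚ.∣p+q∣≤∣p∣+∣q∣ (x m ℚ.- x n) (y m ℚ.- y n))
        (ℚₚ.+-mono-≤
          (h₁ m n (ℕₚ.m⊔n≤o⇒m≤o N₁ N₂ p) (ℕₚ.m⊔n≤o⇒m≤o N₁ N₂ q))
          (h₂ m n (ℕₚ.m⊔n≤o⇒n≤o N₁ N₂ p) (ℕₚ.m⊔n≤o⇒n≤o N₁ N₂ q))))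

  neg-cauchy : ∀ x → IsCauchy x → IsCauchy (λ n → ℚ.- x n)
  neg-cauchy x cx ε 0<ε with cx ε 0<ε
  ... | N , h = N , λ m n p q →
    subst (ℚ._≤ ε)
      (sym (trans (cong ℚ.∣_∣ (neg-diff (x m) (x n))) (ℚₚ.∣-p∣≡∣p∣ (x m ℚ.- x n))))
      (h m n p q)

  divide : ∀ S ε → 0ℚ ℚ.< S → 0ℚ ℚ.< ε → ∃[ δ ] 0ℚ ℚ.< δ × S ℚ.* δ ≡ ε
  divide S ε 0<S 0<ε =
    ε ℚ.* i ,
    0<*-pos ε i 0<ε (ℚₚ.positive⁻¹ i {{ℚₚ.1/pos⇒pos S {{S-pos}}}}) ,
    trans (rotate S ε i)
      (trans (cong (ε ℚ.*_) (ℚₚ.*-inverseʳ S {{S-nonZero}})) (ℚₚ.*-identityʳ ε))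
    where
    S-pos : ℚ.Positive S
    S-pos = ℚ.positive 0<S

    S-nonZero : ℚ.NonZero S
    S-nonZero = ℚₚ.pos⇒nonZero S {{S-pos}}

    i : ℚ
    i = ℚ.1/_ S {{S-nonZero}}

  *-close : ∀ a b c d M₁ M₂ δ ε → (M₁ ℚ.+ M₂) ℚ.* δ ≡ ε →
            ℚ.∣ a ∣ ℚ.≤ M₁ → ℚ.∣ b ℚ.- d ∣ ℚ.≤ δ →
            ℚ.∣ d ∣ ℚ.≤ M₂ → ℚ.∣ a ℚ.- c ∣ ℚ.≤ δ →
            ℚ.∣ a ℚ.* b ℚ.- c ℚ.* d ∣ ℚ.≤ ε
  *-close a b c d M₁ M₂ δ ε e a≤ bd≤ d≤ ac≤ =
    subst₂ ℚ._≤_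
      (cong ℚ.∣_∣ (sym (prod-diff a b c d)))
      (trans (factor-out M₁ M₂ δ) e)
      (ℚₚ.≤-trans
        (ℚₚ.∣p+q∣≤∣p∣+∣q∣ (a ℚ.* (b ℚ.- d)) (d ℚ.* (a ℚ.- c)))
        (ℚₚ.+-mono-≤
          (*-mono-bound a (b ℚ.- d) M₁ δ a≤ bd≤)
          (*-mono-bound d (a ℚ.- c) M₂ δ d≤ ac≤)))

  *-cauchy-bound : ∀ (x y : ℕ → ℚ) M₁ M₂ δ ε → (M₁ ℚ.+ M₂) ℚ.* δ ≡ ε →
    ∀ K₁ K₂ N₁ N₂ →
    (∀ n → K₁ ℕ.≤ n → ℚ.∣ x n ∣ ℚ.≤ M₁) →
    (∀ n → K₂ ℕ.≤ n → ℚ.∣ y n ∣ ℚ.≤ M₂) →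
    (∀ m n → N₁ ℕ.≤ m → N₁ ℕ.≤ n → ℚ.∣ x m ℚ.- x n ∣ ℚ.≤ δ) →
    (∀ m n → N₂ ℕ.≤ m → N₂ ℕ.≤ n → ℚ.∣ y m ℚ.- y n ∣ ℚ.≤ δ) →
    ∃[ N ] (∀ m n → N ℕ.≤ m → N ℕ.≤ n →
      ℚ.∣ x m ℚ.* y m ℚ.- x n ℚ.* y n ∣ ℚ.≤ ε)
  *-cauchy-bound x y M₁ M₂ δ ε eq K₁ K₂ N₁ N₂ b₁ b₂ h₁ h₂ =
    (K₁ ℕ.⊔ K₂) ℕ.⊔ (N₁ ℕ.⊔ N₂) , λ m n p q →
    let K = K₁ ℕ.⊔ K₂
        N = N₁ ℕ.⊔ N₂
        pK = ℕₚ.m⊔n≤o⇒m≤o K N p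
        qK = ℕₚ.m⊔n≤o⇒m≤o K N q
        pN = ℕₚ.m⊔n≤o⇒n≤o K N p
        qN = ℕₚ.m⊔n≤o⇒n≤o K N q
    in *-close (x m) (y m) (x n) (y n) M₁ M₂ δ ε eq
         (b₁ m (ℕₚ.m⊔n≤o⇒m≤o K₁ K₂ pK))
         (h₂ m n (ℕₚ.m⊔n≤o⇒n≤o N₁ N₂ pN) (ℕₚ.m⊔n≤o⇒n≤o N₁ N₂ qN))
         (b₂ n (ℕₚ.m⊔n≤o⇒n≤o K₁ K₂ qK))
         (h₁ m n (ℕₚ.m⊔n≤o⇒m≤o N₁ N₂ pN) (ℕₚ.m⊔n≤o⇒m≤o N₁ N₂ qN))

  *-cauchy : ∀ x y → IsCauchy x → IsCauchy y → IsCauchy (λ n → x n ℚ.* y n)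
  *-cauchy x y cx cy ε 0<ε =
    let M₁ , 0<M₁ , K₁ , b₁ = eventually-bounded x cx
        M₂ , 0<M₂ , K₂ , b₂ = eventually-bounded y cy
        δ , 0<δ , eq = divide (M₁ ℚ.+ M₂) ε (ℚₚ.+-mono-< 0<M₁ 0<M₂) 0<ε
        N₁ , h₁ = cx δ 0<δ
        N₂ , h₂ = cy δ 0<δ
    in *-cauchy-bound x y M₁ M₂ δ ε eq K₁ K₂ N₁ N₂ b₁ b₂ h₁ h₂

infixl 6 _+_ _-_
infixl 7 _*_
infix  8 -_

_+_ : ℝ → ℝ → ℝ
seq    (x + y) n = seq x n ℚ.+ seq y n
cauchy (x + y)   = +-cauchy (seq x) (seq y) (cauchy x) (cauchy y)

-_ : ℝ → ℝ
seq    (- x) n = ℚ.- seq x n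
cauchy (- x)   = neg-cauchy (seq x) (cauchy x)

_-_ : ℝ → ℝ → ℝ
x - y = x + (- y)

_*_ : ℝ → ℝ → ℝ
seq    (x * y) n = seq x n ℚ.* seq y n
cauchy (x * y)   = *-cauchy (seq x) (seq y) (cauchy x) (cauchy y)

fromℚ : ℚ → ℝ
seq    (fromℚ q) _ = q
cauchy (fromℚ q) ε 0<ε = 0 , λ _ _ _ _ →
  subst (ℚ._≤ ε) (cong ℚ.∣_∣ (sym (ℚₚ.+-inverseʳ q))) (ℚₚ.<⇒≤ 0<ε)

fromℤ : ℤ → ℝ
fromℤ z = fromℚ (z ℚ./ 1)

0ℝ 1ℝ : ℝ
0ℝ = fromℚ 0ℚ
1ℝ = fromℚ 1ℚ

≈-refl : ∀ {x} → x ≈ x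
≈-refl {x} ε 0<ε = 0 , λ n _ →
  subst (ℚ._≤ ε) (cong ℚ.∣_∣ (sym (ℚₚ.+-inverseʳ (seq x n)))) (ℚₚ.<⇒≤ 0<ε)

≈-reflexive : ∀ {x y} → x ≡ y → x ≈ y
≈-reflexive {x} refl = ≈-refl {x}

------------------------------------------------------------------------
-- Real polynomials: coefficient sequences that vanish from some point on.

VanishesAbove : (ℕ → ℝ) → ℕ → Set
VanishesAbove c d = ∀ k → d ℕ.< k → c k ≈ 0ℝ

record Poly : Set where
  constructor mkPoly
  field
    coeff  : ℕ → ℝ
    finite : ∃[ d ] VanishesAbove coeff d

open Poly public

Degree≤ : Poly → ℕ → Set
Degree≤ p d = VanishesAbove (coeff p) d

HasDegree : Poly → ℕ → Set
HasDegree p d = coeff p d # 0ℝ × Degree≤ p d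

-- 𝓘 d p is x^d p(1/x), for p of degree at most d.
𝓘 : ∀ d (p : Poly) → Degree≤ p d → Poly
𝓘 d p _ = mkPoly reversed (d , vanishes)
  where
  reversed : ℕ → ℝ
  reversed k with k ℕₚ.≤? d
  ... | yes _ = coeff p (d ∸ k)
  ... | no  _ = 0ℝ

  vanishes : VanishesAbove reversed d
  vanishes k d<k with k ℕₚ.≤? d
  ... | yes k≤d with () ← ℕₚ.<⇒≱ d<k k≤d
  ... | no  _   = ≈-refl {0ℝ}

-- Coefficients of (x - z₁)⋯(x - z_d).
∏[x-_] : ∀ {d} → Vec ℝ d → ℕ → ℝ
∏[x- []     ] zero    = 1ℝ
∏[x- []     ] (suc k) = 0ℝ
∏[x- z ∷ zs ] zero    = - (z * ∏[x- zs ] zero)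
∏[x- z ∷ zs ] (suc k) = ∏[x- zs ] k - z * ∏[x- zs ] (suc k)

-- p has degree d, is real-rooted, and its zeros with multiplicity are zs.
HasZeros : ∀ {d} → Poly → Vec ℝ d → Set
HasZeros {d} p zs =
  HasDegree p d × (∀ k → coeff p k ≈ coeff p d * ∏[x- zs ] k)

-- r ⋎ s is the vector r₁, s₁, r₂, s₂, …; that it is weakly decreasing
-- includes the weak decrease of r and of s.
infix 4 _⪯_ _≪_

_⪯_ : Poly → Poly → Set
g ⪯ f =
    (∃[ d ] Σ (Vec ℝ (suc d)) λ r → Σ (Vec ℝ d) λ s →
       HasZeros f r × HasZeros g s × Linked _≥_ (r ⋎ s))
  ⊎ (∃[ d ] Σ (Vec ℝ d) λ r → Σ (Vec ℝ d) λ s →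
       HasZeros f r × HasZeros g s × Linked _≥_ (r ⋎ s))

SameLeadingSign : Poly → Poly → Set
SameLeadingSign g f = ∃[ d ] ∃[ e ] HasDegree g d × HasDegree f e ×
  ((0ℝ < coeff g d × 0ℝ < coeff f e) ⊎ (coeff g d < 0ℝ × coeff f e < 0ℝ))

OppositeLeadingSign : Poly → Poly → Set
OppositeLeadingSign g f = ∃[ d ] ∃[ e ] HasDegree g d × HasDegree f e ×
  ((0ℝ < coeff g d × coeff f e < 0ℝ) ⊎ (coeff g d < 0ℝ × 0ℝ < coeff f e))

_≪_ : Poly → Poly → Set
g ≪ f = (g ⪯ f × SameLeadingSign g f) ⊎ (f ⪯ g × OppositeLeadingSign g f)

-- The two families of inequalities, p_i ≤ p_{d-i} and p_{d-i} ≤ p_{i+1}, are the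
-- consecutive links of p_0 ≤ p_d ≤ p_1 ≤ p_{d-1} ≤ ⋯ ≤ p_{⌊(d+1)/2⌋}.
AlternatinglyIncreasing : Poly → Set
AlternatinglyIncreasing p = ∃[ d ] HasDegree p d ×
  0ℝ ≤ coeff p 0 ×
  (∀ i → 2 ℕ.* i ℕ.≤ d → coeff p i ≤ coeff p (d ∸ i)) ×
  (∀ i → 2 ℕ.* i ℕ.< d → coeff p (d ∸ i) ≤ coeff p (suc i))

------------------------------------------------------------------------
-- The polynomial A⁺, first as an integer power series (a function ℕ → ℤ
-- giving the coefficients).

[1-x]*_ : (ℕ → ℤ) → ℕ → ℤ
([1-x]* f) zero    = f zero
([1-x]* f) (suc k) = f (suc k) ℤ.- f k

[1-x]^_*_ : ℕ → (ℕ → ℤ) → ℕ → ℤ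
[1-x]^ zero  * f = f
[1-x]^ suc n * f = [1-x]* ([1-x]^ n * f)

powerDiff : ℕ → ℕ → ℕ → ℤ
powerDiff r n m = (+ (r ℕ.* m ℕ.+ 1)) ℤ.^ n ℤ.- (+ (r ℕ.* m)) ℤ.^ n

-- (1-x)^n · Σ_m [(rm+1)^n - (rm)^n] x^m
A⁺-series : ℕ → ℕ → ℕ → ℤ
A⁺-series r n = [1-x]^ n * powerDiff r n

-- The series A⁺ vanishes from x^n on: m ↦ (rm+1)^n - (rm)^n is a polynomial of
-- degree < n, so its n-th finite difference is zero.
private
  ∇ : (ℕ → ℤ) → ℕ → ℤ
  ∇ f m = f (suc m) ℤ.- f m

  Deg< : ℕ → (ℕ → ℤ) → Set
  Deg< zero    f = ∀ m → f m ≡ 0ℤ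
  Deg< (suc n) f = Deg< n (∇ f)

  Deg<-cong : ∀ n {f g} → (∀ m → f m ≡ g m) → Deg< n f → Deg< n g
  Deg<-cong zero    e h m = trans (sym (e m)) (h m)
  Deg<-cong (suc n) {f} {g} e h = Deg<-cong n {∇ f} {∇ g} (λ m → cong₂ ℤ._-_ (e (suc m)) (e m)) h

  module _ where
    open ℤ-Solver.+-*-Solver

    ∇-+ : ∀ a b c d → (a ℤ.- b) ℤ.+ (c ℤ.- d) ≡ (a ℤ.+ c) ℤ.- (b ℤ.+ d)
    ∇-+ = solve 4 (λ a b c d →
      (a :- b) :+ (c :- d) := (a :+ c) :- (b :+ d)) refl

    ∇-scale : ∀ a b c → a ℤ.* (b ℤ.- c) ≡ (a ℤ.* b) ℤ.- (a ℤ.* c)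
    ∇-scale = solve 3 (λ a b c → a :* (b :- c) := (a :* b) :- (a :* c)) refl

    ∇-linear : ∀ a u f g →
      (a ℤ.+ u) ℤ.* (f ℤ.- g) ℤ.+ a ℤ.* g ≡ (a ℤ.+ u) ℤ.* f ℤ.- u ℤ.* g
    ∇-linear = solve 4 (λ a u f g →
      (a :+ u) :* (f :- g) :+ a :* g := (a :+ u) :* f :- u :* g) refl

    powerDiff-step : ∀ u p q →
      u ℤ.* (p ℤ.- q) ℤ.+ p ≡ (+ 1 ℤ.+ u) ℤ.* p ℤ.- u ℤ.* q
    powerDiff-step = solve 3 (λ u p q →
      u :* (p :- q) :+ p := (con (+ 1) :+ u) :* p :- u :* q) refl

  Deg<-+ : ∀ n {f g} → Deg< n f → Deg< n g → Deg< n (λ m → f m ℤ.+ g m)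
  Deg<-+ zero    hf hg m rewrite hf m | hg m = refl
  Deg<-+ (suc n) {f} {g} hf hg =
    Deg<-cong n {λ m → ∇ f m ℤ.+ ∇ g m} {∇ (λ m → f m ℤ.+ g m)}
      (λ m → ∇-+ (f (suc m)) (f m) (g (suc m)) (g m))
      (Deg<-+ n {∇ f} {∇ g} hf hg)

  Deg<-scale : ∀ n a {f} → Deg< n f → Deg< n (λ m → a ℤ.* f m)
  Deg<-scale zero    a h m rewrite h m = ℤₚ.*-zeroʳ a
  Deg<-scale (suc n) a {f} h =
    Deg<-cong n {λ m → a ℤ.* ∇ f m} {∇ (λ m → a ℤ.* f m)}
      (λ m → ∇-scale a (f (suc m)) (f m)) (Deg<-scale n a {∇ f} h)

  Deg<-linear : ∀ n a u {f} → (∀ m → u (suc m) ≡ a ℤ.+ u m) →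
                Deg< n f → Deg< (suc n) (λ m → u m ℤ.* f m)
  Deg<-linear zero a u {f} hu h m = cong₂ ℤ._-_ (zero-at (suc m)) (zero-at m)
    where
    zero-at : ∀ k → u k ℤ.* f k ≡ 0ℤ
    zero-at k = trans (cong (u k ℤ.*_) (h k)) (ℤₚ.*-zeroʳ (u k))
  Deg<-linear (suc n) a u {f} hu h =
    Deg<-cong (suc n)
      {λ m → u (suc m) ℤ.* ∇ f m ℤ.+ a ℤ.* f m} {∇ (λ m → u m ℤ.* f m)} eq
      (Deg<-+ (suc n) {λ m → u (suc m) ℤ.* ∇ f m} {λ m → a ℤ.* f m}
        (Deg<-linear n a (λ m → u (suc m)) {∇ f} (λ m → hu (suc m)) h)
        (Deg<-scale (suc n) a {f} h))
    where
    eq : ∀ m → u (suc m) ℤ.* ∇ f m ℤ.+ a ℤ.* f m ≡ ∇ (λ m → u m ℤ.* f m) m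
    eq m = subst
      (λ v → v ℤ.* ∇ f m ℤ.+ a ℤ.* f m ≡ v ℤ.* f (suc m) ℤ.- u m ℤ.* f m)
      (sym (hu m)) (∇-linear a (u m) (f (suc m)) (f m))

  step₀ : ∀ r m → + (r ℕ.* suc m) ≡ + r ℤ.+ + (r ℕ.* m)
  step₀ r m = cong +_ (ℕₚ.*-suc r m)

  step₁ : ∀ r m → + (r ℕ.* suc m ℕ.+ 1) ≡ + r ℤ.+ + (r ℕ.* m ℕ.+ 1)
  step₁ r m = cong +_
    (trans (cong (ℕ._+ 1) (ℕₚ.*-suc r m)) (ℕₚ.+-assoc r (r ℕ.* m) 1))

  Deg<-power : ∀ r n → Deg< (suc n) (λ m → (+ (r ℕ.* m ℕ.+ 1)) ℤ.^ n)
  Deg<-power r zero    m = refl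
  Deg<-power r (suc n) =
    Deg<-linear (suc n) (+ r) (λ m → + (r ℕ.* m ℕ.+ 1))
      {λ m → (+ (r ℕ.* m ℕ.+ 1)) ℤ.^ n} (step₁ r) (Deg<-power r n)

  Deg<-powerDiff : ∀ r n → Deg< n (powerDiff r n)
  Deg<-powerDiff r zero    m = refl
  Deg<-powerDiff r (suc n) =
    Deg<-cong (suc n)
      {λ m → + (r ℕ.* m) ℤ.* powerDiff r n m ℤ.+ (+ (r ℕ.* m ℕ.+ 1)) ℤ.^ n}
      {powerDiff r (suc n)} eq
      (Deg<-+ (suc n)
        {λ m → + (r ℕ.* m) ℤ.* powerDiff r n m} {λ m → (+ (r ℕ.* m ℕ.+ 1)) ℤ.^ n}
        (Deg<-linear n (+ r) (λ m → + (r ℕ.* m)) {powerDiff r n} (step₀ r)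
          (Deg<-powerDiff r n))
        (Deg<-power r n))
    where
    eq : ∀ m → + (r ℕ.* m) ℤ.* powerDiff r n m ℤ.+ (+ (r ℕ.* m ℕ.+ 1)) ℤ.^ n
             ≡ powerDiff r (suc n) m
    eq m = trans
      (powerDiff-step (+ (r ℕ.* m)) ((+ (r ℕ.* m ℕ.+ 1)) ℤ.^ n) ((+ (r ℕ.* m)) ℤ.^ n))
      (cong (λ z → z ℤ.* (+ (r ℕ.* m ℕ.+ 1)) ℤ.^ n ℤ.- + (r ℕ.* m) ℤ.* (+ (r ℕ.* m)) ℤ.^ n)
        (cong +_ (ℕₚ.+-comm 1 (r ℕ.* m))))

  ∇^ : ℕ → (ℕ → ℤ) → ℕ → ℤ
  ∇^ zero    f = f
  ∇^ (suc n) f = ∇ (∇^ n f)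

  ∇^-shift : ∀ n f m → ∇^ n (∇ f) m ≡ ∇^ (suc n) f m
  ∇^-shift zero    f m = refl
  ∇^-shift (suc n) f m = cong₂ ℤ._-_ (∇^-shift n f (suc m)) (∇^-shift n f m)

  ∇^-vanishes : ∀ n f → Deg< n f → ∀ m → ∇^ n f m ≡ 0ℤ
  ∇^-vanishes zero    f h m = h m
  ∇^-vanishes (suc n) f h m =
    trans (sym (∇^-shift n f m)) (∇^-vanishes n (∇ f) h m)

  [1-x]^-∇^ : ∀ n f m → ([1-x]^ n * f) (n ℕ.+ m) ≡ ∇^ n f m
  [1-x]^-∇^ zero    f m = refl
  [1-x]^-∇^ (suc n) f m = cong₂ ℤ._-_
    (trans (cong ([1-x]^ n * f) (sym (ℕₚ.+-suc n m))) ([1-x]^-∇^ n f (suc m)))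
    ([1-x]^-∇^ n f m)

A⁺-series-vanishes : ∀ r n k → n ℕ.≤ k → A⁺-series r n k ≡ 0ℤ
A⁺-series-vanishes r n k n≤k =
  trans (cong (A⁺-series r n) (sym (ℕₚ.m+[n∸m]≡n n≤k)))
    (trans ([1-x]^-∇^ n (powerDiff r n) (k ∸ n))
      (∇^-vanishes n (powerDiff r n) (Deg<-powerDiff r n) (k ∸ n)))

A⁺ : ℕ → ℕ → Poly
A⁺ r n = mkPoly (λ k → fromℤ (A⁺-series r n k))
  (n , λ k n<k → ≈-reflexive (cong fromℤ (A⁺-series-vanishes r n k (ℕₚ.<⇒≤ n<k))))

A⁺-degree≤ : ∀ r n → Degree≤ (A⁺ r n) (n ∸ 1)
A⁺-degree≤ r n k n∸1<k =
  ≈-reflexive (cong fromℤ (A⁺-series-vanishes r n k (bound n n∸1<k)))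
  where
  bound : ∀ n → n ∸ 1 ℕ.< k → n ℕ.≤ k
  bound zero    _ = ℕ.z≤n
  bound (suc n) h = h

{-# OPTIONS --safe #-}
module Submission where

-- Let n = N + 1 and write E_T for the numerator (1 - x)^(|T|+1) Σ_m ∏_{t ∈ T} (rm + t) x^m. Since
-- (k + 1)^n - k^n = Σ_{a+b=N} k^a (k + 1)^b, the polynomial A⁺ is a sum of numerators E_T with N entries
-- t ∈ {0 , 1}; reversal replaces t by r - t, so 𝓘(A⁺) is such a sum with t ∈ {r , r - 1}. Appending t to T
-- applies a first order differential operator to E_T, so by Rolle's argument all E_T are real-rooted, with
-- zeros interlacing those before the step. Comparing logarithmic derivatives at a zero shows that the i-th zero
-- decreases when an entry of T grows. Hence the i-th zeros of all terms of A⁺ lie between those of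
-- E_(0,…,0) and E_(1,…,1), which also separates the zeros of the sum A⁺, and those of all terms of 𝓘(A⁺)
-- between those of E_(r-1,…,r-1) and E_(r,…,r). Finally E_(0,…,0) = x E_(r,…,r) closes up the chain of inequalities.
--
-- For the second claim, A⁺_k = ψ(rk) where ψ lists the coefficients of (1 + x + ⋯ + x^(r-1))^n times the n-th
-- Eulerian polynomial; ψ is symmetric and unimodal, which gives both families of inequalities.

open import Algebra.Bundles using (CommutativeRing)
import Algebra.Solver.Ring as RingSolver
import Algebra.Solver.Ring.AlmostCommutativeRing as ACR
open import Data.Empty using (⊥; ⊥-elim)
open import Data.Integer.Base as ℤ using (ℤ; +_; -[1+_]; 0ℤ; 1ℤ)
import Data.Integer.Properties as ℤₚ
import Data.Integer.Solver as ℤ-Solver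
open import Data.List.Base using (List; []; _∷_; length; replicate; _++_; map)
import Data.List.Properties as Listₚ
open import Data.List.Relation.Binary.Pointwise using (Pointwise; []; _∷_; Pointwise-length)
open import Data.List.Relation.Unary.All using (All; []; _∷_)
import Data.List.Relation.Unary.All.Properties as Allₚ
open import Data.Maybe.Base using (Maybe; just; nothing)
open import Data.Nat.Base as ℕ using (ℕ; zero; suc; z≤n; s≤s; _∸_) renaming (_≤_ to _≤ℕ_)
import Data.Nat.Properties as ℕₚ
import Data.Nat.Solver as ℕ-Solver
open import Data.Product.Base using (∃; _×_; _,_; proj₁; proj₂; swap)
open import Data.Rational.Base as ℚ using (ℚ; 0ℚ; 1ℚ; ½; mkℚ)
import Data.Rational.Properties as ℚₚ
import Data.Rational.Solver as ℚ-Solver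
import Data.Rational.Unnormalised.Base as ℚᵘ
import Data.Rational.Unnormalised.Properties as ℚᵘₚ
open import Data.Sum.Base using (_⊎_; inj₁; inj₂)
open import Data.Vec.Base using (Vec; []; _∷_; _⋎_)
open import Data.Vec.Relation.Unary.Linked using (Linked; []; [-]; _∷_)
import Defs as R
open import Function.Base using (_∘_)
open import Level using (0ℓ)
open import Relation.Binary.PropositionalEquality as ≡ using (_≡_)
open import Relation.Binary.Structures using (IsEquivalence)
open import Relation.Nullary.Decidable.Core using (Dec; yes; no)
open import Relation.Nullary.Negation.Core using (¬_)

-- The order of the reals is not decidable, so zeros can be neither found nor compared by case
-- analysis. They are found by bisection: all polynomials have integer coefficients, hence decidable
-- signs at rational points. They are compared by contradiction, which yields weak inequalities
-- only. The strict signs of the two sums, which the intermediate value theorem demands, are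
-- recovered from one term of each sum that differs by a single altered step from a polynomial
-- vanishing at the point in question. A second obstacle is that an entry t = 0 creates a zero at 0
-- and an entry t = r loses a degree, so that not all terms have the full number of negative zeros.
-- The factor r x, or r, is therefore split off, whereby the other steps change from (t , r - t) to
-- (t + r , r - t), or to (t , 2r - t). Hence a step carries two independent positive parameters,
-- and polynomials of degrees N and N - 1 have to be compared, with 0 or -∞ standing for the missing
-- zero.

-- The properties of the Cauchy reals on which the argument rests, apart from the intermediate value theorem.
record HeytingRing : Set₁ where
  infix 4 _<_
  field
    commutativeRing : CommutativeRing 0ℓ 0ℓ
  open CommutativeRing commutativeRing public
    hiding (zero)
  field
    _<_       : Carrier → Carrier → Set
    <-resp-≈  : ∀ {x x′ y y′} → x ≈ x′ → y ≈ y′ → x < y → x′ < y′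
    <-irrefl  : ∀ {x} → ¬ x < x
    <-trans   : ∀ {x y z} → x < y → y < z → x < z
    <-cotrans : ∀ {x y} → x < y → ∀ z → x < z ⊎ z < y
    <-tight   : ∀ {x y} → ¬ x < y → ¬ y < x → x ≈ y
    +-monoʳ-< : ∀ z {x y} → x < y → z + x < z + y
    *-pos     : ∀ {x y} → 0# < x → 0# < y → 0# < x * y
    ι         : ℤ → Carrier
    ι-+       : ∀ a b → ι (a ℤ.+ b) ≈ ι a + ι b
    ι-*       : ∀ a b → ι (a ℤ.* b) ≈ ι a * ι b
    ι-neg     : ∀ a → ι (ℤ.- a) ≈ - ι a
    ι-0       : ι 0ℤ ≈ 0#
    ι-1       : ι 1ℤ ≈ 1#
    ι-mono-<  : ∀ {a b} → a ℤ.< b → ι a < ι b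
    archimedean : ∀ x → ∃ λ m → ι (ℤ.- (+ m)) < x

-- Constructive order and alternating signs

module Order (𝓡 : HeytingRing) where
  open HeytingRing 𝓡 public
  open import Relation.Binary.Reasoning.Setoid setoid public

  almostCommutativeRing : ACR.AlmostCommutativeRing 0ℓ 0ℓ
  almostCommutativeRing = ACR.fromCommutativeRing commutativeRing

  ℤ⟶ : ℤ.+-*-rawRing ACR.-Raw-AlmostCommutative⟶ almostCommutativeRing
  ℤ⟶ = record { ⟦_⟧ = ι ; +-homo = ι-+ ; *-homo = ι-* ; -‿homo = ι-neg ; 0-homo = ι-0 ; 1-homo = ι-1 }

  ι≟ : ∀ a b → Maybe (ι a ≈ ι b)
  ι≟ a b with a ℤₚ.≟ b
  ... | yes a≡b = just (reflexive (≡.cong ι a≡b))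
  ... | no  _   = nothing

  open RingSolver ℤ.+-*-rawRing almostCommutativeRing ℤ⟶ ι≟ public
    using (solve; _:+_; _:*_; _:-_; :-_; con; _:=_)

  infix 4 _≤_
  -- The negative form makes weak inequalities provable by contradiction, which is how zeros are
  -- compared; for the Cauchy reals, `≮⇒≥` turns it back into their own order.
  _≤_ : Carrier → Carrier → Set
  x ≤ y = ¬ y < x

  <⇒≤ : ∀ {x y} → x < y → x ≤ y
  <⇒≤ x<y y<x = <-irrefl (<-trans x<y y<x)

  ≤-refl : ∀ {x} → x ≤ x
  ≤-refl = <-irrefl

  ≤-<-trans : ∀ {x y z} → x ≤ y → y < z → x < z
  ≤-<-trans {x} x≤y y<z with <-cotrans y<z x
  ... | inj₁ y<x = ⊥-elim (x≤y y<x)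
  ... | inj₂ x<z = x<z

  <-≤-trans : ∀ {x y z} → x < y → y ≤ z → x < z
  <-≤-trans {z = z} x<y y≤z with <-cotrans x<y z
  ... | inj₁ x<z = x<z
  ... | inj₂ z<y = ⊥-elim (y≤z z<y)

  ≤-trans : ∀ {x y z} → x ≤ y → y ≤ z → x ≤ z
  ≤-trans x≤y y≤z z<x = y≤z (<-≤-trans z<x x≤y)

  ≤-reflexive : ∀ {x y} → x ≈ y → x ≤ y
  ≤-reflexive x≈y y<x = <-irrefl (<-resp-≈ refl x≈y y<x)

  <-respʳ : ∀ {x y y′} → y ≈ y′ → x < y → x < y′
  <-respʳ = <-resp-≈ refl

  <-respˡ : ∀ {x x′ y} → x ≈ x′ → x < y → x′ < y
  <-respˡ x≈x′ = <-resp-≈ x≈x′ refl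

  ≤-respʳ : ∀ {x y y′} → y ≈ y′ → x ≤ y → x ≤ y′
  ≤-respʳ y≈y′ x≤y y′<x = x≤y (<-respˡ (sym y≈y′) y′<x)

  <⇒0<- : ∀ {x y} → x < y → 0# < y - x
  <⇒0<- {x} {y} x<y = <-resp-≈ (-‿inverseˡ x) (+-comm (- x) y) (+-monoʳ-< (- x) x<y)

  ≤⇒0≤- : ∀ {x y} → x ≤ y → 0# ≤ y - x
  ≤⇒0≤- {x} {y} x≤y p = x≤y (<-resp-≈ (solve 2 (λ x y → x :+ (y :- x) := y) refl x y)
    (+-identityʳ x) (+-monoʳ-< x p))

  0<⇒-<0 : ∀ {x} → 0# < x → - x < 0#
  0<⇒-<0 {x} p = <-resp-≈ (+-identityʳ (- x)) (-‿inverseˡ x) (+-monoʳ-< (- x) p)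

  <0⇒0<- : ∀ {x} → x < 0# → 0# < - x
  <0⇒0<- {x} p = <-resp-≈ (-‿inverseˡ x) (+-identityʳ (- x)) (+-monoʳ-< (- x) p)

  0<-⇒<0 : ∀ {x} → 0# < - x → x < 0#
  0<-⇒<0 {x} p = <-respˡ (solve 1 (λ x → :- :- x := x) refl x) (0<⇒-<0 p)

  -<0⇒0< : ∀ {x} → - x < 0# → 0# < x
  -<0⇒0< {x} p = <-respʳ (solve 1 (λ x → :- :- x := x) refl x) (<0⇒0<- p)

  +-pos-nonNeg : ∀ {x y} → 0# < x → 0# ≤ y → 0# < x + y
  +-pos-nonNeg {x} {y} 0<x 0≤y with <-cotrans 0<x (x + y)
  ... | inj₁ p = p
  ... | inj₂ p = ⊥-elim (0≤y (<-resp-≈ (solve 2 (λ x y → (:- x) :+ (x :+ y) := y) refl x y)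
                                (-‿inverseˡ x) (+-monoʳ-< (- x) p)))

  +-nonNeg : ∀ {x y} → 0# ≤ x → 0# ≤ y → 0# ≤ x + y
  +-nonNeg {x} {y} 0≤x 0≤y p with <-cotrans p y
  ... | inj₁ q = 0≤x (<-resp-≈ (solve 2 (λ x y → (:- y) :+ (x :+ y) := x) refl x y)
                   (-‿inverseˡ y) (+-monoʳ-< (- y) q))
  ... | inj₂ q = 0≤y q

  +-pos : ∀ {x y} → 0# < x → 0# < y → 0# < x + y
  +-pos p q = +-pos-nonNeg p (<⇒≤ q)

  *-neg-pos : ∀ {x y} → x < 0# → 0# < y → x * y < 0#
  *-neg-pos {x} {y} p q = 0<-⇒<0
    (<-respʳ (solve 2 (λ x y → (:- x) :* y := :- (x :* y)) refl x y) (*-pos (<0⇒0<- p) q))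

  *-pos-neg : ∀ {x y} → 0# < x → y < 0# → x * y < 0#
  *-pos-neg {x} {y} p q = <-respˡ (*-comm y x) (*-neg-pos q p)

  *-neg-neg : ∀ {x y} → x < 0# → y < 0# → 0# < x * y
  *-neg-neg {x} {y} p q =
    <-respʳ (solve 2 (λ x y → (:- x) :* (:- y) := x :* y) refl x y) (*-pos (<0⇒0<- p) (<0⇒0<- q))

  -- The goal is a negation, so the signs of `x` and `y` may be tested classically: two positive
  -- factors contradict a negative product, and a factor that is not positive is zero by tightness.
  *-nonNeg : ∀ {x y} → 0# ≤ x → 0# ≤ y → 0# ≤ x * y
  *-nonNeg {x} {y} 0≤x 0≤y xy<0 = ¬0<x x≈0⇒⊥
    where
    ¬0<y : 0# < x → ¬ 0# < y
    ¬0<y 0<x 0<y = <⇒≤ (*-pos 0<x 0<y) xy<0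
    ¬0<x : ¬ ¬ 0# < x
    ¬0<x ¬0<x = <-irrefl (<-respˡ (trans (*-congʳ (<-tight 0≤x ¬0<x)) (zeroˡ y)) xy<0)
    x≈0⇒⊥ : ¬ 0# < x
    x≈0⇒⊥ 0<x = <-irrefl
      (<-respˡ (trans (*-congˡ (<-tight 0≤y (¬0<y 0<x))) (zeroʳ x)) xy<0)

  *-cancel-neg : ∀ {x y} → x < 0# → x * y ≈ 0# → y ≈ 0#
  *-cancel-neg x<0 xy≈0 = <-tight
    (λ y<0 → <-irrefl (<-respʳ xy≈0 (*-neg-neg x<0 y<0)))
    (λ 0<y → <-irrefl (<-respˡ xy≈0 (*-neg-pos x<0 0<y)))

  0<1 : 0# < 1#
  0<1 = <-resp-≈ ι-0 ι-1 (ι-mono-< (ℤ.+<+ (s≤s z≤n)))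

  0<ι : ∀ n → 0# < ι (+ suc n)
  0<ι n = <-respˡ ι-0 (ι-mono-< (ℤ.+<+ (s≤s z≤n)))

  0≤ι : ∀ n → 0# ≤ ι (+ n)
  0≤ι zero    = ≤-reflexive (sym ι-0)
  0≤ι (suc n) = <⇒≤ (0<ι n)

  -- This is (-1)^i x. A polynomial with positive leading coefficient and simple real zeros has the
  -- sign (-1)^i at a point with exactly i zeros to its right, so sign statements take the form
  -- `0# < alt i y`.
  alt : ℕ → Carrier → Carrier
  alt zero    x = x
  alt (suc i) x = - alt i x

  alt-cong : ∀ i {x y} → x ≈ y → alt i x ≈ alt i y
  alt-cong zero    e = e
  alt-cong (suc i) e = -‿cong (alt-cong i e)

  alt-+ : ∀ i x y → alt i (x + y) ≈ alt i x + alt i y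
  alt-+ zero    x y = refl
  alt-+ (suc i) x y = trans (-‿cong (alt-+ i x y))
    (solve 2 (λ a b → :- (a :+ b) := (:- a) :+ (:- b)) refl (alt i x) (alt i y))

  alt-* : ∀ i x y → alt i (x * y) ≈ x * alt i y
  alt-* zero    x y = refl
  alt-* (suc i) x y = trans (-‿cong (alt-* i x y))
    (solve 2 (λ a b → :- (a :* b) := a :* (:- b)) refl x (alt i y))

  alt-0 : ∀ i → alt i 0# ≈ 0#
  alt-0 zero    = refl
  alt-0 (suc i) = trans (-‿cong (alt-0 i)) (trans (sym (+-identityˡ _)) (-‿inverseʳ 0#))

  alt-alt : ∀ i j x y → alt i x * alt j y ≈ alt (i ℕ.+ j) (x * y)
  alt-alt zero    j x y = sym (alt-* j x y)
  alt-alt (suc i) j x y = trans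
    (solve 2 (λ a b → (:- a) :* b := :- (a :* b)) refl (alt i x) (alt j y)) (-‿cong (alt-alt i j x y))

  alt-double : ∀ i x → alt (i ℕ.+ i) x ≈ x
  alt-double zero    x = refl
  alt-double (suc i) x rewrite ℕₚ.+-suc i i =
    trans (solve 1 (λ a → :- :- a := a) refl (alt (i ℕ.+ i) x)) (alt-double i x)

-- Values and derivatives of polynomials

module Polynomials (𝓡 : HeytingRing) where
  open Order 𝓡

  -- Horner's scheme. The first argument counts coefficients, so degree d calls for `suc d`.
  ev : ℕ → (ℕ → Carrier) → Carrier → Carrier
  ev zero    c x = 0#
  ev (suc n) c x = c 0 + x * ev n (c ∘ suc) x

  -- θ is the operator x d/dx.
  evθ : ℕ → (ℕ → Carrier) → Carrier → Carrier
  evθ zero    c x = 0#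
  evθ (suc n) c x = x * (ev n (c ∘ suc) x + evθ n (c ∘ suc) x)

  ev-cong : ∀ n {b c} x → (∀ k → b k ≈ c k) → ev n b x ≈ ev n c x
  ev-cong zero    x e = refl
  ev-cong (suc n) x e = +-cong (e 0) (*-congˡ (ev-cong n x (e ∘ suc)))

  ev-cong< : ∀ n {b c} x → (∀ k → k ℕ.< n → b k ≈ c k) → ev n b x ≈ ev n c x
  ev-cong< zero    x e = refl
  ev-cong< (suc n) x e =
    +-cong (e 0 (s≤s z≤n)) (*-congˡ (ev-cong< n x (λ k k<n → e (suc k) (s≤s k<n))))

  evθ-cong : ∀ n {b c} x → (∀ k → b k ≈ c k) → evθ n b x ≈ evθ n c x
  evθ-cong zero    x e = refl
  evθ-cong (suc n) x e = *-congˡ (+-cong (ev-cong n x (e ∘ suc)) (evθ-cong n x (e ∘ suc)))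

  ev-+ : ∀ n b c x → ev n (λ k → b k + c k) x ≈ ev n b x + ev n c x
  ev-+ zero    b c x = sym (+-identityˡ 0#)
  ev-+ (suc n) b c x = trans (+-congˡ (*-congˡ (ev-+ n (b ∘ suc) (c ∘ suc) x)))
    (solve 5 (λ b c x p q → (b :+ c) :+ x :* (p :+ q) := (b :+ x :* p) :+ (c :+ x :* q)) refl
      (b 0) (c 0) x (ev n (b ∘ suc) x) (ev n (c ∘ suc) x))

  ev-* : ∀ n a c x → ev n (λ k → a * c k) x ≈ a * ev n c x
  ev-* zero    a c x = sym (zeroʳ a)
  ev-* (suc n) a c x = trans (+-congˡ (*-congˡ (ev-* n a (c ∘ suc) x)))
    (solve 4 (λ a c x p → a :* c :+ x :* (a :* p) := a :* (c :+ x :* p)) refl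
      a (c 0) x (ev n (c ∘ suc) x))

  evθ-* : ∀ n a c x → evθ n (λ k → a * c k) x ≈ a * evθ n c x
  evθ-* zero    a c x = sym (zeroʳ a)
  evθ-* (suc n) a c x = trans (*-congˡ (+-cong (ev-* n a (c ∘ suc) x) (evθ-* n a (c ∘ suc) x)))
    (solve 4 (λ a p q x → x :* (a :* p :+ a :* q) := a :* (x :* (p :+ q))) refl
      a (ev n (c ∘ suc) x) (evθ n (c ∘ suc) x) x)

  evθ-+ : ∀ n b c x → evθ n (λ k → b k + c k) x ≈ evθ n b x + evθ n c x
  evθ-+ zero    b c x = sym (+-identityˡ 0#)
  evθ-+ (suc n) b c x =
    trans (*-congˡ (+-cong (ev-+ n (b ∘ suc) (c ∘ suc) x) (evθ-+ n (b ∘ suc) (c ∘ suc) x)))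
      (solve 5 (λ x p q s t → x :* ((p :+ q) :+ (s :+ t)) := x :* (p :+ s) :+ x :* (q :+ t)) refl
        x (ev n (b ∘ suc) x) (ev n (c ∘ suc) x) (evθ n (b ∘ suc) x) (evθ n (c ∘ suc) x))

  ev-alt : ∀ i n c x → ev n (alt i ∘ c) x ≈ alt i (ev n c x)
  ev-alt i zero    c x = sym (alt-0 i)
  ev-alt i (suc n) c x = trans (+-congˡ (trans (*-congˡ (ev-alt i n (c ∘ suc) x))
    (sym (alt-* i x _)))) (sym (alt-+ i _ _))

  ev-last : ∀ n c x → c n ≈ 0# → ev (suc n) c x ≈ ev n c x
  ev-last zero    c x e = trans (+-cong e (zeroʳ x)) (+-identityˡ 0#)
  ev-last (suc n) c x e = +-congˡ (*-congˡ (ev-last n (c ∘ suc) x e))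

  evθ-last : ∀ n c x → c n ≈ 0# → evθ (suc n) c x ≈ evθ n c x
  evθ-last zero    c x e = trans (*-congˡ (+-identityˡ 0#)) (zeroʳ x)
  evθ-last (suc n) c x e =
    *-congˡ (+-cong (ev-last n (c ∘ suc) x e) (evθ-last n (c ∘ suc) x e))

  -- Products of linear factors

  x-w*0 : ∀ x w → x - w * 0# ≈ x
  x-w*0 x w = trans (+-congˡ (-‿cong (trans (zeroʳ w) (sym (-‿inverseʳ 0#)))))
    (solve 2 (λ x o → x :- (o :- o) := x) refl x 0#)

  0-w*0 : ∀ w → 0# - w * 0# ≈ 0#
  0-w*0 = x-w*0 0#

  ev-shift : ∀ n w b x →
    ev n (λ k → b k - w * b (suc k)) x ≈ ev n b x - w * ev n (b ∘ suc) x
  ev-shift n w b x = begin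
    ev n (λ k → b k - w * b (suc k)) x       ≈⟨ ev-cong n x (λ k → +-congˡ (neg (b (suc k)))) ⟩
    ev n (λ k → b k + (- w) * b (suc k)) x   ≈⟨ ev-+ n b _ x ⟩
    ev n b x + ev n (λ k → (- w) * b (suc k)) x ≈⟨ +-congˡ (ev-* n (- w) (b ∘ suc) x) ⟩
    ev n b x + (- w) * ev n (b ∘ suc) x      ≈⟨ +-congˡ (neg _) ⟨
    ev n b x - w * ev n (b ∘ suc) x          ∎
    where
    neg : ∀ y → - (w * y) ≈ (- w) * y
    neg y = solve 2 (λ w y → :- (w :* y) := (:- w) :* y) refl w y

  evθ-shift : ∀ n w b x →
    evθ n (λ k → b k - w * b (suc k)) x ≈ evθ n b x - w * evθ n (b ∘ suc) x
  evθ-shift n w b x = begin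
    evθ n (λ k → b k - w * b (suc k)) x       ≈⟨ evθ-cong n x (λ k → +-congˡ (neg (b (suc k)))) ⟩
    evθ n (λ k → b k + (- w) * b (suc k)) x   ≈⟨ evθ-+ n b _ x ⟩
    evθ n b x + evθ n (λ k → (- w) * b (suc k)) x ≈⟨ +-congˡ (evθ-* n (- w) (b ∘ suc) x) ⟩
    evθ n b x + (- w) * evθ n (b ∘ suc) x      ≈⟨ +-congˡ (neg _) ⟨
    evθ n b x - w * evθ n (b ∘ suc) x          ∎
    where
    neg : ∀ y → - (w * y) ≈ (- w) * y
    neg y = solve 2 (λ w y → :- (w :* y) := (:- w) :* y) refl w y

  timesLinear : Carrier → (ℕ → Carrier) → ℕ → Carrier
  timesLinear w b zero    = - (w * b 0)
  timesLinear w b (suc k) = b k - w * b (suc k)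

  -- Follows the recursion of `∏[x-_]`, but on sequences, whose entries can be indexed without
  -- bounds; `π≡∏` translates in the end.
  π : (ℕ → Carrier) → ℕ → ℕ → Carrier
  π z zero    zero    = 1#
  π z zero    (suc k) = 0#
  π z (suc N) k       = timesLinear (z 0) (π (z ∘ suc) N) k

  π-vanishes : ∀ z N k → N ℕ.< k → π z N k ≈ 0#
  π-vanishes z zero    (suc k) _         = refl
  π-vanishes z (suc N) (suc k) (s≤s N<k) = trans
    (+-cong (π-vanishes _ N k N<k) (-‿cong (*-congˡ (π-vanishes _ N (suc k) (ℕₚ.m<n⇒m<1+n N<k)))))
    (0-w*0 (z 0))

  π-lead : ∀ z N → π z N N ≈ 1#
  π-lead z zero    = refl
  π-lead z (suc N) = trans
    (+-cong (π-lead _ N) (-‿cong (*-congˡ (π-vanishes _ N (suc N) ℕₚ.≤-refl))))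
    (x-w*0 1# (z 0))

  ev-timesLinear : ∀ n w b x → b n ≈ 0# → ev (suc n) (timesLinear w b) x ≈ (x - w) * ev n b x
  ev-timesLinear n w b x e = begin
    - (w * b 0) + x * ev n (λ k → b k - w * b (suc k)) x
      ≈⟨ +-congˡ (*-congˡ (ev-shift n w b x)) ⟩
    - (w * b 0) + x * (ev n b x - w * ev n (b ∘ suc) x)
      ≈⟨ solve 5 (λ w b x p q → (:- (w :* b)) :+ x :* (p :- w :* q) := x :* p :- w :* (b :+ x :* q))
           refl w (b 0) x (ev n b x) (ev n (b ∘ suc) x) ⟩
    x * ev n b x - w * ev (suc n) b x
      ≈⟨ +-congˡ (-‿cong (*-congˡ (ev-last n b x e))) ⟩
    x * ev n b x - w * ev n b x
      ≈⟨ solve 3 (λ x w p → x :* p :- w :* p := (x :- w) :* p) refl x w (ev n b x) ⟩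
    (x - w) * ev n b x ∎

  evθ-timesLinear : ∀ n w b x → b n ≈ 0# →
    evθ (suc n) (timesLinear w b) x ≈ x * ev n b x + (x - w) * evθ n b x
  evθ-timesLinear n w b x e = begin
    x * (ev n (λ k → b k - w * b (suc k)) x + evθ n (λ k → b k - w * b (suc k)) x)
      ≈⟨ *-congˡ (+-cong (ev-shift n w b x) (evθ-shift n w b x)) ⟩
    x * ((ev n b x - w * ev n (b ∘ suc) x) + (evθ n b x - w * evθ n (b ∘ suc) x))
      ≈⟨ solve 6 (λ x w p q s t → x :* ((p :- w :* q) :+ (s :- w :* t))
           := x :* p :+ (x :* s :- w :* (x :* (q :+ t)))) refl
           x w (ev n b x) (ev n (b ∘ suc) x) (evθ n b x) (evθ n (b ∘ suc) x) ⟩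
    x * ev n b x + (x * evθ n b x - w * evθ (suc n) b x)
      ≈⟨ +-congˡ (+-congˡ (-‿cong (*-congˡ (evθ-last n b x e)))) ⟩
    x * ev n b x + (x * evθ n b x - w * evθ n b x)
      ≈⟨ solve 4 (λ x w p s → x :* p :+ (x :* s :- w :* s) := x :* p :+ (x :- w) :* s) refl
           x w (ev n b x) (evθ n b x) ⟩
    x * ev n b x + (x - w) * evθ n b x ∎

  PV : (ℕ → Carrier) → ℕ → Carrier → Carrier
  PV z zero    x = 1#
  PV z (suc N) x = (x - z 0) * PV (z ∘ suc) N x

  -- The product rule for θ, with θ (x - z₀) = x.
  PΘ : (ℕ → Carrier) → ℕ → Carrier → Carrier
  PΘ z zero    x = 0#
  PΘ z (suc N) x = x * PV (z ∘ suc) N x + (x - z 0) * PΘ (z ∘ suc) N x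

  ev-π : ∀ z N x → ev (suc N) (π z N) x ≈ PV z N x
  ev-π z zero    x = trans (+-congˡ (zeroʳ x)) (+-identityʳ 1#)
  ev-π z (suc N) x = trans
    (ev-timesLinear (suc N) (z 0) (π (z ∘ suc) N) x (π-vanishes _ N (suc N) ℕₚ.≤-refl))
    (*-congˡ (ev-π (z ∘ suc) N x))

  evθ-π : ∀ z N x → evθ (suc N) (π z N) x ≈ PΘ z N x
  evθ-π z zero    x = trans (*-congˡ (+-identityˡ 0#)) (zeroʳ x)
  evθ-π z (suc N) x = trans
    (evθ-timesLinear (suc N) (z 0) (π (z ∘ suc) N) x (π-vanishes _ N (suc N) ℕₚ.≤-refl))
    (+-cong (*-congˡ (ev-π (z ∘ suc) N x)) (*-congˡ (evθ-π (z ∘ suc) N x)))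

  PV-zero : ∀ z N i → i ℕ.< N → PV z N (z i) ≈ 0#
  PV-zero z (suc N) zero    _         = trans (*-congʳ (-‿inverseʳ (z 0))) (zeroˡ _)
  PV-zero z (suc N) (suc i) (s≤s i<N) = trans (*-congˡ (PV-zero (z ∘ suc) N i i<N)) (zeroʳ _)

  -- The first `i` factors occur with reversed sign, which `alt i` compensates. The predicate is
  -- abstract in order to treat strict and weak signs at once.
  PV-sign : (P : Carrier → Set) → (∀ {x y} → x ≈ y → P x → P y) → P 1# →
    (∀ {x y} → P x → P y → P (x * y)) → ∀ z N x i → i ℕ.≤ N →
    (∀ k → k ℕ.< i → P (z k - x)) → (∀ k → i ℕ.≤ k → k ℕ.< N → P (x - z k)) →
    P (alt i (PV z N x))
  PV-sign P resp one mul z zero    x zero _ _ _ = one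
  PV-sign P resp one mul z (suc N) x zero _ above below =
    mul (below 0 z≤n (s≤s z≤n))
      (PV-sign P resp one mul (z ∘ suc) N x zero z≤n (λ k ()) (λ k _ k<N → below (suc k) z≤n (s≤s k<N)))
  PV-sign P resp one mul z (suc N) x (suc i) (s≤s i≤N) above below =
    resp (trans (solve 3 (λ a x p → (a :- x) :* p := :- ((x :- a) :* p)) refl (z 0) x _)
           (-‿cong (sym (alt-* i (x - z 0) _))))
      (mul (above 0 (s≤s z≤n))
        (PV-sign P resp one mul (z ∘ suc) N x i i≤N (λ k k<i → above (suc k) (s≤s k<i))
          (λ k i≤k k<N → below (suc k) (s≤s i≤k) (s≤s k<N))))

  PV-pos : ∀ z N x i → i ℕ.≤ N → (∀ k → k ℕ.< i → x < z k) →
    (∀ k → i ℕ.≤ k → k ℕ.< N → z k < x) → 0# < alt i (PV z N x)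
  PV-pos z N x i i≤N above below = PV-sign (0# <_) <-respʳ 0<1 *-pos z N x i i≤N
    (λ k k<i → <⇒0<- (above k k<i)) (λ k i≤k k<N → <⇒0<- (below k i≤k k<N))

  PV-nonNeg : ∀ z N x i → i ℕ.≤ N → (∀ k → k ℕ.< i → x ≤ z k) →
    (∀ k → i ℕ.≤ k → k ℕ.< N → z k ≤ x) → 0# ≤ alt i (PV z N x)
  PV-nonNeg z N x i i≤N above below = PV-sign (0# ≤_) ≤-respʳ (<⇒≤ 0<1) *-nonNeg z N x i i≤N
    (λ k k<i → ≤⇒0≤- (above k k<i)) (λ k i≤k k<N → ≤⇒0≤- (below k i≤k k<N))

  Decreasing : (ℕ → Carrier) → ℕ → Set
  Decreasing z N = ∀ i j → i ℕ.< j → j ℕ.< N → z j < z i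

  Decreasing-suc : ∀ {z N} → Decreasing z (suc N) → Decreasing (z ∘ suc) N
  Decreasing-suc dec i j i<j j<N = dec (suc i) (suc j) (s≤s i<j) (s≤s j<N)

  Decreasing-≤ : ∀ {z N} → Decreasing z N → ∀ i j → i ℕ.≤ j → j ℕ.< N → z j ≤ z i
  Decreasing-≤ {z} dec i j i≤j j<N with ℕₚ.m≤n⇒m<n∨m≡n i≤j
  ... | inj₁ i<j    = <⇒≤ (dec i j i<j j<N)
  ... | inj₂ ≡.refl = ≤-refl

  decreasing : ∀ z N → (∀ i → suc i ℕ.< N → z (suc i) < z i) → Decreasing z N
  decreasing z N step i (suc j) (s≤s i≤j) j<N with ℕₚ.m≤n⇒m<n∨m≡n i≤j
  ... | inj₁ i<j    = <-trans (step j j<N) (decreasing z N step i j i<j (ℕₚ.<-trans ℕₚ.≤-refl j<N))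
  ... | inj₂ ≡.refl = step j j<N

  -- At a zero only the summand that differentiates its own factor survives, so θP has the value z_i
  -- ∏ (z_i - z_j) over j ≠ i. The i larger zeros and the negative factor z_i make i + 1 sign
  -- changes.
  PΘ-sign : ∀ z N i → Decreasing z N → i ℕ.< N → z i < 0# → 0# < alt (suc i) (PΘ z N (z i))
  PΘ-sign z (suc N) zero dec _ z<0 = <-respʳ
    (trans (solve 2 (λ x p → (:- x) :* p := :- (x :* p)) refl (z 0) _)
      (-‿cong (sym (trans (+-congˡ (trans (*-congʳ (-‿inverseʳ (z 0))) (zeroˡ _))) (+-identityʳ _)))))
    (*-pos (<0⇒0<- z<0) (PV-pos (z ∘ suc) N (z 0) 0 z≤n (λ k ()) (λ k _ k<N → dec 0 (suc k) (s≤s z≤n) (s≤s k<N))))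
  PΘ-sign z (suc N) (suc i) dec (s≤s i<N) z<0 = <-respʳ (begin
      (z 0 - x) * alt (suc i) p
        ≈⟨ solve 3 (λ a x p → (a :- x) :* p := :- ((x :- a) :* p)) refl (z 0) x (alt (suc i) p) ⟩
      - ((x - z 0) * alt (suc i) p)
        ≈⟨ -‿cong (sym (alt-* (suc i) (x - z 0) p)) ⟩
      alt (suc (suc i)) ((x - z 0) * p)
        ≈⟨ alt-cong (suc (suc i)) (sym (trans (+-congʳ (trans (*-congˡ (PV-zero (z ∘ suc) N i i<N)) (zeroʳ x)))
             (+-identityˡ _))) ⟩
      alt (suc (suc i)) (PΘ z (suc N) x) ∎)
    (*-pos (<⇒0<- (dec 0 (suc i) (s≤s z≤n) (s≤s i<N)))
      (PΘ-sign (z ∘ suc) N i (Decreasing-suc dec) i<N z<0))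
    where
    x = z (suc i)
    p = PΘ (z ∘ suc) N x

  -- Factorisation

  -- The quotient of Horner's division by X - w; n is the number of coefficients.
  quotient : ℕ → (ℕ → Carrier) → Carrier → ℕ → Carrier
  quotient zero    c w k       = 0#
  quotient (suc n) c w zero    = ev n (c ∘ suc) w
  quotient (suc n) c w (suc k) = quotient n (c ∘ suc) w k

  quotient-vanishes : ∀ n c w k → n ℕ.≤ suc k → quotient n c w k ≈ 0#
  quotient-vanishes zero          c w k       _         = refl
  quotient-vanishes (suc zero)    c w zero    _         = refl
  quotient-vanishes (suc n)       c w (suc k) (s≤s n≤k) = quotient-vanishes n (c ∘ suc) w k n≤k
  quotient-vanishes (suc (suc n)) c w zero    (s≤s ())

  coeff₀ : ∀ n c w → c 0 ≈ ev (suc n) c w - w * quotient (suc n) c w 0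
  coeff₀ n c w = solve 3 (λ a w p → a := (a :+ w :* p) :- w :* p) refl (c 0) w (ev n (c ∘ suc) w)

  coeff₊ : ∀ n c w → (∀ k → n ℕ.≤ k → c k ≈ 0#) → ∀ k →
    c (suc k) ≈ quotient n c w k - w * quotient n c w (suc k)
  coeff₊ zero          c w v k       = trans (v (suc k) z≤n) (sym (0-w*0 w))
  coeff₊ (suc zero)    c w v zero    = trans (v 1 (s≤s z≤n)) (sym (0-w*0 w))
  coeff₊ (suc (suc n)) c w v zero    = coeff₀ n (c ∘ suc) w
  coeff₊ (suc n)       c w v (suc k) = coeff₊ n (c ∘ suc) w (λ j n≤j → v (suc j) (s≤s n≤j)) k

  ev-quotient : ∀ n c w x →
    ev (suc n) c x ≈ ev (suc n) c w + (x - w) * ev n (quotient (suc n) c w) x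
  ev-quotient zero    c w x = trans (+-congˡ (zeroʳ x))
    (sym (trans (+-cong (+-congˡ (zeroʳ w)) (zeroʳ _)) (+-identityʳ _)))
  ev-quotient (suc n) c w x = trans (+-congˡ (*-congˡ (ev-quotient n (c ∘ suc) w x)))
    (solve 5 (λ a x w A B → a :+ x :* (A :+ (x :- w) :* B) := (a :+ w :* A) :+ (x :- w) :* (A :+ x :* B))
      refl (c 0) x w (ev (suc n) (c ∘ suc) w) (ev n (quotient (suc n) (c ∘ suc) w) x))

  -- The factor theorem, iterated. The quotient inherits the remaining zeros because each z_(i+1) -
  -- z_0 is strictly negative and can be cancelled.
  factorise : ∀ N z c → Decreasing z N → (∀ k → N ℕ.< k → c k ≈ 0#) →
    (∀ i → i ℕ.< N → ev (suc N) c (z i) ≈ 0#) → ∀ k → c k ≈ c N * π z N k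
  factorise zero    z c dec v roots zero    = sym (*-identityʳ _)
  factorise zero    z c dec v roots (suc k) = trans (v (suc k) (s≤s z≤n)) (sym (zeroʳ _))
  factorise (suc N) z c dec v roots = coeffs
    where
    w = z 0
    q = quotient (suc (suc N)) c w

    q-vanishes : ∀ k → N ℕ.< k → q k ≈ 0#
    q-vanishes k N<k = quotient-vanishes (suc (suc N)) c w k (s≤s N<k)

    c-suc : ∀ k → c (suc k) ≈ q k - w * q (suc k)
    c-suc = coeff₊ (suc (suc N)) c w v

    q-roots : ∀ i → i ℕ.< N → ev (suc N) q (z (suc i)) ≈ 0#
    q-roots i i<N = *-cancel-neg
      (<-resp-≈ refl (-‿inverseʳ w)
        (<-resp-≈ (+-comm (- w) _) (+-comm (- w) w) (+-monoʳ-< (- w) (dec 0 (suc i) (s≤s z≤n) (s≤s i<N)))))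
      (begin
        (z (suc i) - w) * ev (suc N) q (z (suc i)) ≈⟨ +-identityˡ _ ⟨
        0# + (z (suc i) - w) * ev (suc N) q (z (suc i)) ≈⟨ +-congʳ (roots 0 (s≤s z≤n)) ⟨
        ev (suc (suc N)) c w + (z (suc i) - w) * ev (suc N) q (z (suc i))
          ≈⟨ ev-quotient (suc N) c w (z (suc i)) ⟨
        ev (suc (suc N)) c (z (suc i)) ≈⟨ roots (suc i) (s≤s i<N) ⟩
        0# ∎)

    q≈ : ∀ k → q k ≈ q N * π (z ∘ suc) N k
    q≈ = factorise N (z ∘ suc) q (Decreasing-suc dec) q-vanishes q-roots

    lead : q N ≈ c (suc N)
    lead = sym (trans (c-suc N) (trans (+-congˡ (-‿cong (*-congˡ (q-vanishes (suc N) ℕₚ.≤-refl)))) (x-w*0 (q N) w)))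

    coeffs : ∀ k → c k ≈ c (suc N) * π z (suc N) k
    coeffs zero = begin
      c 0                                            ≈⟨ coeff₀ (suc N) c w ⟩
      ev (suc (suc N)) c w - w * q 0                 ≈⟨ +-cong (roots 0 (s≤s z≤n)) (-‿cong (*-congˡ (q≈ 0))) ⟩
      0# - w * (q N * π (z ∘ suc) N 0)               ≈⟨ +-identityˡ _ ⟩
      - (w * (q N * π (z ∘ suc) N 0))
        ≈⟨ solve 3 (λ w a p → :- (w :* (a :* p)) := a :* (:- (w :* p))) refl w (q N) (π (z ∘ suc) N 0) ⟩
      q N * - (w * π (z ∘ suc) N 0)                  ≈⟨ *-congʳ lead ⟩
      c (suc N) * - (w * π (z ∘ suc) N 0)            ∎
    coeffs (suc k) = begin
      c (suc k)                                      ≈⟨ c-suc k ⟩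
      q k - w * q (suc k)                            ≈⟨ +-cong (q≈ k) (-‿cong (*-congˡ (q≈ (suc k)))) ⟩
      q N * π (z ∘ suc) N k - w * (q N * π (z ∘ suc) N (suc k))
        ≈⟨ solve 4 (λ w a p s → a :* p :- w :* (a :* s) := a :* (p :- w :* s)) refl
             w (q N) (π (z ∘ suc) N k) (π (z ∘ suc) N (suc k)) ⟩
      q N * (π (z ∘ suc) N k - w * π (z ∘ suc) N (suc k)) ≈⟨ *-congʳ lead ⟩
      c (suc N) * (π (z ∘ suc) N k - w * π (z ∘ suc) N (suc k)) ∎

-- Coefficients of iterated first order steps

module Coefficients (r : ℕ) where

  -- With E = Σ c_k x^k of degree d, the polynomial
  --   r x (1 - x) E′ + (a + (r d + e) x) E.
  Dop : ℕ → ℕ → ℕ → (ℕ → ℤ) → ℕ → ℤ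
  Dop a e d c zero    = + a ℤ.* c 0
  Dop a e d c (suc k) = (+ r ℤ.* + suc k ℤ.+ + a) ℤ.* c (suc k)
                  ℤ.+ (+ r ℤ.* (+ d ℤ.- + k) ℤ.+ + e) ℤ.* c k

  δ : ℕ → ℤ
  δ zero    = 1ℤ
  δ (suc k) = 0ℤ

  -- A pair (a , e) stands for the step with parameters suc a and suc e, so
  -- that both are positive.
  coef : List (ℕ × ℕ) → ℕ → ℤ
  coef []            = δ
  coef ((a , e) ∷ T) = Dop (suc a) (suc e) (length T) (coef T)

  Dop-vanishes : ∀ a e d c → (∀ k → d ℕ.< k → c k ≡ 0ℤ) → ∀ k → suc d ℕ.< k → Dop a e d c k ≡ 0ℤ
  Dop-vanishes a e d c v (suc k) (s≤s d<k)
    rewrite v (suc k) (ℕₚ.m<n⇒m<1+n d<k) | v k d<k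
          | ℤₚ.*-zeroʳ (+ r ℤ.* + suc k ℤ.+ + a) | ℤₚ.*-zeroʳ (+ r ℤ.* (+ d ℤ.- + k) ℤ.+ + e) = ≡.refl

  coef-vanishes : ∀ T k → length T ℕ.< k → coef T k ≡ 0ℤ
  coef-vanishes []            (suc k) _ = ≡.refl
  coef-vanishes ((a , e) ∷ T) k       p = Dop-vanishes (suc a) (suc e) (length T) (coef T) (coef-vanishes T) k p

  -- At the top index the weight r (d - k) vanishes and only `e` is left; a positive `e` thus raises
  -- the degree by exactly one.
  Dop-lead : ∀ a e d c → c (suc d) ≡ 0ℤ → Dop a e d c (suc d) ≡ + e ℤ.* c d
  Dop-lead a e d c v rewrite v | ℤₚ.*-zeroʳ (+ r ℤ.* + suc d ℤ.+ + a) | ℤₚ.+-inverseʳ (+ d)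
    | ℤₚ.*-zeroʳ (+ r) | ℤₚ.+-identityˡ (+ e) | ℤₚ.+-identityˡ (+ e ℤ.* c d) = ≡.refl

  positive-* : ∀ n {i} → 0ℤ ℤ.< i → 0ℤ ℤ.< + suc n ℤ.* i
  positive-* n {+ suc i} _ = ℤ.+<+ (s≤s z≤n)
  positive-* n {+ 0} (ℤ.+<+ ())

  coef-lead : ∀ T → 0ℤ ℤ.< coef T (length T)
  coef-lead []            = ℤ.+<+ (s≤s z≤n)
  coef-lead ((a , e) ∷ T) = ≡.subst (0ℤ ℤ.<_)
    (≡.sym (Dop-lead (suc a) (suc e) (length T) (coef T) (coef-vanishes T _ ℕₚ.≤-refl)))
    (positive-* e (coef-lead T))

  coef-const : ∀ T → 0ℤ ℤ.< coef T 0
  coef-const []            = ℤ.+<+ (s≤s z≤n)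
  coef-const ((a , e) ∷ T) = positive-* a (coef-const T)

-- Polynomials with integer coefficients

module IntegerPolynomials (𝓡 : HeytingRing) where
  open Order 𝓡
  open Polynomials 𝓡

  evℤ : ℕ → (ℕ → ℤ) → Carrier → Carrier
  evℤ n c x = ev n (ι ∘ c) x

  ι-suc : ∀ k → ι (+ suc k) ≈ 1# + ι (+ k)
  ι-suc k = trans (ι-+ 1ℤ (+ k)) (+-congʳ ι-1)

  ι-≤ : ∀ {m n} → m ℕ.≤ n → 0# ≤ ι (+ n) - ι (+ m)
  ι-≤ {m} {n} m≤n = ≤-respʳ (begin
    ι (+ (n ℕ.∸ m))                    ≈⟨ solve 2 (λ a b → a := (b :+ a) :- b) refl _ (ι (+ m)) ⟩
    (ι (+ m) + ι (+ (n ℕ.∸ m))) - ι (+ m) ≈⟨ +-congʳ (ι-+ (+ m) (+ (n ℕ.∸ m))) ⟨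
    ι (+ (m ℕ.+ (n ℕ.∸ m))) - ι (+ m)  ≈⟨ +-congʳ (reflexive (≡.cong (ι ∘ +_) (ℕₚ.m+[n∸m]≡n m≤n))) ⟩
    ι (+ n) - ι (+ m)                  ∎) (0≤ι (n ℕ.∸ m))

  evθ-ev : ∀ n c x → evθ n c x ≈ ev n (λ k → ι (+ k) * c k) x
  evθ-ev zero    c x = refl
  evθ-ev (suc n) c x = begin
    x * (ev n (c ∘ suc) x + evθ n (c ∘ suc) x)
      ≈⟨ *-congˡ (+-congˡ (evθ-ev n (c ∘ suc) x)) ⟩
    x * (ev n (c ∘ suc) x + ev n (λ k → ι (+ k) * c (suc k)) x)
      ≈⟨ *-congˡ (ev-+ n (c ∘ suc) _ x) ⟨
    x * ev n (λ k → c (suc k) + ι (+ k) * c (suc k)) x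
      ≈⟨ *-congˡ (ev-cong n x (λ k → trans
           (solve 2 (λ i c → c :+ i :* c := (con 1ℤ :+ i) :* c) refl (ι (+ k)) (c (suc k)))
           (*-congʳ (trans (+-congʳ ι-1) (sym (ι-suc k)))))) ⟩
    x * ev n (λ k → ι (+ suc k) * c (suc k)) x
      ≈⟨ +-identityˡ _ ⟨
    0# + x * ev n (λ k → ι (+ suc k) * c (suc k)) x
      ≈⟨ +-congʳ (trans (*-congʳ ι-0) (zeroˡ _)) ⟨
    ι (+ 0) * c 0 + x * ev n (λ k → ι (+ suc k) * c (suc k)) x ∎

  -- Behaviour at -∞

  alt-neg : ∀ j x → alt j (- x) ≈ - alt j x
  alt-neg zero    x = refl
  alt-neg (suc j) x = -‿cong (alt-neg j x)

  ∣∣+alt-nonNeg : ∀ j c → 0# ≤ ι (+ ℤ.∣ c ∣) + alt j (ι c)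
  ∣∣+alt-nonNeg zero (+ n)    = +-nonNeg (0≤ι n) (0≤ι n)
  ∣∣+alt-nonNeg zero -[1+ n ] = ≤-respʳ (sym (trans (+-congˡ (ι-neg (+ suc n))) (-‿inverseʳ _))) ≤-refl
  ∣∣+alt-nonNeg (suc j) c = ≤-respʳ
    (+-cong (reflexive (≡.cong (ι ∘ +_) (ℤₚ.∣-i∣≡∣i∣ c))) (trans (alt-cong j (ι-neg c)) (alt-neg j (ι c))))
    (∣∣+alt-nonNeg j (ℤ.- c))

  ι-neg-mono : ∀ {m n} → m ℕ.≤ n → ι (ℤ.- (+ n)) ≤ ι (ℤ.- (+ m))
  ι-neg-mono m≤n with ℕₚ.m≤n⇒m<n∨m≡n m≤n
  ... | inj₁ m<n    = <⇒≤ (ι-mono-< (ℤₚ.neg-mono-< (ℤ.+<+ m<n)))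
  ... | inj₂ ≡.refl = ≤-refl

  -- Induction on Horner's form. If (-1)^N E ≥ 1 then (-1)^(N+1) (c₀ + x E) ≥ -x - |c₀| for negative
  -- x, which is at least 1 once x < -(|c₀| + 1). The bound 1, in place of mere positivity, carries
  -- the induction; it starts because a positive integer is at least 1.
  sign-at--∞ : ∀ N c → 0ℤ ℤ.< c N → ∃ λ M → ∀ x → x < ι (ℤ.- (+ M)) → 1# ≤ alt N (evℤ (suc N) c x)
  sign-at--∞ zero    c 0<c = 0 , λ x _ → ≤-respʳ (sym (trans (+-congˡ (zeroʳ x)) (+-identityʳ _)))
    (λ c<1 → ι-≤1 (c 0) 0<c (<-respʳ (sym ι-1) c<1))
    where
    ι-≤1 : ∀ i → 0ℤ ℤ.< i → ι 1ℤ ≤ ι i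
    ι-≤1 (+ suc zero)    _ = ≤-refl
    ι-≤1 (+ suc (suc n)) _ = <⇒≤ (ι-mono-< (ℤ.+<+ (s≤s (s≤s z≤n))))
    ι-≤1 (+ zero) (ℤ.+<+ ())
  sign-at--∞ (suc N) c 0<c with sign-at--∞ N (c ∘ suc) 0<c
  ... | M , bound = M ℕ.+ suc ℤ.∣ c 0 ∣ , λ x x<M → ≤-respʳ (sum x) (λ p →
      +-nonNeg (+-nonNeg (∣∣+alt-nonNeg (suc N) (c 0)) (<⇒≤ (gap x x<M)))
        (*-nonNeg (<⇒≤ (<0⇒0<- (neg x x<M)))
          (≤⇒0≤- (bound x (<-≤-trans x<M (ι-neg-mono (ℕₚ.m≤m+n M _))))))
        (<-resp-≈ (solve 2 (λ o g → (:- o) :+ (o :+ g) := g) refl 1# _) (-‿inverseˡ 1#) (+-monoʳ-< (- 1#) p)))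
    where
    K = ℤ.∣ c 0 ∣
    E : Carrier → Carrier
    E x = alt N (evℤ (suc N) (c ∘ suc) x)

    below : ∀ x → x < ι (ℤ.- (+ (M ℕ.+ suc K))) → x < ι (ℤ.- (+ suc K))
    below x x<M = <-≤-trans x<M (ι-neg-mono (ℕₚ.m≤n+m (suc K) M))

    neg : ∀ x → x < ι (ℤ.- (+ (M ℕ.+ suc K))) → x < 0#
    neg x x<M = <-trans (below x x<M) (<-respʳ ι-0 (ι-mono-< ℤ.-<+))

    gap : ∀ x → x < ι (ℤ.- (+ (M ℕ.+ suc K))) → 0# < (- x) - (1# + ι (+ K))
    gap x x<M = <-respʳ
      (trans (+-congʳ (trans (ι-neg (+ suc K)) (-‿cong (ι-suc K))))
        (+-comm (- (1# + ι (+ K))) (- x)))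
      (<⇒0<- (below x x<M))

    sum : ∀ x → 1# + (((ι (+ K) + alt (suc N) (ι (c 0))) + ((- x) - (1# + ι (+ K)))) + (- x) * (E x - 1#))
              ≈ alt (suc N) (evℤ (suc (suc N)) c x)
    sum x = begin
      1# + (((ι (+ K) + alt (suc N) (ι (c 0))) + ((- x) - (1# + ι (+ K)))) + (- x) * (E x - 1#))
        ≈⟨ +-cong refl (+-congˡ (trans (distribˡ (- x) (E x) (- 1#)) (+-congˡ
             (trans (solve 2 (λ x o → (:- x) :* (:- o) := x :* o) refl x 1#) (*-identityʳ x))))) ⟩
      1# + (((ι (+ K) + alt (suc N) (ι (c 0))) + ((- x) - (1# + ι (+ K)))) + ((- x) * E x + x))
        ≈⟨ solve 5 (λ o k a x e → o :+ (((k :+ a) :+ ((:- x) :- (o :+ k))) :+ ((:- x) :* e :+ x))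
             := a :+ :- (x :* e)) refl 1# (ι (+ K)) (alt (suc N) (ι (c 0))) x (E x) ⟩
      alt (suc N) (ι (c 0)) + - (x * E x)
        ≈⟨ +-congˡ (-‿cong (alt-* N x _)) ⟨
      alt (suc N) (ι (c 0)) + alt (suc N) (x * evℤ (suc N) (c ∘ suc) x)
        ≈⟨ alt-+ (suc N) (ι (c 0)) _ ⟨
      alt (suc N) (evℤ (suc (suc N)) c x) ∎

  below-all : ∀ N c → 0ℤ ℤ.< c N → ∀ y → ∃ λ x → x < y × 0# < alt N (evℤ (suc N) c x)
  below-all N c 0<c y with sign-at--∞ N c 0<c | archimedean y
  ... | M , bound | m , m<y = ι (ℤ.- (+ suc (m ℕ.+ M))) ,
    ≤-<-trans (ι-neg-mono (ℕₚ.m≤n⇒m≤1+n (ℕₚ.m≤m+n m M))) m<y ,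
    <-≤-trans 0<1 (bound _ (ι-mono-< (ℤₚ.neg-mono-< (ℤ.+<+ (s≤s (ℕₚ.m≤n+m M m))))))

module _ (𝓡 : HeytingRing) where
  open Order 𝓡
  open Polynomials 𝓡
  open IntegerPolynomials 𝓡

  -- With integer coefficients the values at rational points are rational, so that bisection can
  -- decide their signs.
  IntermediateValue : Set
  IntermediateValue = ∀ n (c : ℕ → ℤ) {l u} → l ≤ u → evℤ n c l < 0# → 0# < evℤ n c u →
    ∃ λ z → l < z × z < u × evℤ n c z ≈ 0#

-- Real-rootedness of the iterated steps

module Tower (𝓡 : HeytingRing) (ivt : IntermediateValue 𝓡) (r′ : ℕ) where
  open Order 𝓡
  open Polynomials 𝓡
  open IntegerPolynomials 𝓡
  r : ℕ
  r = suc r′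
  open Coefficients r

  altℤ : ℕ → ℤ → ℤ
  altℤ zero    c = c
  altℤ (suc i) c = ℤ.- altℤ i c

  ι-alt : ∀ i c → ι (altℤ i c) ≈ alt i (ι c)
  ι-alt zero    c = refl
  ι-alt (suc i) c = trans (ι-neg (altℤ i c)) (-‿cong (ι-alt i c))

  evℤ-alt : ∀ i n c x → evℤ n (altℤ i ∘ c) x ≈ alt i (evℤ n c x)
  evℤ-alt i n c x = trans (ev-cong n x (λ k → ι-alt i (c k))) (ev-alt i n (ι ∘ c) x)

  root-between : ∀ i n c {l u} → l ≤ u → 0# < alt (suc i) (evℤ n c l) → 0# < alt i (evℤ n c u) →
    ∃ λ z → l < z × z < u × evℤ n c z ≈ 0#
  root-between i n c {l} {u} l≤u l-sign u-sign
    with ivt n (altℤ i ∘ c) l≤u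
           (<-respˡ (sym (evℤ-alt i n c l)) (0<-⇒<0 l-sign))
           (<-respʳ (sym (evℤ-alt i n c u)) u-sign)
  ... | z , l<z , z<u , root = z , l<z , z<u , (begin
    evℤ n c z                           ≈⟨ alt-double i _ ⟨
    alt (i ℕ.+ i) (evℤ n c z)           ≈⟨ trans (alt-alt i i 1# _) (alt-cong (i ℕ.+ i) (*-identityˡ _)) ⟨
    alt i 1# * alt i (evℤ n c z)        ≈⟨ *-congˡ (trans (sym (evℤ-alt i n c z)) root) ⟩
    alt i 1# * 0#                       ≈⟨ zeroʳ _ ⟩
    0#                                  ∎)

  choose : {P : ℕ → Carrier → Set} → ∀ N → (∀ i → i ℕ.< N → ∃ (P i)) →
    ∃ λ (f : ℕ → Carrier) → ∀ i → i ℕ.< N → P i (f i)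
  choose {P} N h = f , f-P
    where
    f : ℕ → Carrier
    f i with i ℕₚ.<? N
    ... | yes i<N = proj₁ (h i i<N)
    ... | no  _   = 0#
    f-P : ∀ i → i ℕ.< N → P i (f i)
    f-P i i<N with i ℕₚ.<? N
    ... | yes i<N′ = proj₂ (h i i<N′)
    ... | no  i≮N  = ⊥-elim (i≮N i<N)

  roots-between : ∀ N n c (lo up : ℕ → Carrier) → (∀ i → i ℕ.< N → lo i ≤ up i) →
    (∀ i → i ℕ.< N → 0# < alt (suc i) (evℤ n c (lo i))) → (∀ i → i ℕ.< N → 0# < alt i (evℤ n c (up i))) →
    ∃ λ (z : ℕ → Carrier) → ∀ i → i ℕ.< N → lo i < z i × z i < up i × evℤ n c (z i) ≈ 0#
  roots-between N n c lo up lo≤up lo-sign up-sign = choose N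
    (λ i i<N → root-between i n c (lo≤up i i<N) (lo-sign i i<N) (up-sign i i<N))

  -- As above, with -∞ for the last of the lower nodes.
  roots-below : ∀ d c (lo up : ℕ → Carrier) → 0ℤ ℤ.< c (suc d) → (∀ i → i ℕ.< d → lo i ≤ up i) →
    (∀ i → i ℕ.< d → 0# < alt (suc i) (evℤ (suc (suc d)) c (lo i))) →
    (∀ i → i ℕ.< suc d → 0# < alt i (evℤ (suc (suc d)) c (up i))) →
    ∃ λ (z : ℕ → Carrier) → (∀ i → i ℕ.< d → lo i < z i) × (∀ i → i ℕ.< suc d → z i < up i) ×
      (∀ i → i ℕ.< suc d → evℤ (suc (suc d)) c (z i) ≈ 0#)
  roots-below d c lo up lead lo≤up lo-sign up-sign =
    z , lower , (λ i i<N → proj₁ (proj₂ (z-P i i<N))) , (λ i i<N → proj₂ (proj₂ (z-P i i<N)))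
    where
    B : ∃ λ x → x < up d × 0# < alt (suc d) (evℤ (suc (suc d)) c x)
    B = below-all (suc d) c lead (up d)

    lo′ : ℕ → Carrier
    lo′ i with i ℕₚ.<? d
    ... | yes _ = lo i
    ... | no  _ = proj₁ B

    lo′≡lo : ∀ i → i ℕ.< d → lo′ i ≡ lo i
    lo′≡lo i i<d with i ℕₚ.<? d
    ... | yes _   = ≡.refl
    ... | no  i≮d = ⊥-elim (i≮d i<d)

    lo′≤up : ∀ i → i ℕ.< suc d → lo′ i ≤ up i
    lo′≤up i (s≤s i≤d) with i ℕₚ.<? d
    ... | yes i<d = lo≤up i i<d
    ... | no  i≮d = ≡.subst (λ j → proj₁ B ≤ up j) (ℕₚ.≤-antisym (ℕₚ.≮⇒≥ i≮d) i≤d) (<⇒≤ (proj₁ (proj₂ B)))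

    lo′-sign : ∀ i → i ℕ.< suc d → 0# < alt (suc i) (evℤ (suc (suc d)) c (lo′ i))
    lo′-sign i (s≤s i≤d) with i ℕₚ.<? d
    ... | yes i<d = lo-sign i i<d
    ... | no  i≮d = ≡.subst (λ j → 0# < alt (suc j) (evℤ (suc (suc d)) c (proj₁ B)))
      (ℕₚ.≤-antisym (ℕₚ.≮⇒≥ i≮d) i≤d) (proj₂ (proj₂ B))

    chosen : ∃ λ (z : ℕ → Carrier) → ∀ i → i ℕ.< suc d →
      lo′ i < z i × z i < up i × evℤ (suc (suc d)) c (z i) ≈ 0#
    chosen = roots-between (suc d) (suc (suc d)) c lo′ up lo′≤up lo′-sign up-sign

    z : ℕ → Carrier
    z = proj₁ chosen

    z-P : ∀ i → i ℕ.< suc d → lo′ i < z i × z i < up i × evℤ (suc (suc d)) c (z i) ≈ 0#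
    z-P = proj₂ chosen

    lower : ∀ i → i ℕ.< d → lo i < z i
    lower i i<d = ≡.subst (_< z i) (lo′≡lo i i<d) (proj₁ (z-P i (ℕₚ.m<n⇒m<1+n i<d)))

  -- The step as r (1 - x) θP + β P, in terms of the values Θ of θP and C of P alone. The factor β
  -- is free, since the comparison of zeros also needs values other than `βcoef`.
  Dval : Carrier → Carrier → Carrier → Carrier → Carrier
  Dval β x Θ C = ι (+ r) * (1# - x) * Θ + β * C

  βcoef : ℕ → ℕ → ℕ → Carrier → Carrier
  βcoef a e d x = ι (+ a) + (ι (+ r) * ι (+ d) + ι (+ e)) * x

  ev-Dop : ∀ a e d c x → c (suc d) ≡ 0ℤ →
    evℤ (suc (suc d)) (Dop a e d c) x ≈ Dval (βcoef a e d x) x (evθ (suc d) (ι ∘ c) x) (evℤ (suc d) c x)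
  ev-Dop a e d c x v = begin
    ι (+ a ℤ.* c 0) + x * ev n (λ k → ι (Dop a e d c (suc k))) x
      ≈⟨ +-cong (ι-* (+ a) (c 0)) (*-congˡ (shifted n)) ⟩
    A * C₀ + x * (((R * E′ + R * Θ′) + A * E′) + (G * E + (- R) * Θ))
      ≈⟨ +-cong refl (trans (distribˡ x _ _) (+-cong (distribˡ x _ _) (distribˡ x _ _))) ⟩
    A * C₀ + ((x * (R * E′ + R * Θ′) + x * (A * E′)) + (x * (G * E) + x * ((- R) * Θ)))
      ≈⟨ +-cong refl (+-cong (+-cong
           (solve 4 (λ x r e θ → x :* (r :* e :+ r :* θ) := r :* (x :* (e :+ θ))) refl x R E′ Θ′)
           (solve 3 (λ x a e → x :* (a :* e) := a :* (x :* e)) refl x A E′))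
           (+-cong (solve 3 (λ x g e → x :* (g :* e) := (g :* x) :* e) refl x G E)
             (solve 3 (λ x r θ → x :* ((:- r) :* θ) := :- (r :* x :* θ)) refl x R Θ))) ⟩
    A * C₀ + ((R * evθ (suc n) C x + A * (x * E′)) + ((G * x) * E - R * x * Θ))
      ≈⟨ solve 5 (λ u p v w t → u :+ ((p :+ v) :+ (w :- t)) := (p :- t) :+ ((u :+ v) :+ w)) refl _ _ _ _ _ ⟩
    (R * evθ (suc n) C x - R * x * Θ) + ((A * C₀ + A * (x * E′)) + (G * x) * E)
      ≈⟨ +-congˡ (+-congʳ (distribˡ A C₀ (x * E′))) ⟨
    (R * evθ (suc n) C x - R * x * Θ) + (A * ev (suc n) C x + (G * x) * E)
      ≈⟨ +-cong (+-congʳ (*-congˡ (evθ-last n C x C-vanishes)))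
           (+-congʳ (*-congˡ (ev-last n C x C-vanishes))) ⟩
    (R * Θ - R * x * Θ) + (A * E + (G * x) * E)
      ≈⟨ +-cong (trans (+-congʳ (trans (sym (*-identityˡ _)) (sym (*-assoc 1# R Θ))))
           (solve 4 (λ o r x θ → o :* r :* θ :- r :* x :* θ := r :* (o :- x) :* θ) refl 1# R x Θ))
           (sym (distribʳ E A _)) ⟩
    Dval (βcoef a e d x) x Θ E ∎
    where
    n = suc d
    C = ι ∘ c
    C₀ = C 0
    A = ι (+ a)
    F = ι (+ e)
    R = ι (+ r)
    D = ι (+ d)
    G = R * D + F
    E = ev n C x
    Θ = evθ n C x
    E′ = ev n (C ∘ suc) x
    Θ′ = evθ n (C ∘ suc) x

    C-vanishes : C (suc d) ≈ 0#
    C-vanishes = trans (reflexive (≡.cong ι v)) ι-0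

    term : ∀ k → ι (Dop a e d c (suc k)) ≈
      ((R * C (suc k) + R * (ι (+ k) * C (suc k))) + A * C (suc k)) + (G * C k + (- R) * (ι (+ k) * C k))
    term k = begin
      ι (Dop a e d c (suc k))
        ≈⟨ ι-+ _ _ ⟩
      ι ((+ r ℤ.* + suc k ℤ.+ + a) ℤ.* c (suc k)) + ι ((+ r ℤ.* (+ d ℤ.- + k) ℤ.+ + e) ℤ.* c k)
        ≈⟨ +-cong (trans (ι-* _ _) (*-congʳ (trans (ι-+ _ _) (+-congʳ (trans (ι-* _ _) (*-congˡ (ι-suc k)))))))
             (trans (ι-* _ _) (*-congʳ (trans (ι-+ _ _) (+-congʳ (trans (ι-* _ _)
               (*-congˡ (trans (ι-+ _ _) (+-congˡ (ι-neg _))))))))) ⟩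
      (R * (1# + ι (+ k)) + A) * C (suc k) + (R * (D - ι (+ k)) + F) * C k
        ≈⟨ +-cong (trans (*-congʳ (+-congʳ (trans (distribˡ R 1# _) (+-congʳ (*-identityʳ R)))))
             (solve 4 (λ r k a c → (r :+ r :* k :+ a) :* c := (r :* c :+ r :* (k :* c)) :+ a :* c) refl
               R (ι (+ k)) A (C (suc k))))
             (solve 5 (λ r d k f c → (r :* (d :- k) :+ f) :* c := (r :* d :+ f) :* c :+ (:- r) :* (k :* c)) refl
               R D (ι (+ k)) F (C k)) ⟩
      ((R * C (suc k) + R * (ι (+ k) * C (suc k))) + A * C (suc k)) + (G * C k + (- R) * (ι (+ k) * C k)) ∎

    shifted : ∀ n → ev n (λ k → ι (Dop a e d c (suc k))) x ≈
      ((R * ev n (C ∘ suc) x + R * evθ n (C ∘ suc) x) + A * ev n (C ∘ suc) x)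
        + (G * ev n C x + (- R) * evθ n C x)
    shifted n = begin
      ev n (λ k → ι (Dop a e d c (suc k))) x ≈⟨ ev-cong n x term ⟩
      ev n (λ k → ((R * C (suc k) + R * (ι (+ k) * C (suc k))) + A * C (suc k))
                  + (G * C k + (- R) * (ι (+ k) * C k))) x
        ≈⟨ ev-+ n _ _ x ⟩
      ev n (λ k → (R * C (suc k) + R * (ι (+ k) * C (suc k))) + A * C (suc k)) x
        + ev n (λ k → G * C k + (- R) * (ι (+ k) * C k)) x
        ≈⟨ +-cong
             (trans (ev-+ n _ _ x) (+-cong
               (trans (ev-+ n _ _ x) (+-cong (ev-* n R _ x)
                 (trans (ev-* n R _ x) (*-congˡ (sym (evθ-ev n (C ∘ suc) x))))))
               (ev-* n A _ x)))
             (trans (ev-+ n _ _ x) (+-cong (ev-* n _ _ x)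
               (trans (ev-* n _ _ x) (*-congˡ (sym (evθ-ev n C x)))))) ⟩
      ((R * ev n (C ∘ suc) x + R * evθ n (C ∘ suc) x) + A * ev n (C ∘ suc) x)
        + (G * ev n C x + (- R) * evθ n C x) ∎

  record Zeros (T : List (ℕ × ℕ)) (z : ℕ → Carrier) : Set where
    field
      neg  : ∀ i → i ℕ.< length T → z i < 0#
      dec  : Decreasing z (length T)
      root : ∀ i → i ℕ.< length T → evℤ (suc (length T)) (coef T) (z i) ≈ 0#

    κ : Carrier
    κ = ι (coef T (length T))

    0<κ : 0# < κ
    0<κ = <-respˡ ι-0 (ι-mono-< (coef-lead T))

    private
      factored : ∀ k → ι (coef T k) ≈ κ * π z (length T) k
      factored = factorise (length T) z (ι ∘ coef T) dec
        (λ k d<k → trans (reflexive (≡.cong ι (coef-vanishes T k d<k))) ι-0) root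

    value : ∀ x → evℤ (suc (length T)) (coef T) x ≈ κ * PV z (length T) x
    value x = trans (ev-cong (suc (length T)) x factored)
      (trans (ev-* (suc (length T)) κ (π z (length T)) x) (*-congˡ (ev-π z (length T) x)))

    θ-value : ∀ x → evθ (suc (length T)) (ι ∘ coef T) x ≈ κ * PΘ z (length T) x
    θ-value x = trans (evθ-cong (suc (length T)) x factored)
      (trans (evθ-* (suc (length T)) κ (π z (length T)) x) (*-congˡ (evθ-π z (length T) x)))

    sign : ∀ x i → i ℕ.≤ length T → (∀ k → k ℕ.< i → x < z k) →
      (∀ k → i ℕ.≤ k → k ℕ.< length T → z k < x) → 0# < alt i (evℤ (suc (length T)) (coef T) x)
    sign x i i≤d above below = <-respʳ
      (trans (sym (alt-* i κ _)) (alt-cong i (sym (value x))))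
      (*-pos 0<κ (PV-pos z (length T) x i i≤d above below))

    weak-sign : ∀ x i → i ℕ.≤ length T → (∀ k → k ℕ.< i → x ≤ z k) →
      (∀ k → i ℕ.≤ k → k ℕ.< length T → z k ≤ x) → 0# ≤ alt i (evℤ (suc (length T)) (coef T) x)
    weak-sign x i i≤d above below = ≤-respʳ
      (trans (sym (alt-* i κ _)) (alt-cong i (sym (value x))))
      (*-nonNeg (<⇒≤ 0<κ) (PV-nonNeg z (length T) x i i≤d above below))

    Dop-value : ∀ a e x → evℤ (suc (suc (length T))) (Dop a e (length T) (coef T)) x ≈
      κ * Dval (βcoef a e (length T) x) x (PΘ z (length T) x) (PV z (length T) x)
    Dop-value a e x = trans (ev-Dop a e (length T) (coef T) x (coef-vanishes T _ ℕₚ.≤-refl))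
      (trans (+-cong (*-congˡ (θ-value x)) (*-congˡ (value x)))
        (solve 5 (λ g k θ b p → g :* (k :* θ) :+ b :* (k :* p) := k :* (g :* θ :+ b :* p)) refl
          (ι (+ r) * (1# - x)) κ (PΘ z (length T) x) (βcoef a e (length T) x) (PV z (length T) x)))

    -- At a zero of P the term β P drops out, and r (1 - x) is positive to the left of 0, so the
    -- sign is that of θP.
    Dop-sign : ∀ a e i → i ℕ.< length T →
      0# < alt (suc i) (evℤ (suc (suc (length T))) (Dop a e (length T) (coef T)) (z i))
    Dop-sign a e i i<d = <-respʳ (begin
        (κ * (ι (+ r) * (1# - x))) * alt (suc i) (PΘ z (length T) x)
          ≈⟨ alt-* (suc i) _ _ ⟨
        alt (suc i) ((κ * (ι (+ r) * (1# - x))) * PΘ z (length T) x)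
          ≈⟨ alt-cong (suc i) (trans (*-assoc _ _ _) (*-congˡ (trans (sym (+-identityʳ _))
               (+-congˡ (sym (trans (*-congˡ (PV-zero z _ i i<d)) (zeroʳ _))))))) ⟩
        alt (suc i) (κ * Dval (βcoef a e (length T) x) x (PΘ z (length T) x) (PV z (length T) x))
          ≈⟨ alt-cong (suc i) (Dop-value a e x) ⟨
        alt (suc i) (evℤ (suc (suc (length T))) (Dop a e (length T) (coef T)) x) ∎)
      (*-pos (*-pos 0<κ (*-pos (0<ι r′) (+-pos 0<1 (<0⇒0<- (neg i i<d))))) (PΘ-sign z _ i dec i<d (neg i i<d)))
      where x = z i

  record Interlace (z z′ : ℕ → Carrier) (d : ℕ) : Set where
    field
      lower : ∀ i → i ℕ.< d → z i < z′ i
      upper : ∀ i → i ℕ.< d → z′ (suc i) < z i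

  evℤ-at-0 : ∀ n c → evℤ (suc n) c 0# ≈ ι (c 0)
  evℤ-at-0 n c = trans (+-congˡ (zeroˡ _)) (+-identityʳ _)

  -- Rolle's argument: the signs of the new polynomial alternate along 0, z_0, ..., z_(d-1), -∞,
  -- which leaves a zero in each of the d + 1 gaps. The positive constant and leading coefficients
  -- supply the two outer signs.
  next-zeros : ∀ t T z → Zeros T z → ∃ λ z′ → Zeros (t ∷ T) z′ × Interlace z z′ (length T)
  next-zeros t@(a , e) T z Z = z′ ,
    record { neg = neg′ ; dec = decreasing z′ (suc d) dec′ ; root = proj₂ (proj₂ (proj₂ found)) } ,
    record { lower = lower′ ; upper = λ i i<d → upper′ (suc i) (s≤s i<d) }
    where
    open Zeros Z
    d = length T
    c′ = coef (t ∷ T)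

    node : ℕ → Carrier
    node zero    = 0#
    node (suc i) = z i

    node-sign : ∀ i → i ℕ.< suc d → 0# < alt i (evℤ (suc (suc d)) c′ (node i))
    node-sign zero    _         = <-resp-≈ ι-0 (sym (evℤ-at-0 (suc d) c′)) (ι-mono-< (coef-const (t ∷ T)))
    node-sign (suc i) (s≤s i<d) = Dop-sign (suc a) (suc e) i i<d

    node-dec : ∀ i → i ℕ.< d → z i ≤ node i
    node-dec zero    0<d = <⇒≤ (neg 0 0<d)
    node-dec (suc i) i<d = <⇒≤ (dec i (suc i) ℕₚ.≤-refl i<d)

    found : ∃ λ (z′ : ℕ → Carrier) → (∀ i → i ℕ.< d → z i < z′ i) × (∀ i → i ℕ.< suc d → z′ i < node i) ×
      (∀ i → i ℕ.< suc d → evℤ (suc (suc d)) c′ (z′ i) ≈ 0#)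
    found = roots-below d c′ z node (coef-lead (t ∷ T)) node-dec
      (λ i i<d → Dop-sign (suc a) (suc e) i i<d) node-sign

    z′ : ℕ → Carrier
    z′ = proj₁ found

    lower′ : ∀ i → i ℕ.< d → z i < z′ i
    lower′ = proj₁ (proj₂ found)

    upper′ : ∀ i → i ℕ.< suc d → z′ i < node i
    upper′ = proj₁ (proj₂ (proj₂ found))

    neg′ : ∀ i → i ℕ.< suc d → z′ i < 0#
    neg′ zero    i<d       = upper′ 0 i<d
    neg′ (suc i) (s≤s i<d) = <-trans (upper′ (suc i) (s≤s i<d)) (neg i i<d)

    dec′ : ∀ i → suc i ℕ.< suc d → z′ (suc i) < z′ i
    dec′ i (s≤s i<d) = <-trans (upper′ (suc i) (s≤s i<d)) (lower′ i i<d)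

  -- Opaque, since only the recorded properties of the zeros matter from here on and not how they
  -- were found.
  abstract
    step : ∀ t T z → Zeros T z → ∃ λ z′ → Zeros (t ∷ T) z′ × Interlace z z′ (length T)
    step = next-zeros

  mutual
    zeros : List (ℕ × ℕ) → ℕ → Carrier
    zeros []      = λ _ → 0#
    zeros (t ∷ T) = proj₁ (step t T (zeros T) (zeros-Zeros T))

    zeros-Zeros : ∀ T → Zeros T (zeros T)
    zeros-Zeros []      = record { neg = λ i () ; dec = λ i j _ () ; root = λ i () }
    zeros-Zeros (t ∷ T) = proj₁ (proj₂ (step t T (zeros T) (zeros-Zeros T)))

  interlace : ∀ t T → Interlace (zeros T) (zeros (t ∷ T)) (length T)
  interlace t T = proj₂ (proj₂ (step t T (zeros T) (zeros-Zeros T)))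

-- Monotonicity of the zeros in the parameters of the steps

module Comparison (𝓡 : HeytingRing) (ivt : IntermediateValue 𝓡) (r′ : ℕ) where
  open Order 𝓡
  open Polynomials 𝓡
  open IntegerPolynomials 𝓡
  open Tower 𝓡 ivt r′
  open Coefficients r

  square-nonNeg : ∀ x → 0# ≤ x * x
  square-nonNeg x xx<0 = <-irrefl (<-respˡ (trans (*-congʳ x≈0) (zeroˡ x)) xx<0)
    where
    x≈0 : x ≈ 0#
    x≈0 = <-tight (λ x<0 → <⇒≤ (*-neg-neg x<0 x<0) xx<0) (λ 0<x → <⇒≤ (*-pos 0<x 0<x) xx<0)

  *-cancel-pos : ∀ {x y} → 0# < x → x * y ≈ 0# → y ≈ 0#
  *-cancel-pos 0<x xy≈0 = <-tight
    (λ y<0 → <-irrefl (<-respˡ xy≈0 (*-pos-neg 0<x y<0)))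
    (λ 0<y → <-irrefl (<-respʳ xy≈0 (*-pos 0<x 0<y)))

  -- Either m = l or m = l + 1, with the surplus factor at the end: the two shapes in which P, with
  -- m factors, meets Q, with l factors.
  data Fits : ℕ → ℕ → Set where
    none : Fits 0 0
    one  : Fits 0 1
    suc  : ∀ {l m} → Fits l m → Fits (suc l) (suc m)

  fits-refl : ∀ l → Fits l l
  fits-refl zero    = none
  fits-refl (suc l) = suc (fits-refl l)

  fits-suc : ∀ l → Fits l (suc l)
  fits-suc zero    = one
  fits-suc (suc l) = suc (fits-suc l)

  -- For P = ∏(x - p_k) and Q = ∏(x - q_k) this says that Q′/Q ≤ P′/P at ρ < 0, provided that
  -- q_k ≤ p_k and that ρ is on the same side of both; divisions have been cleared.
  logDerivative-≤ : ∀ {l m} → Fits l m → ∀ p q {ρ} → ρ < 0# →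
    (∀ k → k ℕ.< l → 0# < (ρ - p k) * (ρ - q k)) → (∀ k → k ℕ.< l → q k ≤ p k) →
    (∀ k → l ℕ.≤ k → k ℕ.< m → p k ≤ ρ) →
    0# ≤ - ((PV p m ρ * PV q l ρ) * (PΘ p m ρ * PV q l ρ - PΘ q l ρ * PV p m ρ))
  logDerivative-≤ none p q {ρ} ρ<0 same q≤p extra = ≤-reflexive (sym
    (trans (-‿cong (trans (*-congˡ (trans (-‿inverseʳ (0# * 1#)) refl)) (zeroʳ _))) (alt-0 1)))
  -- The surplus factor contributes 1/(ρ - p_0) to P′/P, and p_0 lies to the left of ρ.
  logDerivative-≤ one p q {ρ} ρ<0 same q≤p extra = ≤-respʳ (begin
      (- ρ) * (ρ - p 0)
        ≈⟨ solve 2 (λ ρ a → (:- ρ) :* a := :- (a :* ρ)) refl ρ (ρ - p 0) ⟩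
      - ((ρ - p 0) * ρ)
        ≈⟨ -‿cong (*-cong (trans (*-identityʳ _) (*-identityʳ _))
             (trans (+-cong (trans (*-identityʳ _) (trans (+-cong (*-identityʳ ρ) (zeroʳ _)) (+-identityʳ ρ)))
               (trans (-‿cong (zeroˡ _)) (alt-0 1))) (+-identityʳ ρ))) ⟨
      - ((PV p 1 ρ * PV q 0 ρ) * (PΘ p 1 ρ * PV q 0 ρ - PΘ q 0 ρ * PV p 1 ρ)) ∎)
    (*-nonNeg (<⇒≤ (<0⇒0<- ρ<0)) (≤⇒0≤- (extra 0 z≤n (s≤s z≤n))))
  -- A further pair of factors adds 1/a - 1/b = (b - a)/(a b) to P′/P - Q′/Q, where b - a = p_0 -
  -- q_0. Clearing denominators multiplies the previous expression by (a b)².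
  logDerivative-≤ {suc l} {suc m} (suc f) p q {ρ} ρ<0 same q≤p extra = ≤-respʳ (begin
      ((a * b) * (a * b)) * (- ((P * Q) * (S * Q - T * P))) + (- ρ) * (((P * Q) * (P * Q)) * ((a * b) * (p 0 - q 0)))
        ≈⟨ +-congˡ (*-congˡ (*-congˡ (*-congˡ
             (solve 3 (λ p q ρ → p :- q := (ρ :- q) :- (ρ :- p)) refl (p 0) (q 0) ρ)))) ⟩
      ((a * b) * (a * b)) * (- ((P * Q) * (S * Q - T * P))) + (- ρ) * (((P * Q) * (P * Q)) * ((a * b) * (b - a)))
        ≈⟨ solve 5 (λ m x w ρ c → (m :* m) :* (:- (x :* w)) :+ (:- ρ) :* ((x :* x) :* (m :* c))
             := :- ((m :* x) :* (ρ :* (x :* c) :+ m :* w))) refl (a * b) (P * Q) (S * Q - T * P) ρ (b - a) ⟩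
      - (((a * b) * (P * Q)) * (ρ * ((P * Q) * (b - a)) + (a * b) * (S * Q - T * P)))
        ≈⟨ -‿cong (*-cong
             (solve 4 (λ a b P Q → (a :* b) :* (P :* Q) := (a :* P) :* (b :* Q)) refl a b P Q)
             (trans
               (+-cong (solve 5 (λ ρ P Q a b → ρ :* ((P :* Q) :* (b :- a)) := (ρ :* P) :* (b :* Q) :- (ρ :* Q) :* (a :* P))
                          refl ρ P Q a b)
                 (solve 6 (λ a b S Q T P → (a :* b) :* (S :* Q :- T :* P) := (a :* S) :* (b :* Q) :- (b :* T) :* (a :* P))
                    refl a b S Q T P))
               (solve 6 (λ u v w x y z → (u :* y :- v :* z) :+ (w :* y :- x :* z) := (u :+ w) :* y :- (v :+ x) :* z)
                  refl (ρ * P) (ρ * Q) (a * S) (b * T) (b * Q) (a * P)))) ⟩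
      - ((PV p (suc m) ρ * PV q (suc l) ρ) * (PΘ p (suc m) ρ * PV q (suc l) ρ - PΘ q (suc l) ρ * PV p (suc m) ρ)) ∎)
    (+-nonNeg
      (*-nonNeg (square-nonNeg (a * b)) (logDerivative-≤ f (p ∘ suc) (q ∘ suc) ρ<0 (λ k k<l → same (suc k) (s≤s k<l))
        (λ k k<l → q≤p (suc k) (s≤s k<l)) (λ k l≤k k<m → extra (suc k) (s≤s l≤k) (s≤s k<m))))
      (*-nonNeg (<⇒≤ (<0⇒0<- ρ<0)) (*-nonNeg (square-nonNeg (P * Q))
        (*-nonNeg (<⇒≤ (same 0 (s≤s z≤n))) (≤⇒0≤- (q≤p 0 (s≤s z≤n)))))))
    where
    a = ρ - p 0
    b = ρ - q 0
    P = PV (p ∘ suc) m ρ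
    Q = PV (q ∘ suc) l ρ
    S = PΘ (p ∘ suc) m ρ
    T = PΘ (q ∘ suc) l ρ

  -- At a zero ρ of the step applied to P, the step applied to Q has the sign of Q.
  sign-clash : ∀ i {ρ κ P Q S T β γ} → ρ < 0# → 0# < κ → 0# < alt i P → 0# < alt i Q →
    Dval β ρ S P ≈ 0# → 0# < alt (suc i) (κ * Dval γ ρ T Q) → 0# ≤ γ - β →
    ¬ 0# ≤ - ((P * Q) * (S * Q - T * P))
  sign-clash i {ρ} {κ} {P} {Q} {S} {T} {β} {γ} ρ<0 0<κ 0<P 0<Q P-root Q-sign β≤γ W = nonNeg
    (<-respˡ (solve 4 (λ κ p q d → :- ((p :* p) :* (:- (q :* (κ :* d)))) :* (con 1ℤ) := κ :* ((p :* p) :* (q :* d))) refl κ P Q D)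
      (<-respˡ (trans (sym (*-identityʳ _)) (*-congˡ (sym ι-1))) (0<⇒-<0 (*-pos PP QD))))
    where
    D = Dval γ ρ T Q
    g = ι (+ r) * (1# - ρ)
    U = g * S
    V = g * T

    PP : 0# < P * P
    PP = <-respʳ (trans (alt-alt i i P P) (alt-double i _)) (*-pos 0<P 0<P)

    QD : 0# < - (Q * (κ * D))
    QD = <-respʳ (trans (alt-alt i (suc i) Q (κ * D))
      (trans (reflexive (≡.cong (λ j → alt j (Q * (κ * D))) (ℕₚ.+-suc i i))) (-‿cong (alt-double i _))))
      (*-pos 0<Q Q-sign)

    -- The root equation says g S/P = -β, so D/Q = g (T/Q - S/P) + (γ - β) with both summands
    -- nonnegative. The calculation multiplies this by P² Q² and adds the root equation as a
    -- vanishing term.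
    nonNeg : 0# ≤ κ * ((P * P) * (Q * D))
    nonNeg = *-nonNeg (<⇒≤ 0<κ) (≤-respʳ (begin
        g * - ((P * Q) * (S * Q - T * P)) + (γ - β) * ((P * Q) * (P * Q))
          ≈⟨ +-identityʳ _ ⟨
        (g * - ((P * Q) * (S * Q - T * P)) + (γ - β) * ((P * Q) * (P * Q))) + 0#
          ≈⟨ +-congˡ (trans (*-congˡ P-root) (zeroʳ _)) ⟨
        (g * - ((P * Q) * (S * Q - T * P)) + (γ - β) * ((P * Q) * (P * Q))) + (P * (Q * Q)) * (g * S + β * P)
          ≈⟨ +-congʳ (+-congʳ (trans
               (solve 3 (λ g x y → g :* (:- (x :* y)) := :- (x :* (g :* y))) refl g (P * Q) (S * Q - T * P))
               (-‿cong (*-congˡ (solve 5 (λ g S Q T P → g :* (S :* Q :- T :* P) := (g :* S) :* Q :- (g :* T) :* P)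
                  refl g S Q T P))))) ⟩
        (- ((P * Q) * (U * Q - V * P)) + (γ - β) * ((P * Q) * (P * Q))) + (P * (Q * Q)) * (U + β * P)
          ≈⟨ +-cong (+-cong
               (solve 4 (λ P Q U V → :- ((P :* Q) :* (U :* Q :- V :* P)) := (P :* P) :* (Q :* V) :- (P :* (Q :* Q)) :* U) refl P Q U V)
               (solve 4 (λ P Q β γ → (γ :- β) :* ((P :* Q) :* (P :* Q)) := (P :* P) :* (Q :* (γ :* Q)) :- (P :* (Q :* Q)) :* (β :* P))
                  refl P Q β γ))
               (distribˡ (P * (Q * Q)) U (β * P)) ⟩
        (((P * P) * (Q * V) - (P * (Q * Q)) * U) + ((P * P) * (Q * (γ * Q)) - (P * (Q * Q)) * (β * P)))
          + ((P * (Q * Q)) * U + (P * (Q * Q)) * (β * P))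
          ≈⟨ solve 4 (λ v u c b → ((v :- u) :+ (c :- b)) :+ (u :+ b) := v :+ c) refl _ _ _ _ ⟩
        (P * P) * (Q * V) + (P * P) * (Q * (γ * Q))
          ≈⟨ trans (*-congˡ (distribˡ Q V (γ * Q))) (distribˡ (P * P) _ _) ⟨
        (P * P) * (Q * D) ∎)
      (+-nonNeg (*-nonNeg (*-nonNeg (0≤ι r) (<⇒≤ (+-pos 0<1 (<0⇒0<- ρ<0)))) W)
        (*-nonNeg β≤γ (square-nonNeg (P * Q)))))

  above-step : ∀ t T i k → i ℕ.≤ length T → k ℕ.< i → zeros (t ∷ T) i < zeros T k
  above-step t T (suc i) k i<d (s≤s k≤i) = <-≤-trans (Interlace.upper (interlace t T) i i<d)
    (Decreasing-≤ (Zeros.dec (zeros-Zeros T)) k i k≤i i<d)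

  below-step : ∀ t T i k → i ℕ.≤ k → k ℕ.< length T → zeros T k < zeros (t ∷ T) i
  below-step t T i k i≤k k<d = ≤-<-trans (Decreasing-≤ (Zeros.dec (zeros-Zeros T)) i k i≤k k<d)
    (Interlace.lower (interlace t T) i (ℕₚ.≤-<-trans i≤k k<d))

  -- The parameters enter as a + (r d + e) x, where the slope acts with reversed sign because x < 0.
  -- It is compared as a whole since d and d′ may differ.
  β-mono : ∀ {a a′ e e′ d d′ x} → x < 0# → a ℕ.≤ a′ → r ℕ.* d′ ℕ.+ e′ ℕ.≤ r ℕ.* d ℕ.+ e →
    0# ≤ βcoef a′ e′ d′ x - βcoef a e d x
  β-mono {a} {a′} {e} {e′} {d} {d′} {x} x<0 a≤a′ e′≤e = ≤-respʳ (begin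
      (ι (+ a′) - ι (+ a)) + (- x) * (ι (+ (r ℕ.* d ℕ.+ e)) - ι (+ (r ℕ.* d′ ℕ.+ e′)))
        ≈⟨ +-congˡ (*-congˡ (+-cong (lin d e) (-‿cong (lin d′ e′)))) ⟩
      (ι (+ a′) - ι (+ a)) + (- x) * (u d e - u d′ e′)
        ≈⟨ solve 5 (λ a′ a x u u′ → (a′ :- a) :+ (:- x) :* (u :- u′) := (a′ :+ u′ :* x) :- (a :+ u :* x)) refl
             (ι (+ a′)) (ι (+ a)) x (u d e) (u d′ e′) ⟩
      βcoef a′ e′ d′ x - βcoef a e d x ∎)
    (+-nonNeg (ι-≤ a≤a′) (*-nonNeg (<⇒≤ (<0⇒0<- x<0)) (ι-≤ e′≤e)))
    where
    u : ℕ → ℕ → Carrier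
    u d e = ι (+ r) * ι (+ d) + ι (+ e)
    lin : ∀ d e → ι (+ (r ℕ.* d ℕ.+ e)) ≈ u d e
    lin d e = trans (ι-+ (+ (r ℕ.* d)) (+ e)) (+-congʳ
      (trans (reflexive (≡.cong ι (ℤₚ.pos-* r d))) (ι-* (+ r) (+ d))))

  -- By contradiction: if ρ lay to the left of the i-th zero after the step, interlacing would put
  -- it on the same side of each q_k as of p_k. Then P and Q would share a sign at ρ, while the step
  -- of Q, evaluated between its zeros i + 1 and i, would have the opposite sign, against
  -- `sign-clash`.
  compare-step : ∀ a e T {m} → Fits (length T) m → ∀ p {ρ β} i → i ℕ.≤ length T → ρ < 0# →
    (∀ k → k ℕ.< i → ρ < p k) → (∀ k → i ℕ.≤ k → k ℕ.< m → p k < ρ) → i ℕ.≤ m →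
    (∀ k → k ℕ.< length T → zeros T k ≤ p k) →
    Dval β ρ (PΘ p m ρ) (PV p m ρ) ≈ 0# → 0# ≤ βcoef (suc a) (suc e) (length T) ρ - β →
    zeros ((a , e) ∷ T) i ≤ ρ
  compare-step a e T {m} f p {ρ} i i≤d ρ<0 above below i≤m q≤p P-root β≤γ ρ<σ =
    sign-clash i ρ<0 Z.0<κ (PV-pos p m ρ i i≤m above below) (PV-pos q d ρ i i≤d q-above q-below)
      P-root (<-respʳ (alt-cong (suc i) (Z.Dop-value (suc a) (suc e) ρ)) Q-sign) β≤γ
      (logDerivative-≤ f p q ρ<0 same q≤p (λ k d≤k k<m → <⇒≤ (below k (ℕₚ.≤-trans i≤d d≤k) k<m)))
    where
    t = (a , e)
    d = length T
    q = zeros T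
    module Z  = Zeros (zeros-Zeros T)
    module Z′ = Zeros (zeros-Zeros (t ∷ T))

    d≤m : ∀ {l m} → Fits l m → l ℕ.≤ m
    d≤m none    = z≤n
    d≤m one     = z≤n
    d≤m (suc f) = s≤s (d≤m f)

    q-above : ∀ k → k ℕ.< i → ρ < q k
    q-above k k<i = <-trans ρ<σ (above-step t T i k i≤d k<i)

    q-below : ∀ k → i ℕ.≤ k → k ℕ.< d → q k < ρ
    q-below k i≤k k<d = ≤-<-trans (q≤p k k<d) (below k i≤k (ℕₚ.<-≤-trans k<d (d≤m f)))

    same : ∀ k → k ℕ.< d → 0# < (ρ - p k) * (ρ - q k)
    same k k<d with k ℕₚ.<? i
    ... | yes k<i = *-neg-neg (sub (above k k<i)) (sub (q-above k k<i))
      where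
      sub : ∀ {x y} → x < y → x - y < 0#
      sub {x} {y} x<y = <-respˡ (solve 2 (λ x y → :- (y :- x) := x :- y) refl x y) (0<⇒-<0 (<⇒0<- x<y))
    ... | no  k≮i = *-pos (<⇒0<- (below k (ℕₚ.≮⇒≥ k≮i) (ℕₚ.<-≤-trans k<d (d≤m f))))
                          (<⇒0<- (q-below k (ℕₚ.≮⇒≥ k≮i) k<d))

    Q-sign : 0# < alt (suc i) (evℤ (suc (suc d)) (coef (t ∷ T)) ρ)
    Q-sign = Z′.sign ρ (suc i) (s≤s i≤d)
      (λ { k (s≤s k≤i) → <-≤-trans ρ<σ (Decreasing-≤ Z′.dec k i k≤i (s≤s i≤d)) })
      (λ { (suc k) (s≤s i≤k) (s≤s k<d) → <-trans (Interlace.upper (interlace t T) k k<d) (q-below k i≤k k<d) })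

  step-root : ∀ a e T i → i ℕ.≤ length T →
    Dval (βcoef (suc a) (suc e) (length T) (zeros ((a , e) ∷ T) i)) (zeros ((a , e) ∷ T) i)
      (PΘ (zeros T) (length T) (zeros ((a , e) ∷ T) i)) (PV (zeros T) (length T) (zeros ((a , e) ∷ T) i)) ≈ 0#
  step-root a e T i i≤d = *-cancel-pos Z.0<κ
    (trans (sym (Z.Dop-value (suc a) (suc e) (zeros ((a , e) ∷ T) i))) (Zeros.root (zeros-Zeros ((a , e) ∷ T)) i (s≤s i≤d)))
    where module Z = Zeros (zeros-Zeros T)

  zeros-neg : ∀ T i → i ℕ.< length T → zeros T i < 0#
  zeros-neg T = Zeros.neg (zeros-Zeros T)

  -- A pair (t , r - t) grows with t. The components are compared separately, since a pair left
  -- after splitting off a factor x has another sum.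
  _⊑_ : ℕ × ℕ → ℕ × ℕ → Set
  (a , e) ⊑ (a′ , e′) = a ℕ.≤ a′ × e′ ℕ.≤ e

  zeros-antitone : ∀ {S T} → Pointwise _⊑_ S T → ∀ i → i ℕ.< length S → zeros T i ≤ zeros S i
  zeros-antitone {(a , e) ∷ S} {(a′ , e′) ∷ T} ((a≤a′ , e′≤e) ∷ S⊑T) i (s≤s i≤d) =
    compare-step a′ e′ T (≡.subst (Fits (length T)) (≡.sym lengths) (fits-refl _)) (zeros S) i
      (≡.subst (i ℕ.≤_) lengths i≤d) (zeros-neg _ i (s≤s i≤d))
      (λ k → above-step (a , e) S i k i≤d) (λ k → below-step (a , e) S i k) i≤d
      (λ k k<d → zeros-antitone S⊑T k (≡.subst (k ℕ.<_) (≡.sym lengths) k<d))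
      (step-root a e S i i≤d)
      (β-mono (zeros-neg _ i (s≤s i≤d)) (s≤s a≤a′)
        (≡.subst (λ d → r ℕ.* d ℕ.+ suc e′ ℕ.≤ r ℕ.* length S ℕ.+ suc e) lengths (ℕₚ.+-monoʳ-≤ (r ℕ.* length S) (s≤s e′≤e))))
    where
    lengths : length S ≡ length T
    lengths = Pointwise-length S⊑T

  -- T has one step more than S; the missing zero of S counts as 0.
  data _⊑₀_ : List (ℕ × ℕ) → List (ℕ × ℕ) → Set where
    [_] : ∀ t → [] ⊑₀ (t ∷ [])
    _∷_ : ∀ {a e a′ e′ S T} → a ℕ.≤ a′ ℕ.+ r × e′ ℕ.≤ e → S ⊑₀ T → ((a , e) ∷ S) ⊑₀ ((a′ , e′) ∷ T)

  ⊑₀-length : ∀ {S T} → S ⊑₀ T → length T ≡ suc (length S)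
  ⊑₀-length [ _ ]     = ≡.refl
  ⊑₀-length (_ ∷ S⊑T) = ≡.cong suc (⊑₀-length S⊑T)

  zeros-antitone₀ : ∀ {S T} → S ⊑₀ T → ∀ i → i ℕ.< length S → zeros T (suc i) ≤ zeros S i
  zeros-antitone₀ {(a , e) ∷ S} {(a′ , e′) ∷ T} ((a≤a′ , e′≤e) ∷ S⊑T) i (s≤s i≤d) =
    compare-step a′ e′ T (≡.subst (λ l → Fits l (suc d)) (≡.sym lengths) (fits-refl _)) p (suc i)
      (≡.subst (suc i ℕ.≤_) (≡.sym lengths) (s≤s i≤d)) ρ<0
      above below (s≤s i≤d) T≤p P-root β≤
    where
    d = length S
    ρ = zeros ((a , e) ∷ S) i
    p : ℕ → Carrier
    p zero    = 0#
    p (suc k) = zeros S k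

    lengths : length T ≡ suc d
    lengths = ⊑₀-length S⊑T

    ρ<0 : ρ < 0#
    ρ<0 = zeros-neg ((a , e) ∷ S) i (s≤s i≤d)

    above : ∀ k → k ℕ.< suc i → ρ < p k
    above zero    _         = ρ<0
    above (suc k) (s≤s k<i) = above-step (a , e) S i k i≤d k<i

    below : ∀ k → suc i ℕ.≤ k → k ℕ.< suc d → p k < ρ
    below (suc k) (s≤s i≤k) (s≤s k<d) = below-step (a , e) S i k i≤k k<d

    T≤p : ∀ k → k ℕ.< length T → zeros T k ≤ p k
    T≤p zero    0<l = <⇒≤ (zeros-neg T 0 0<l)
    T≤p (suc k) k<l = zeros-antitone₀ S⊑T k (ℕₚ.≤-pred (≡.subst (suc k ℕ.<_) lengths k<l))

    g = ι (+ r) * (1# - ρ)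
    β = βcoef (suc a) (suc e) d ρ

    -- The product x P takes the place of P. As θ (x P) = x (P + θP), the step with β - g maps x P
    -- to x times the step with β of P. Moreover β - g is (a - r) + (r (d + 1) + e) ρ in terms of
    -- the parameters, which is the origin of the allowance r in `⊑₀`.
    P-root : Dval (β - g) ρ (PΘ p (suc d) ρ) (PV p (suc d) ρ) ≈ 0#
    P-root = begin
      g * (ρ * P + (ρ - 0#) * Θ) + (β - g) * ((ρ - 0#) * P)
        ≈⟨ +-cong (*-congˡ (+-congˡ (*-congʳ ρ-0))) (*-congˡ (*-congʳ ρ-0)) ⟩
      g * (ρ * P + ρ * Θ) + (β - g) * (ρ * P)
        ≈⟨ solve 5 (λ g ρ P Θ β → g :* (ρ :* P :+ ρ :* Θ) :+ (β :- g) :* (ρ :* P)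
             := ρ :* (g :* Θ :+ β :* P)) refl g ρ P Θ β ⟩
      ρ * (g * Θ + β * P) ≈⟨ *-congˡ (step-root a e S i i≤d) ⟩
      ρ * 0#              ≈⟨ zeroʳ ρ ⟩
      0#                  ∎
      where
      P = PV (zeros S) d ρ
      Θ = PΘ (zeros S) d ρ
      ρ-0 : ρ - 0# ≈ ρ
      ρ-0 = trans (+-congˡ (alt-0 1)) (+-identityʳ ρ)

    β≤ : 0# ≤ βcoef (suc a′) (suc e′) (length T) ρ - (β - g)
    β≤ = ≡.subst (λ l → 0# ≤ βcoef (suc a′) (suc e′) l ρ - (β - g)) (≡.sym lengths) (≤-respʳ (begin
        βcoef (suc a′ ℕ.+ r) (suc e′) d ρ - β
          ≈⟨ +-congʳ (+-congʳ (ι-+ (+ suc a′) (+ r))) ⟩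
        ((A + R) + (R * D + F) * ρ) - β
          ≈⟨ solve 5 (λ A R H ρ β → ((A :+ R) :+ H :* ρ) :- β := (A :+ (R :+ H) :* ρ) :- (β :- (R :- R :* ρ)))
               refl A R (R * D + F) ρ β ⟩
        (A + (R + (R * D + F)) * ρ) - (β - (R - R * ρ))
          ≈⟨ +-cong (+-congˡ (*-congʳ (trans (+-congʳ (trans (*-congˡ (ι-suc d))
               (trans (distribˡ R 1# D) (+-congʳ (*-identityʳ R))))) (+-assoc R (R * D) F))))
               (-‿cong (+-congˡ (-‿cong (trans (distribˡ R 1# (- ρ))
                 (+-cong (*-identityʳ R) (solve 2 (λ R ρ → R :* (:- ρ) := :- (R :* ρ)) refl R ρ)))))) ⟨
        βcoef (suc a′) (suc e′) (suc d) ρ - (β - g) ∎)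
      (β-mono ρ<0 (s≤s a≤a′) (ℕₚ.+-monoʳ-≤ (r ℕ.* d) (s≤s e′≤e))))
      where
      A = ι (+ suc a′)
      R = ι (+ r)
      D = ι (+ d)
      F = ι (+ suc e′)

  -- S has one step more than T; the missing zero of T counts as -∞.
  data _⊑∞_ : List (ℕ × ℕ) → List (ℕ × ℕ) → Set where
    [_] : ∀ s → (s ∷ []) ⊑∞ []
    _∷_ : ∀ {a e a′ e′ S T} → a ℕ.≤ a′ × e′ ℕ.≤ r ℕ.+ e → S ⊑∞ T → ((a , e) ∷ S) ⊑∞ ((a′ , e′) ∷ T)

  ⊑∞-length : ∀ {S T} → S ⊑∞ T → length S ≡ suc (length T)
  ⊑∞-length [ _ ]     = ≡.refl
  ⊑∞-length (_ ∷ S⊑T) = ≡.cong suc (⊑∞-length S⊑T)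

  zeros-antitone∞ : ∀ {S T} → S ⊑∞ T → ∀ i → i ℕ.< length T → zeros T i ≤ zeros S i
  zeros-antitone∞ {(a , e) ∷ S} {(a′ , e′) ∷ T} ((a≤a′ , e′≤e) ∷ S⊑T) i (s≤s i≤d) =
    compare-step a′ e′ T (≡.subst (Fits (length T)) (≡.sym lengths) (fits-suc _)) (zeros S) i i≤d
      (zeros-neg _ i (s≤s i≤m)) (λ k → above-step (a , e) S i k i≤m) (λ k → below-step (a , e) S i k) i≤m
      (λ k k<d → zeros-antitone∞ S⊑T k k<d) (step-root a e S i i≤m)
      (β-mono (zeros-neg _ i (s≤s i≤m)) (s≤s a≤a′)
        (≡.subst (λ m → r ℕ.* length T ℕ.+ suc e′ ℕ.≤ r ℕ.* m ℕ.+ suc e) (≡.sym lengths) bound))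
    where
    lengths : length S ≡ suc (length T)
    lengths = ⊑∞-length S⊑T
    i≤m : i ℕ.≤ length S
    i≤m = ≡.subst (i ℕ.≤_) (≡.sym lengths) (ℕₚ.m≤n⇒m≤1+n i≤d)
    -- The slopes r d + e′ and r (d + 1) + e belong to different degrees, hence the allowance r in
    -- `⊑∞`.
    bound : r ℕ.* length T ℕ.+ suc e′ ℕ.≤ r ℕ.* suc (length T) ℕ.+ suc e
    bound = ℕₚ.≤-trans (ℕₚ.+-monoʳ-≤ (r ℕ.* length T) (s≤s e′≤e)) (ℕₚ.≤-reflexive
      (≡.trans (≡.cong (r ℕ.* length T ℕ.+_) (≡.sym (ℕₚ.+-suc r e)))
        (≡.trans (≡.sym (ℕₚ.+-assoc (r ℕ.* length T) r (suc e)))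
          (≡.cong (ℕ._+ suc e) (≡.trans (ℕₚ.+-comm (r ℕ.* length T) r) (≡.sym (ℕₚ.*-suc r (length T))))))))

-- The polynomial and its reversal as sums over lists of steps

mixed : {A : Set} → A → A → ℕ → ℕ → List A
mixed s t b m = replicate b s ++ replicate m t

length-mixed : ∀ {A : Set} (s t : A) b m → length (mixed s t b m) ≡ b ℕ.+ m
length-mixed s t b m = ≡.trans (Listₚ.length-++ (replicate b s))
  (≡.cong₂ ℕ._+_ (Listₚ.length-replicate b) (Listₚ.length-replicate m))

mixed-All : ∀ {A : Set} {P : A → Set} {s t} → P s → P t → ∀ b m → All P (mixed s t b m)
mixed-All Ps Pt zero    zero    = []
mixed-All Ps Pt zero    (suc m) = Pt ∷ mixed-All Ps Pt zero m
mixed-All Ps Pt (suc b) m       = Ps ∷ mixed-All Ps Pt b m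

Σℤ : ℕ → (ℕ → ℤ) → ℤ
Σℤ zero    f = 0ℤ
Σℤ (suc n) f = f 0 ℤ.+ Σℤ n (f ∘ suc)

shift : (ℕ → ℤ) → ℕ → ℤ
shift c zero    = 0ℤ
shift c (suc k) = c k

module Blocks (q : ℕ) where
  r : ℕ
  r = suc (suc q)
  open Coefficients r public

  -- As steps these have parameters (1 , r - 1), (r - 1 , 1), (r , r), (r + 1 , r - 1), (r - 1 , r + 1).
  first last middle above below : ℕ × ℕ
  first  = (0 , q)
  last   = (q , 0)
  middle = (suc q , suc q)
  above  = (suc (suc q) , q)
  below  = (q , suc (suc q))

  -- Up to a factor x in the terms of the sum, these are the contributions of (rm)^a (rm+1)^b and of
  -- (rm+r-1)^a (rm+r)^b with a + b = N to the numerators of (rm+1)^n - (rm)^n and (rm+r)^n - (rm+r-1)^n,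
  -- where n = N + 1.
  A-coef I-coef : ℕ → ℕ → ℤ
  A-coef N k = coef (replicate N first) k
    ℤ.+ Σℤ N (λ b → + r ℤ.* shift (coef (mixed above middle b (N ℕ.∸ suc b))) k)
  I-coef N k = coef (replicate N last) k
    ℤ.+ Σℤ N (λ b → + r ℤ.* coef (mixed below middle b (N ℕ.∸ suc b)) k)

  Σℤ-zero : ∀ n f → (∀ b → b ℕ.< n → f b ≡ 0ℤ) → Σℤ n f ≡ 0ℤ
  Σℤ-zero zero    f f≡0 = ≡.refl
  Σℤ-zero (suc n) f f≡0 = ≡.cong₂ ℤ._+_ (f≡0 0 (s≤s z≤n)) (Σℤ-zero n (f ∘ suc) (λ b b<n → f≡0 (suc b) (s≤s b<n)))

  Σℤ-nonNeg : ∀ n f → (∀ b → b ℕ.< n → 0ℤ ℤ.≤ f b) → 0ℤ ℤ.≤ Σℤ n f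
  Σℤ-nonNeg zero    f 0≤f = ℤₚ.≤-refl
  Σℤ-nonNeg (suc n) f 0≤f = ℤₚ.+-mono-≤ (0≤f 0 (s≤s z≤n)) (Σℤ-nonNeg n (f ∘ suc) (λ b b<n → 0≤f (suc b) (s≤s b<n)))

  length-block : ∀ s t {N b} → b ℕ.< N → suc (length (mixed {ℕ × ℕ} s t b (N ℕ.∸ suc b))) ≡ N
  length-block s t {suc M} {b} (s≤s b≤M) =
    ≡.cong suc (≡.trans (length-mixed s t b (M ℕ.∸ b)) (ℕₚ.m+[n∸m]≡n b≤M))

  scaled-zero : ∀ {c} → c ≡ 0ℤ → + r ℤ.* c ≡ 0ℤ
  scaled-zero c≡0 = ≡.trans (≡.cong (+ r ℤ.*_) c≡0) (ℤₚ.*-zeroʳ (+ r))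

  block-vanishes : ∀ s t {N b k} → b ℕ.< N → N ℕ.≤ k → coef (mixed s t b (N ℕ.∸ suc b)) k ≡ 0ℤ
  block-vanishes s t {N} {b} b<N N≤k = coef-vanishes (mixed s t b (N ℕ.∸ suc b)) _ (≡.subst (ℕ._≤ _) (≡.sym (length-block s t b<N)) N≤k)

  replicate-vanishes : ∀ t N {k} → N ℕ.< k → coef (replicate N t) k ≡ 0ℤ
  replicate-vanishes t N N<k = coef-vanishes (replicate N t) _ (≡.subst (ℕ._< _) (≡.sym (Listₚ.length-replicate N)) N<k)

  A-coef-vanishes : ∀ N k → N ℕ.< k → A-coef N k ≡ 0ℤ
  A-coef-vanishes N (suc k) N<k = ≡.cong₂ ℤ._+_ (replicate-vanishes first N N<k)
    (Σℤ-zero N _ (λ b b<N → scaled-zero (block-vanishes above middle b<N (ℕₚ.≤-pred N<k))))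

  I-coef-vanishes : ∀ N k → N ℕ.< k → I-coef N k ≡ 0ℤ
  I-coef-vanishes N k N<k = ≡.cong₂ ℤ._+_ (replicate-vanishes last N N<k)
    (Σℤ-zero N _ (λ b b<N → scaled-zero (block-vanishes below middle b<N (ℕₚ.<⇒≤ N<k))))

  A-coef-const : ∀ N → 0ℤ ℤ.< A-coef N 0
  A-coef-const N = ≡.subst (0ℤ ℤ.<_) (≡.sym (≡.trans (≡.cong (λ s → coef (replicate N first) 0 ℤ.+ s)
    (Σℤ-zero N _ (λ b _ → scaled-zero ≡.refl))) (ℤₚ.+-identityʳ _))) (coef-const (replicate N first))

  I-coef-lead : ∀ N → 0ℤ ℤ.< I-coef N N
  I-coef-lead N = ≡.subst (0ℤ ℤ.<_) (≡.sym (≡.trans (≡.cong (λ s → coef (replicate N last) N ℤ.+ s)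
    (Σℤ-zero N _ (λ b b<N → scaled-zero (block-vanishes below middle b<N ℕₚ.≤-refl)))) (ℤₚ.+-identityʳ _)))
    (≡.subst (λ n → 0ℤ ℤ.< coef (replicate N last) n) (Listₚ.length-replicate N) (coef-lead (replicate N last)))

  I-coef-const : ∀ N → 0ℤ ℤ.< I-coef N 0
  I-coef-const N = ℤₚ.+-mono-<-≤ (coef-const (replicate N last))
    (Σℤ-nonNeg N _ (λ b _ → ℤₚ.<⇒≤ (positive-* (suc q) (coef-const (mixed below middle b (N ℕ.∸ suc b))))))

-- Separation of the zeros of the two sums

module Interlacing (𝓡 : HeytingRing) (ivt : IntermediateValue 𝓡) (q : ℕ)
  -- Each identity presents the term b = M of a sum as one altered last step on top of `first` or
  -- `last`, so that its sign can be read off at the zeros belonging to the unaltered step.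
  (above-first : ∀ M k → + suc (suc q) ℤ.* shift (Coefficients.coef (suc (suc q)) (replicate M (suc (suc q) , q))) k
    ≡ Coefficients.Dop (suc (suc q)) 0 (suc (suc q)) M (Coefficients.coef (suc (suc q)) (replicate M (0 , q))) k)
  (below-last : ∀ M k → + suc (suc q) ℤ.* Coefficients.coef (suc (suc q)) (replicate M (q , suc (suc q))) k
    ≡ Coefficients.Dop (suc (suc q)) (suc (suc q)) 0 M (Coefficients.coef (suc (suc q)) (replicate M (q , 0))) k)
  where
  open Order 𝓡
  open Polynomials 𝓡
  open IntegerPolynomials 𝓡
  open Tower 𝓡 ivt (suc q) hiding (r)
  open Comparison 𝓡 ivt (suc q)
  open Blocks q

  ∑ : ℕ → (ℕ → Carrier) → Carrier
  ∑ zero    f = 0#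
  ∑ (suc n) f = f 0 + ∑ n (f ∘ suc)

  ∑-nonNeg : ∀ n f → (∀ b → b ℕ.< n → 0# ≤ f b) → 0# ≤ ∑ n f
  ∑-nonNeg zero    f 0≤f = ≤-refl
  ∑-nonNeg (suc n) f 0≤f = +-nonNeg (0≤f 0 (s≤s z≤n)) (∑-nonNeg n (f ∘ suc) (λ b b<n → 0≤f (suc b) (s≤s b<n)))

  ∑-pos : ∀ n f b → b ℕ.< n → (∀ b → b ℕ.< n → 0# ≤ f b) → 0# < f b → 0# < ∑ n f
  ∑-pos (suc n) f zero    _         0≤f 0<f = +-pos-nonNeg 0<f
    (∑-nonNeg n (f ∘ suc) (λ b b<n → 0≤f (suc b) (s≤s b<n)))
  ∑-pos (suc n) f (suc b) (s≤s b<n) 0≤f 0<f = <-respʳ (+-comm _ _) (+-pos-nonNeg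
    (∑-pos n (f ∘ suc) b b<n (λ b b<n → 0≤f (suc b) (s≤s b<n)) 0<f) (0≤f 0 (s≤s z≤n)))

  ∑-cong : ∀ n {f g} → (∀ b → b ℕ.< n → f b ≈ g b) → ∑ n f ≈ ∑ n g
  ∑-cong zero    e = refl
  ∑-cong (suc n) e = +-cong (e 0 (s≤s z≤n)) (∑-cong n (λ b b<n → e (suc b) (s≤s b<n)))

  alt-∑ : ∀ i n f → alt i (∑ n f) ≈ ∑ n (alt i ∘ f)
  alt-∑ i zero    f = alt-0 i
  alt-∑ i (suc n) f = trans (alt-+ i _ _) (+-congˡ (alt-∑ i n (f ∘ suc)))

  evℤ-+ : ∀ n b c x → evℤ n (λ k → b k ℤ.+ c k) x ≈ evℤ n b x + evℤ n c x
  evℤ-+ n b c x = trans (ev-cong n x (λ k → ι-+ (b k) (c k))) (ev-+ n (ι ∘ b) (ι ∘ c) x)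

  evℤ-0 : ∀ n x → evℤ n (λ _ → 0ℤ) x ≈ 0#
  evℤ-0 zero    x = refl
  evℤ-0 (suc n) x = trans (+-cong ι-0 (trans (*-congˡ (evℤ-0 n x)) (zeroʳ x))) (+-identityˡ 0#)

  evℤ-Σ : ∀ n m (c : ℕ → ℕ → ℤ) x → evℤ n (λ k → Σℤ m (λ b → c b k)) x ≈ ∑ m (λ b → evℤ n (c b) x)
  evℤ-Σ n zero    c x = evℤ-0 n x
  evℤ-Σ n (suc m) c x = trans (evℤ-+ n (c 0) (λ k → Σℤ m (λ b → c (suc b) k)) x) (+-congˡ (evℤ-Σ n m (c ∘ suc) x))

  evℤ-* : ∀ n a c x → evℤ n (λ k → a ℤ.* c k) x ≈ ι a * evℤ n c x
  evℤ-* n a c x = trans (ev-cong n x (λ k → ι-* a (c k))) (ev-* n (ι a) (ι ∘ c) x)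

  evℤ-shift : ∀ n c x → evℤ (suc n) (shift c) x ≈ x * evℤ n c x
  evℤ-shift n c x = trans (+-congʳ ι-0) (+-identityˡ _)

  evℤ-cong : ∀ n {b c} x → (∀ k → b k ≡ c k) → evℤ n b x ≈ evℤ n c x
  evℤ-cong n x b≡c = ev-cong n x (λ k → reflexive (≡.cong ι (b≡c k)))

  *-neg-alt : ∀ i s x y → 0# < s → x < 0# → 0# < alt i y → 0# < alt (suc i) (s * (x * y))
  *-neg-alt i s x y 0<s x<0 p = <-respʳ (begin
      s * ((- x) * alt i y)     ≈⟨ *-congˡ (solve 2 (λ x y → (:- x) :* y := :- (x :* y)) refl x (alt i y)) ⟩
      s * - (x * alt i y)       ≈⟨ *-congˡ (-‿cong (alt-* i x y)) ⟨
      s * alt (suc i) (x * y)   ≈⟨ alt-* (suc i) s (x * y) ⟨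
      alt (suc i) (s * (x * y)) ∎) (*-pos 0<s (*-pos (<0⇒0<- x<0) p))

  *-neg-alt-weak : ∀ i s x y → 0# < s → x < 0# → 0# ≤ alt i y → 0# ≤ alt (suc i) (s * (x * y))
  *-neg-alt-weak i s x y 0<s x<0 p = ≤-respʳ (begin
      s * ((- x) * alt i y)     ≈⟨ *-congˡ (solve 2 (λ x y → (:- x) :* y := :- (x :* y)) refl x (alt i y)) ⟩
      s * - (x * alt i y)       ≈⟨ *-congˡ (-‿cong (alt-* i x y)) ⟨
      s * alt (suc i) (x * y)   ≈⟨ alt-* (suc i) s (x * y) ⟨
      alt (suc i) (s * (x * y)) ∎) (*-nonNeg (<⇒≤ 0<s) (*-nonNeg (<⇒≤ (<0⇒0<- x<0)) p))

  *-pos-alt : ∀ i s y → 0# < s → 0# < alt i y → 0# < alt i (s * y)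
  *-pos-alt i s y 0<s p = <-respʳ (sym (alt-* i s y)) (*-pos 0<s p)

  *-pos-alt-weak : ∀ i s y → 0# < s → 0# ≤ alt i y → 0# ≤ alt i (s * y)
  *-pos-alt-weak i s y 0<s p = ≤-respʳ (sym (alt-* i s y)) (*-nonNeg (<⇒≤ 0<s) p)

  0<r : 0# < ι (+ r)
  0<r = 0<ι (suc q)

  -- Moving one unit from `e` to `a` changes β by 1 - x. At a zero of one of the two steps the other
  -- is therefore (1 - x) P up to sign, which is nonzero by interlacing.
  Dop-exchange : ∀ a e T x → evℤ (suc (suc (length T))) (Dop (suc a) e (length T) (coef T)) x ≈
    evℤ (suc (suc (length T))) (Dop a (suc e) (length T) (coef T)) x + (1# - x) * evℤ (suc (length T)) (coef T) x
  Dop-exchange a e T x = begin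
    evℤ (suc (suc d)) (Dop (suc a) e d (coef T)) x
      ≈⟨ ev-Dop (suc a) e d (coef T) x v ⟩
    G * Θ + (ι (+ suc a) + (R * D + ι (+ e)) * x) * E
      ≈⟨ +-congˡ (*-congʳ (+-congʳ (ι-suc a))) ⟩
    G * Θ + ((1# + ι (+ a)) + (R * D + ι (+ e)) * x) * E
      ≈⟨ +-congˡ (*-congʳ (trans
           (solve 4 (λ o a u x → (o :+ a) :+ u :* x := (a :+ (x :+ u :* x)) :+ (o :- x)) refl 1# (ι (+ a)) (R * D + ι (+ e)) x)
           (+-congʳ (+-congˡ (trans (+-congʳ (sym (*-identityˡ x))) (trans (sym (distribʳ x 1# _))
             (*-congʳ (solve 3 (λ o m e → o :+ (m :+ e) := m :+ (o :+ e)) refl 1# (R * D) (ι (+ e)))))))))) ⟩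
    G * Θ + ((ι (+ a) + (R * D + (1# + ι (+ e))) * x) + (1# - x)) * E
      ≈⟨ +-congˡ (*-congʳ (+-congʳ (+-congˡ (*-congʳ (+-congˡ (sym (ι-suc e))))))) ⟩
    G * Θ + (βcoef a (suc e) d x + (1# - x)) * E
      ≈⟨ trans (+-congˡ (distribʳ E _ _)) (sym (+-assoc _ _ _)) ⟩
    Dval (βcoef a (suc e) d x) x Θ E + (1# - x) * E
      ≈⟨ +-congʳ (ev-Dop a (suc e) d (coef T) x v) ⟨
    evℤ (suc (suc d)) (Dop a (suc e) d (coef T)) x + (1# - x) * E ∎
    where
    d = length T
    v = coef-vanishes T (suc d) ℕₚ.≤-refl
    R = ι (+ r)
    D = ι (+ d)
    G = R * (1# - x)
    Θ = evθ (suc d) (ι ∘ coef T) x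
    E = evℤ (suc d) (coef T) x

  argument-sign : ∀ t T i → i ℕ.≤ length T → 0# < alt i ((1# - zeros (t ∷ T) i) * evℤ (suc (length T)) (coef T) (zeros (t ∷ T) i))
  argument-sign t T i i≤d = *-pos-alt i _ _ (+-pos 0<1 (<0⇒0<- (zeros-neg (t ∷ T) i (s≤s i≤d))))
    (Zeros.sign (zeros-Zeros T) (zeros (t ∷ T) i) i i≤d (λ k → above-step t T i k i≤d) (λ k → below-step t T i k))

  raised-sign : ∀ a e T i → i ℕ.≤ length T → 0# < alt i
    (evℤ (suc (suc (length T))) (Dop (suc (suc a)) e (length T) (coef T)) (zeros ((a , e) ∷ T) i))
  raised-sign a e T i i≤d = <-respʳ (alt-cong i (sym (begin
      evℤ (suc (suc (length T))) (Dop (suc (suc a)) e (length T) (coef T)) x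
        ≈⟨ Dop-exchange (suc a) e T x ⟩
      evℤ (suc (suc (length T))) (coef ((a , e) ∷ T)) x + (1# - x) * evℤ (suc (length T)) (coef T) x
        ≈⟨ +-congʳ (Zeros.root (zeros-Zeros ((a , e) ∷ T)) i (s≤s i≤d)) ⟩
      0# + (1# - x) * evℤ (suc (length T)) (coef T) x
        ≈⟨ +-identityˡ _ ⟩
      (1# - x) * evℤ (suc (length T)) (coef T) x ∎))) (argument-sign (a , e) T i i≤d)
    where x = zeros ((a , e) ∷ T) i

  lowered-sign : ∀ a e T i → i ℕ.≤ length T → 0# < alt (suc i)
    (evℤ (suc (suc (length T))) (Dop a (suc (suc e)) (length T) (coef T)) (zeros ((a , e) ∷ T) i))
  lowered-sign a e T i i≤d = <-respʳ (trans (alt-cong i (begin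
      (1# - x) * E                    ≈⟨ solve 2 (λ u w → w := (u :+ w) :- u) refl W _ ⟩
      (W + (1# - x) * E) - W          ≈⟨ +-congʳ (Dop-exchange a (suc e) T x) ⟨
      evℤ (suc (suc (length T))) (coef ((a , e) ∷ T)) x - W
        ≈⟨ +-congʳ (Zeros.root (zeros-Zeros ((a , e) ∷ T)) i (s≤s i≤d)) ⟩
      0# - W                          ≈⟨ +-identityˡ _ ⟩
      - W                             ∎)) (alt-neg i W)) (argument-sign (a , e) T i i≤d)
    where
    x = zeros ((a , e) ∷ T) i
    E = evℤ (suc (length T)) (coef T) x
    W = evℤ (suc (suc (length T))) (Dop a (suc (suc e)) (length T) (coef T)) x

  replicate-⊑ : ∀ {s T} → All (s ⊑_) T → Pointwise _⊑_ (replicate (length T) s) T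
  replicate-⊑ []       = []
  replicate-⊑ (p ∷ ps) = p ∷ replicate-⊑ ps

  ⊑-replicate : ∀ {S t} → All (_⊑ t) S → Pointwise _⊑_ S (replicate (length S) t)
  ⊑-replicate []       = []
  ⊑-replicate (p ∷ ps) = p ∷ ⊑-replicate ps

  ⊑₀-replicate : ∀ {S a′ e′} → All (λ s → proj₁ s ℕ.≤ a′ ℕ.+ r × e′ ℕ.≤ proj₂ s) S →
    S ⊑₀ replicate (suc (length S)) (a′ , e′)
  ⊑₀-replicate []       = [ _ ]
  ⊑₀-replicate (p ∷ ps) = p ∷ ⊑₀-replicate ps

  replicate-⊑∞ : ∀ {T a e} → All (λ t → a ℕ.≤ proj₁ t × proj₂ t ℕ.≤ r ℕ.+ e) T →
    replicate (suc (length T)) (a , e) ⊑∞ T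
  replicate-⊑∞ []       = [ _ ]
  replicate-⊑∞ (p ∷ ps) = p ∷ replicate-⊑∞ ps

  module Degree (M : ℕ) where
    W V : ℕ → List (ℕ × ℕ)
    W b = mixed above middle b (M ℕ.∸ b)
    V b = mixed below middle b (M ℕ.∸ b)

    -- `α` and `γ` are the zeros of E_(1,...,1) and E_(r-1,...,r-1) with M + 1 entries. With as many
    -- entries, E_(0,...,0) is r x and E_(r,...,r) is r times one polynomial of degree M, whose
    -- zeros are `h`.
    α γ h : ℕ → Carrier
    α = zeros (replicate (suc M) first)
    γ = zeros (replicate (suc M) last)
    h = zeros (replicate M middle)

    w v : ℕ → ℕ → Carrier
    w b = zeros (W b)
    v b = zeros (V b)

    length-W : ∀ b → b ℕ.≤ M → length (W b) ≡ M
    length-W b b≤M = ≡.trans (length-mixed above middle b (M ℕ.∸ b)) (ℕₚ.m+[n∸m]≡n b≤M)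

    length-V : ∀ b → b ℕ.≤ M → length (V b) ≡ M
    length-V b b≤M = ≡.trans (length-mixed below middle b (M ℕ.∸ b)) (ℕₚ.m+[n∸m]≡n b≤M)

    length-r : ∀ n {t : ℕ × ℕ} → length (replicate n t) ≡ n
    length-r n = Listₚ.length-replicate n

    -- This and the following comparisons combine to the chain α_(i+1) ≤ w_(b,i) ≤ h_i ≤ v_(b,i) ≤
    -- γ_i ≤ α_i for every b.
    γ≤α : ∀ i → i ℕ.< suc M → γ i ≤ α i
    γ≤α i i<N = ≡.subst (λ n → ∀ i → i ℕ.< n → zeros (replicate n last) i ≤ α i) (length-r (suc M))
      (λ i i<n → zeros-antitone (⊑-replicate (Allₚ.replicate⁺ (suc M) (z≤n , z≤n))) i i<n) i i<N

    h≤α : ∀ i → i ℕ.< M → h i ≤ α i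
    h≤α i i<M = ≡.subst (λ n → ∀ i → i ℕ.< n → h i ≤ zeros (replicate (suc n) first) i) (length-r M)
      (λ i i<n → zeros-antitone∞ (replicate-⊑∞ (Allₚ.replicate⁺ M (z≤n , ℕₚ.m≤n⇒m≤1+n (s≤s (ℕₚ.m≤m+n q q))))) i i<n) i i<M

    h≤γ : ∀ i → i ℕ.< M → h i ≤ γ i
    h≤γ i i<M = ≡.subst (λ n → ∀ i → i ℕ.< n → h i ≤ zeros (replicate (suc n) last) i) (length-r M)
      (λ i i<n → zeros-antitone∞ (replicate-⊑∞ (Allₚ.replicate⁺ M (ℕₚ.n≤1+n q , ℕₚ.m≤n⇒m≤1+n (ℕₚ.m≤m+n (suc q) 0)))) i i<n) i i<M

    α≤h : ∀ i → i ℕ.< M → α (suc i) ≤ h i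
    α≤h i i<M = ≡.subst (λ n → ∀ i → i ℕ.< n → zeros (replicate (suc n) first) (suc i) ≤ h i) (length-r M)
      (λ i i<n → zeros-antitone₀ (⊑₀-replicate (Allₚ.replicate⁺ M (ℕₚ.n≤1+n (suc q) , ℕₚ.n≤1+n q))) i i<n) i i<M

    γ≤h : ∀ i → i ℕ.< M → γ (suc i) ≤ h i
    γ≤h i i<M = ≡.subst (λ n → ∀ i → i ℕ.< n → zeros (replicate (suc n) last) (suc i) ≤ h i) (length-r M)
      (λ i i<n → zeros-antitone₀ (⊑₀-replicate (Allₚ.replicate⁺ M (ℕₚ.≤-trans (ℕₚ.n≤1+n (suc q)) (ℕₚ.m≤n+m r q) , z≤n))) i i<n) i i<M

    α≤w : ∀ b → b ℕ.≤ M → ∀ i → i ℕ.< M → α (suc i) ≤ w b i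
    α≤w b b≤M i i<M = ≡.subst (λ n → ∀ i → i ℕ.< n → zeros (replicate (suc n) first) (suc i) ≤ w b i) (length-W b b≤M)
      (λ i i<n → zeros-antitone₀ (⊑₀-replicate (mixed-All (ℕₚ.≤-refl , ℕₚ.≤-refl) (ℕₚ.n≤1+n (suc q) , ℕₚ.n≤1+n q) b (M ℕ.∸ b))) i i<n) i i<M

    w≤h : ∀ b → b ℕ.≤ M → ∀ i → i ℕ.< M → w b i ≤ h i
    w≤h b b≤M i i<M = ≡.subst (λ n → ∀ i → i ℕ.< n → w b i ≤ zeros (replicate n middle) i) (length-W b b≤M)
      (λ i i<n → zeros-antitone (replicate-⊑ {T = W b} (mixed-All (ℕₚ.n≤1+n (suc q) , ℕₚ.n≤1+n q) (ℕₚ.≤-refl , ℕₚ.≤-refl) b (M ℕ.∸ b))) i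
        (≡.subst (i ℕ.<_) (≡.sym (length-r (length (W b)))) i<n)) i i<M

    v≤γ : ∀ b → b ℕ.≤ M → ∀ i → i ℕ.< M → v b i ≤ γ i
    v≤γ b b≤M i i<M = ≡.subst (λ n → ∀ i → i ℕ.< n → v b i ≤ zeros (replicate (suc n) last) i) (length-V b b≤M)
      (λ i i<n → zeros-antitone∞ (replicate-⊑∞ {T = V b}
        (mixed-All (ℕₚ.≤-refl , ℕₚ.m≤m+n r 0) (ℕₚ.n≤1+n q , ℕₚ.m≤n⇒m≤1+n (ℕₚ.m≤m+n (suc q) 0)) b (M ℕ.∸ b))) i i<n) i i<M

    h≤v : ∀ b → b ℕ.≤ M → ∀ i → i ℕ.< M → h i ≤ v b i
    h≤v b b≤M i i<M = ≡.subst (λ n → ∀ i → i ℕ.< n → zeros (replicate n middle) i ≤ v b i) (length-V b b≤M)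
      (λ i i<n → zeros-antitone (⊑-replicate {S = V b} (mixed-All (ℕₚ.n≤1+n q , ℕₚ.n≤1+n (suc q)) (ℕₚ.≤-refl , ℕₚ.≤-refl) b (M ℕ.∸ b))) i i<n) i i<M

    mono : ∀ T {n} → length T ≡ n → ∀ i j → i ℕ.≤ j → j ℕ.< n → zeros T j ≤ zeros T i
    mono T ≡.refl = Decreasing-≤ (Zeros.dec (zeros-Zeros T))

    α-mono : ∀ i j → i ℕ.≤ j → j ℕ.< suc M → α j ≤ α i
    α-mono = mono (replicate (suc M) first) (length-r (suc M))
    γ-mono : ∀ i j → i ℕ.≤ j → j ℕ.< suc M → γ j ≤ γ i
    γ-mono = mono (replicate (suc M) last) (length-r (suc M))
    h-mono : ∀ i j → i ℕ.≤ j → j ℕ.< M → h j ≤ h i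
    h-mono = mono (replicate M middle) (length-r M)

    neg : ∀ T {n} → length T ≡ n → ∀ i → i ℕ.< n → zeros T i < 0#
    neg T ≡.refl = zeros-neg T

    α<0 : ∀ i → i ℕ.< suc M → α i < 0#
    α<0 = neg (replicate (suc M) first) (length-r (suc M))
    h<0 : ∀ i → i ℕ.< M → h i < 0#
    h<0 = neg (replicate M middle) (length-r M)

    weak : ∀ T {n} → length T ≡ n → ∀ x i → i ℕ.≤ n → (∀ k → k ℕ.< i → x ≤ zeros T k) →
      (∀ k → i ℕ.≤ k → k ℕ.< n → zeros T k ≤ x) → 0# ≤ alt i (evℤ (suc n) (coef T) x)
    weak T ≡.refl = Zeros.weak-sign (zeros-Zeros T)

    root : ∀ T {n} → length T ≡ n → ∀ i → i ℕ.< n → evℤ (suc n) (coef T) (zeros T i) ≈ 0#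
    root T ≡.refl = Zeros.root (zeros-Zeros T)

    N = suc M

    A-term I-term : ℕ → Carrier → Carrier
    A-term b x = ι (+ r) * (x * evℤ N (coef (W b)) x)
    I-term b x = ι (+ r) * evℤ N (coef (V b)) x

    A-value : ∀ x → evℤ (suc N) (A-coef N) x ≈ evℤ (suc N) (coef (replicate N first)) x + ∑ N (λ b → A-term b x)
    A-value x = trans (evℤ-+ (suc N) (coef (replicate N first)) (λ k → Σℤ N (λ b → + r ℤ.* shift (coef (W b)) k)) x) (+-congˡ (trans
      (evℤ-Σ (suc N) N (λ b k → + r ℤ.* shift (coef (W b)) k) x)
      (∑-cong N (λ b _ → trans (evℤ-* (suc N) (+ r) (shift (coef (W b))) x) (*-congˡ (evℤ-shift N (coef (W b)) x))))))

    I-value : ∀ x → evℤ (suc N) (I-coef N) x ≈ evℤ (suc N) (coef (replicate N last)) x + ∑ N (λ b → I-term b x)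
    I-value x = trans (evℤ-+ (suc N) (coef (replicate N last)) (λ k → Σℤ N (λ b → + r ℤ.* coef (V b) k)) x) (+-congˡ (trans
      (evℤ-Σ (suc N) N (λ b k → + r ℤ.* coef (V b) k) x)
      (∑-cong N (λ b b<N → trans (evℤ-* (suc N) (+ r) (coef (V b)) x) (*-congˡ
        (ev-last N (ι ∘ coef (V b)) x (trans (reflexive (≡.cong ι (coef-vanishes (V b) N
          (≡.subst (ℕ._< N) (≡.sym (length-V b (ℕₚ.≤-pred b<N))) ℕₚ.≤-refl)))) ι-0)))))))

    -- As the comparisons of zeros are weak, each term has its sign only weakly; a single strict
    -- term suffices for the sum.
    sum-sign : ∀ i {y z} (f : ℕ → Carrier) → y ≈ z + ∑ N f → 0# ≤ alt i z → (∀ b → b ℕ.< N → 0# ≤ alt i (f b)) →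
      ∀ b → b ℕ.< N → 0# < alt i (f b) → 0# < alt i y
    sum-sign i {y} {z} f y≈ 0≤z 0≤f b b<N 0<f = <-respʳ (trans
        (trans (+-comm _ _) (+-congˡ (sym (alt-∑ i N f)))) (trans (sym (alt-+ i z (∑ N f))) (alt-cong i (sym y≈))))
      (+-pos-nonNeg (∑-pos N (alt i ∘ f) b b<N 0≤f 0<f) 0≤z)

    zero-nonNeg : ∀ i {z} → z ≈ 0# → 0# ≤ alt i z
    zero-nonNeg i z≈0 = ≤-reflexive (sym (trans (alt-cong i z≈0) (alt-0 i)))

    -- The strict term is b = 1, where one `above` stands in place of a `middle` in the list that
    -- has the zeros `h`. The index 1 is in range because j < M forces M to be positive.
    A-at-h : ∀ j → j ℕ.< M → 0# < alt (suc j) (evℤ (suc N) (A-coef N) (h j))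
    A-at-h j j<M = sum-sign (suc j) (λ b → A-term b (h j)) (A-value (h j))
      (weak (replicate N first) (length-r N) (h j) (suc j) (ℕₚ.m≤n⇒m≤1+n j<M)
        (λ k k<sj → ≤-trans (h≤α j j<M) (α-mono k j (ℕₚ.≤-pred k<sj) (ℕₚ.m<n⇒m<1+n j<M)))
        (λ k sj≤k k<N → ≤-trans (α-mono (suc j) k sj≤k k<N) (α≤h j j<M)))
      (λ b b<N → *-neg-alt-weak j _ _ _ 0<r (h<0 j j<M)
        (weak (W b) (length-W b (ℕₚ.≤-pred b<N)) (h j) j (ℕₚ.<⇒≤ j<M)
          (λ k k<j → ≤-trans (h≤α j j<M) (≤-trans (α-mono (suc k) j k<j (ℕₚ.m<n⇒m<1+n j<M))
            (α≤w b (ℕₚ.≤-pred b<N) k (ℕₚ.<-trans k<j j<M))))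
          (λ k j≤k k<M → ≤-trans (w≤h b (ℕₚ.≤-pred b<N) k k<M) (h-mono j k j≤k k<M))))
      1 (s≤s (ℕₚ.≤-<-trans z≤n j<M)) (*-neg-alt j _ _ _ 0<r (h<0 j j<M) (strict M j j<M))
      where
      strict : ∀ M j → j ℕ.< M → 0# < alt j (evℤ (suc M) (coef (mixed above middle 1 (M ℕ.∸ 1))) (zeros (replicate M middle) j))
      strict (suc M) j (s≤s j≤M) = ≡.subst (λ n → 0# < alt j (evℤ (suc (suc n)) (coef (above ∷ replicate M middle)) (zeros (replicate (suc M) middle) j)))
        (length-r M) (raised-sign (suc q) (suc q) (replicate M middle) j (≡.subst (j ℕ.≤_) (≡.sym (length-r M)) j≤M))

    -- As in `A-at-h`, with the outermost `middle` lowered to `below`, so that the strict sign is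
    -- the opposite one; here no negative factor x intervenes.
    I-at-h : ∀ j → j ℕ.< M → 0# < alt (suc j) (evℤ (suc N) (I-coef N) (h j))
    I-at-h j j<M = sum-sign (suc j) (λ b → I-term b (h j)) (I-value (h j))
      (weak (replicate N last) (length-r N) (h j) (suc j) (ℕₚ.m≤n⇒m≤1+n j<M)
        (λ k k<sj → ≤-trans (h≤γ j j<M) (γ-mono k j (ℕₚ.≤-pred k<sj) (ℕₚ.m<n⇒m<1+n j<M)))
        (λ k sj≤k k<N → ≤-trans (γ-mono (suc j) k sj≤k k<N) (γ≤h j j<M)))
      (λ b b<N → *-pos-alt-weak (suc j) _ _ 0<r
        (weak (V b) (length-V b (ℕₚ.≤-pred b<N)) (h j) (suc j) j<M
          (λ k k<sj → ≤-trans (h-mono k j (ℕₚ.≤-pred k<sj) j<M) (h≤v b (ℕₚ.≤-pred b<N) k (ℕₚ.<-≤-trans k<sj j<M)))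
          (λ k sj≤k k<M → ≤-trans (v≤γ b (ℕₚ.≤-pred b<N) k k<M)
            (≤-trans (γ-mono (suc j) k sj≤k (ℕₚ.m<n⇒m<1+n k<M)) (γ≤h j j<M)))))
      1 (s≤s (ℕₚ.≤-<-trans z≤n j<M)) (*-pos-alt (suc j) _ _ 0<r (strict M j j<M))
      where
      strict : ∀ M j → j ℕ.< M → 0# < alt (suc j) (evℤ (suc M) (coef (mixed below middle 1 (M ℕ.∸ 1))) (zeros (replicate M middle) j))
      strict (suc M) j (s≤s j≤M) = ≡.subst (λ n → 0# < alt (suc j) (evℤ (suc (suc n)) (coef (below ∷ replicate M middle)) (zeros (replicate (suc M) middle) j)))
        (length-r M) (lowered-sign (suc q) (suc q) (replicate M middle) j (≡.subst (j ℕ.≤_) (≡.sym (length-r M)) j≤M))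

    W-top : W M ≡ replicate M above
    W-top = ≡.trans (≡.cong (mixed above middle M) (ℕₚ.n∸n≡0 M)) (Listₚ.++-identityʳ _)

    V-top : V M ≡ replicate M below
    V-top = ≡.trans (≡.cong (mixed below middle M) (ℕₚ.n∸n≡0 M)) (Listₚ.++-identityʳ _)

    -- The term outside the sum vanishes at its own zeros, so strictness comes from b = M: by
    -- `above-first` this term is the step (0 , r) over `first`, while α_i is a zero of the step (1
    -- , r - 1).
    A-at-α : ∀ i → i ℕ.< N → 0# < alt (suc i) (evℤ (suc N) (A-coef N) (α i))
    A-at-α i i<N@(s≤s i≤M) = sum-sign (suc i) (λ b → A-term b (α i)) (A-value (α i))
      (zero-nonNeg (suc i) (root (replicate N first) (length-r N) i i<N))
      (λ b b<N → *-neg-alt-weak i _ _ _ 0<r (α<0 i i<N)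
        (weak (W b) (length-W b (ℕₚ.≤-pred b<N)) (α i) i i≤M
          (λ k k<i → ≤-trans (α-mono (suc k) i k<i i<N) (α≤w b (ℕₚ.≤-pred b<N) k (ℕₚ.<-≤-trans k<i i≤M)))
          (λ k i≤k k<M → ≤-trans (w≤h b (ℕₚ.≤-pred b<N) k k<M)
            (≤-trans (h≤α k k<M) (α-mono i k i≤k (ℕₚ.m<n⇒m<1+n k<M))))))
      M ℕₚ.≤-refl (<-respʳ (alt-cong (suc i) (sym top)) strict)
      where
      x = α i
      top : A-term M x ≈ evℤ (suc N) (Dop 0 r M (coef (replicate M first))) x
      top = begin
        ι (+ r) * (x * evℤ N (coef (W M)) x)
          ≈⟨ *-congˡ (*-congˡ (reflexive (≡.cong (λ T → evℤ N (coef T) x) W-top))) ⟩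
        ι (+ r) * (x * evℤ N (coef (replicate M above)) x)
          ≈⟨ *-congˡ (evℤ-shift N (coef (replicate M above)) x) ⟨
        ι (+ r) * evℤ (suc N) (shift (coef (replicate M above))) x
          ≈⟨ evℤ-* (suc N) (+ r) (shift (coef (replicate M above))) x ⟨
        evℤ (suc N) (λ k → + r ℤ.* shift (coef (replicate M above)) k) x
          ≈⟨ evℤ-cong (suc N) x (above-first M) ⟩
        evℤ (suc N) (Dop 0 r M (coef (replicate M first))) x ∎
      strict : 0# < alt (suc i) (evℤ (suc N) (Dop 0 r M (coef (replicate M first))) x)
      strict = ≡.subst (λ n → 0# < alt (suc i) (evℤ (suc (suc n)) (Dop 0 r n (coef (replicate M first))) x)) (length-r M)
        (lowered-sign 0 q (replicate M first) i (≡.subst (i ℕ.≤_) (≡.sym (length-r M)) i≤M))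

    -- Mirror image of `A-at-α`: the step (r - 1 , 1) over `last` is altered to (r , 0).
    I-at-γ : ∀ i → i ℕ.< N → 0# < alt i (evℤ (suc N) (I-coef N) (γ i))
    I-at-γ i i<N@(s≤s i≤M) = sum-sign i (λ b → I-term b (γ i)) (I-value (γ i))
      (zero-nonNeg i (root (replicate N last) (length-r N) i i<N))
      (λ b b<N → *-pos-alt-weak i _ _ 0<r
        (weak (V b) (length-V b (ℕₚ.≤-pred b<N)) (γ i) i i≤M
          (λ k k<i → ≤-trans (γ-mono (suc k) i k<i i<N)
            (≤-trans (γ≤h k (ℕₚ.<-≤-trans k<i i≤M)) (h≤v b (ℕₚ.≤-pred b<N) k (ℕₚ.<-≤-trans k<i i≤M))))
          (λ k i≤k k<M → ≤-trans (v≤γ b (ℕₚ.≤-pred b<N) k k<M) (γ-mono i k i≤k (ℕₚ.m<n⇒m<1+n k<M)))))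
      M ℕₚ.≤-refl (<-respʳ (alt-cong i (sym top)) strict)
      where
      x = γ i
      top : I-term M x ≈ evℤ (suc N) (Dop r 0 M (coef (replicate M last))) x
      top = begin
        ι (+ r) * evℤ N (coef (V M)) x
          ≈⟨ *-congˡ (reflexive (≡.cong (λ T → evℤ N (coef T) x) V-top)) ⟩
        ι (+ r) * evℤ N (coef (replicate M below)) x
          ≈⟨ *-congˡ (ev-last N (ι ∘ coef (replicate M below)) x (trans (reflexive (≡.cong ι
               (coef-vanishes (replicate M below) N (≡.subst (ℕ._< N) (≡.sym (length-r M)) ℕₚ.≤-refl)))) ι-0)) ⟨
        ι (+ r) * evℤ (suc N) (coef (replicate M below)) x
          ≈⟨ evℤ-* (suc N) (+ r) (coef (replicate M below)) x ⟨
        evℤ (suc N) (λ k → + r ℤ.* coef (replicate M below) k) x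
          ≈⟨ evℤ-cong (suc N) x (below-last M) ⟩
        evℤ (suc N) (Dop r 0 M (coef (replicate M last))) x ∎
      strict : 0# < alt i (evℤ (suc N) (Dop r 0 M (coef (replicate M last))) x)
      strict = ≡.subst (λ n → 0# < alt i (evℤ (suc (suc n)) (Dop r 0 n (coef (replicate M last))) x)) (length-r M)
        (raised-sign q 0 (replicate M last) i (≡.subst (i ℕ.≤_) (≡.sym (length-r M)) i≤M))

    up : ℕ → Carrier
    up zero    = 0#
    up (suc j) = h j

    up-sign : ∀ i → i ℕ.< N → 0# < alt i (evℤ (suc N) (A-coef N) (up i))
    up-sign zero    _         = <-resp-≈ ι-0 (sym (evℤ-at-0 N (A-coef N))) (ι-mono-< (A-coef-const N))
    up-sign (suc j) (s≤s j<M) = A-at-h j j<M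

    α≤up : ∀ i → i ℕ.< N → α i ≤ up i
    α≤up zero    0<N       = <⇒≤ (α<0 0 0<N)
    α≤up (suc j) (s≤s j<M) = α≤h j j<M

    A-roots : ∃ λ (ρ : ℕ → Carrier) → ∀ i → i ℕ.< N → α i < ρ i × ρ i < up i × evℤ (suc N) (A-coef N) (ρ i) ≈ 0#
    A-roots = roots-between N (suc N) (A-coef N) α up α≤up A-at-α up-sign

    I-roots : ∃ λ (σ : ℕ → Carrier) → (∀ i → i ℕ.< M → h i < σ i) × (∀ i → i ℕ.< N → σ i < γ i) ×
      (∀ i → i ℕ.< N → evℤ (suc N) (I-coef N) (σ i) ≈ 0#)
    I-roots = roots-below M (I-coef N) h γ (I-coef-lead N) h≤γ I-at-h I-at-γ

  record InterlacingZeros (N : ℕ) : Set where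
    field
      ρ σ       : ℕ → Carrier
      A-factors : ∀ k → ι (A-coef N k) ≈ ι (A-coef N N) * π ρ N k
      I-factors : ∀ k → ι (I-coef N k) ≈ ι (I-coef N N) * π σ N k
      σ≤ρ       : ∀ i → i ℕ.< N → σ i ≤ ρ i
      ρ≤σ       : ∀ i → suc i ℕ.< N → ρ (suc i) ≤ σ i

  ι-vanishes : ∀ {c : ℕ → ℤ} {N} → (∀ k → N ℕ.< k → c k ≡ 0ℤ) → ∀ k → N ℕ.< k → ι (c k) ≈ 0#
  ι-vanishes v k N<k = trans (reflexive (≡.cong ι (v k N<k))) ι-0

  interlacingZeros : ∀ N → InterlacingZeros N
  interlacingZeros zero = record
    { ρ = λ _ → 0# ; σ = λ _ → 0#
    ; A-factors = factorise 0 (λ _ → 0#) (ι ∘ A-coef 0) (λ i j _ ()) (ι-vanishes (A-coef-vanishes 0)) (λ i ())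
    ; I-factors = factorise 0 (λ _ → 0#) (ι ∘ I-coef 0) (λ i j _ ()) (ι-vanishes (I-coef-vanishes 0)) (λ i ())
    ; σ≤ρ = λ i () ; ρ≤σ = λ i () }
  interlacingZeros (suc M) = record
    { ρ = ρ ; σ = σ
    ; A-factors = factorise (suc M) ρ (ι ∘ A-coef (suc M))
        (decreasing ρ (suc M) (λ { i (s≤s i<M) → <-trans (ρ<σ i i<M) (σ<ρ i (ℕₚ.m<n⇒m<1+n i<M)) }))
        (ι-vanishes (A-coef-vanishes (suc M))) (λ i i<N → proj₂ (proj₂ (proj₂ A-roots i i<N)))
    ; I-factors = factorise (suc M) σ (ι ∘ I-coef (suc M))
        (decreasing σ (suc M) (λ { i (s≤s i<M) → <-trans (σ<ρ (suc i) (s≤s i<M)) (ρ<σ i i<M) }))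
        (ι-vanishes (I-coef-vanishes (suc M))) (proj₂ (proj₂ (proj₂ I-roots)))
    ; σ≤ρ = λ i i<N → <⇒≤ (σ<ρ i i<N) ; ρ≤σ = λ { i (s≤s i<M) → <⇒≤ (ρ<σ i i<M) } }
    where
    open Degree M
    ρ = proj₁ A-roots
    σ = proj₁ I-roots

    -- The inequality γ_i ≤ α_i is the only link between the two families in this direction.
    σ<ρ : ∀ i → i ℕ.< suc M → σ i < ρ i
    σ<ρ i i<N = <-trans (<-≤-trans (proj₁ (proj₂ (proj₂ I-roots)) i i<N) (γ≤α i i<N)) (proj₁ (proj₂ A-roots i i<N))

    -- The points `h` separate the zeros of both sums: those of A lie below them with index shifted
    -- by one, those of I above them.
    ρ<σ : ∀ i → i ℕ.< M → ρ (suc i) < σ i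
    ρ<σ i i<M = <-trans (proj₁ (proj₂ (proj₂ A-roots (suc i) (s≤s i<M)))) (proj₁ (proj₂ I-roots) i i<M)

-- Numerators of power series

module IntegerSeries where
  open R using ([1-x]*_; [1-x]^_*_; powerDiff; A⁺-series)
  open ≡ using (refl; sym; trans; cong; cong₂; _≗_)
  open ≡.≡-Reasoning
  open ℤ-Solver.+-*-Solver using (solve; _:+_; _:*_; _:-_; :-_; con; _:=_)

  infixl 7 _·_
  _·_ : (ℕ → ℤ) → (ℕ → ℤ) → ℕ → ℤ
  (f · g) m = f m ℤ.* g m

  [1-x]-cong : ∀ {f g} → f ≗ g → [1-x]* f ≗ [1-x]* g
  [1-x]-cong e zero    = e zero
  [1-x]-cong e (suc k) = cong₂ ℤ._-_ (e (suc k)) (e k)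

  [1-x]^-cong : ∀ n {f g} → f ≗ g → [1-x]^ n * f ≗ [1-x]^ n * g
  [1-x]^-cong zero    e = e
  [1-x]^-cong (suc n) e = [1-x]-cong ([1-x]^-cong n e)

  [1-x]^-+ : ∀ n f g → [1-x]^ n * (λ m → f m ℤ.+ g m) ≗ (λ k → ([1-x]^ n * f) k ℤ.+ ([1-x]^ n * g) k)
  [1-x]^-+ zero    f g k       = refl
  [1-x]^-+ (suc n) f g zero    = [1-x]^-+ n f g zero
  [1-x]^-+ (suc n) f g (suc k) = trans (cong₂ ℤ._-_ ([1-x]^-+ n f g (suc k)) ([1-x]^-+ n f g k))
    (solve 4 (λ a b c d → (a :+ b) :- (c :+ d) := (a :- c) :+ (b :- d)) refl
      (([1-x]^ n * f) (suc k)) (([1-x]^ n * g) (suc k)) (([1-x]^ n * f) k) (([1-x]^ n * g) k))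

  [1-x]^-0 : ∀ n → [1-x]^ n * (λ _ → 0ℤ) ≗ (λ _ → 0ℤ)
  [1-x]^-0 zero    k       = refl
  [1-x]^-0 (suc n) zero    = [1-x]^-0 n zero
  [1-x]^-0 (suc n) (suc k) = cong₂ ℤ._-_ ([1-x]^-0 n (suc k)) ([1-x]^-0 n k)

  [1-x]^-Σ : ∀ n m (f : ℕ → ℕ → ℤ) →
    [1-x]^ n * (λ k → Σℤ m (λ b → f b k)) ≗ (λ k → Σℤ m (λ b → ([1-x]^ n * f b) k))
  [1-x]^-Σ n zero    f k = [1-x]^-0 n k
  [1-x]^-Σ n (suc m) f k =
    trans ([1-x]^-+ n (f 0) (λ k → Σℤ m (λ b → f (suc b) k)) k) (cong (ℤ._+_ (([1-x]^ n * f 0) k)) ([1-x]^-Σ n m (f ∘ suc) k))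

  [1-x]^-suc : ∀ n f → [1-x]^ n * ([1-x]* f) ≗ [1-x]^ suc n * f
  [1-x]^-suc zero    f = λ _ → refl
  [1-x]^-suc (suc n) f = [1-x]-cong ([1-x]^-suc n f)

  Σℤ-cong : ∀ n {f g} → (∀ b → b ℕ.< n → f b ≡ g b) → Σℤ n f ≡ Σℤ n g
  Σℤ-cong zero    e = refl
  Σℤ-cong (suc n) e = cong₂ ℤ._+_ (e 0 (s≤s z≤n)) (Σℤ-cong n (λ b b<n → e (suc b) (s≤s b<n)))

  Σℤ-* : ∀ n a f → Σℤ n (λ b → a ℤ.* f b) ≡ a ℤ.* Σℤ n f
  Σℤ-* zero    a f = sym (ℤₚ.*-zeroʳ a)
  Σℤ-* (suc n) a f = trans (cong (ℤ._+_ (a ℤ.* f 0)) (Σℤ-* n a (f ∘ suc))) (sym (ℤₚ.*-distribˡ-+ a (f 0) (Σℤ n (f ∘ suc))))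

  shift-cong : ∀ {b c} → b ≗ c → shift b ≗ shift c
  shift-cong e zero    = refl
  shift-cong e (suc k) = e k

  module Series (r : ℕ) where
    open Coefficients r

    u : ℕ → ℕ → ℤ
    u t m = + r ℤ.* + m ℤ.+ + t

    -- (1 - x)^(N+1) (r x d/dx + t) h / (1 - x)^N, coefficientwise
    [1-x]^-linear₀ : ∀ N t f → ([1-x]^ suc N * (u t · f)) zero ≡ + t ℤ.* ([1-x]^ N * f) zero
    [1-x]^-linear₀ zero    t f = cong (ℤ._* f 0) (trans (cong (ℤ._+ + t) (ℤₚ.*-zeroʳ (+ r))) (ℤₚ.+-identityˡ (+ t)))
    [1-x]^-linear₀ (suc N) t f = [1-x]^-linear₀ N t f

    [1-x]^-linear₊ : ∀ N t f k → ([1-x]^ suc N * (u t · f)) (suc k) ≡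
      (+ r ℤ.* + suc k ℤ.+ + t) ℤ.* ([1-x]^ N * f) (suc k) ℤ.+ (+ r ℤ.* (+ N ℤ.- + k) ℤ.- + t) ℤ.* ([1-x]^ N * f) k
    [1-x]^-linear₊ zero    t f k = solve 5 (λ r k t a b →
      (r :* (con 1ℤ :+ k) :+ t) :* a :- (r :* k :+ t) :* b
      := (r :* (con 1ℤ :+ k) :+ t) :* a :+ (r :* (con 0ℤ :- k) :- t) :* b) refl (+ r) (+ k) (+ t) (f (suc k)) (f k)
    [1-x]^-linear₊ (suc N) t f zero = trans (cong₂ ℤ._-_ ([1-x]^-linear₊ N t f zero) ([1-x]^-linear₀ N t f))
      (solve 5 (λ r N t a b →
        ((r :* con 1ℤ :+ t) :* a :+ (r :* (N :- con 0ℤ) :- t) :* b) :- t :* b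
        := (r :* con 1ℤ :+ t) :* (a :- b) :+ (r :* ((con 1ℤ :+ N) :- con 0ℤ) :- t) :* b) refl
        (+ r) (+ N) (+ t) (([1-x]^ N * f) 1) (([1-x]^ N * f) 0))
    [1-x]^-linear₊ (suc N) t f (suc k) = trans (cong₂ ℤ._-_ ([1-x]^-linear₊ N t f (suc k)) ([1-x]^-linear₊ N t f k))
      (solve 7 (λ r N k t a b c →
        ((r :* (con 1ℤ :+ (con 1ℤ :+ k)) :+ t) :* a :+ (r :* (N :- (con 1ℤ :+ k)) :- t) :* b)
          :- ((r :* (con 1ℤ :+ k) :+ t) :* b :+ (r :* (N :- k) :- t) :* c)
        := (r :* (con 1ℤ :+ (con 1ℤ :+ k)) :+ t) :* (a :- b) :+ (r :* ((con 1ℤ :+ N) :- (con 1ℤ :+ k)) :- t) :* (b :- c)) refl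
        (+ r) (+ N) (+ k) (+ t) (([1-x]^ N * f) (suc (suc k))) (([1-x]^ N * f) (suc k)) (([1-x]^ N * f) k))

    -- The factor r m + t acts on the series as r θ + t. Over the denominator (1 - x)^(d+1) this
    -- costs a further factor 1 - x, and the numerator acquires the slope r (d + 1) - t = r d + e.
    series-step : ∀ d t e f {c} → t ℕ.+ e ≡ r → [1-x]^ suc d * f ≗ c → [1-x]^ suc (suc d) * (u t · f) ≗ Dop t e d c
    series-step d t e f t+e≡r h zero    = trans ([1-x]^-linear₀ (suc d) t f) (cong (ℤ._*_ (+ t)) (h 0))
    series-step d t e f {c} t+e≡r h (suc k) = begin
      ([1-x]^ suc (suc d) * (u t · f)) (suc k)
        ≡⟨ [1-x]^-linear₊ (suc d) t f k ⟩
      (+ r ℤ.* + suc k ℤ.+ + t) ℤ.* ([1-x]^ suc d * f) (suc k) ℤ.+ (+ r ℤ.* (+ suc d ℤ.- + k) ℤ.- + t) ℤ.* ([1-x]^ suc d * f) k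
        ≡⟨ cong₂ (λ x y → (+ r ℤ.* + suc k ℤ.+ + t) ℤ.* x ℤ.+ (+ r ℤ.* (+ suc d ℤ.- + k) ℤ.- + t) ℤ.* y) (h (suc k)) (h k) ⟩
      (+ r ℤ.* + suc k ℤ.+ + t) ℤ.* c (suc k) ℤ.+ (+ r ℤ.* (+ suc d ℤ.- + k) ℤ.- + t) ℤ.* c k
        ≡⟨ cong (λ w → (+ r ℤ.* + suc k ℤ.+ + t) ℤ.* c (suc k) ℤ.+ w ℤ.* c k) bracket ⟩
      Dop t e d c (suc k) ∎
      where
      bracket : + r ℤ.* (+ suc d ℤ.- + k) ℤ.- + t ≡ + r ℤ.* (+ d ℤ.- + k) ℤ.+ + e
      bracket = trans (solve 4 (λ r d k t → r :* ((con 1ℤ :+ d) :- k) :- t := r :* (d :- k) :+ (r :- t)) refl (+ r) (+ d) (+ k) (+ t))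
        (cong (ℤ._+_ (+ r ℤ.* (+ d ℤ.- + k))) (trans (cong (λ s → + s ℤ.- + t) (sym t+e≡r))
          (solve 2 (λ t e → (t :+ e) :- t := e) refl (+ t) (+ e))))

    -- Since θ (x P) = x (P + θP), drawing x out of a step adds r (1 - x) to t + (r (d + 1) + e) x,
    -- giving (t + r) + (r d + e) x. This is the origin of `middle` and `above`.
    Dop-shift : ∀ d t e c → Dop t e (suc d) (λ k → + r ℤ.* shift c k) ≗ (λ k → + r ℤ.* shift (Dop (t ℕ.+ r) e d c) k)
    Dop-shift d t e c zero       = trans (cong (ℤ._*_ (+ t)) (ℤₚ.*-zeroʳ (+ r))) (trans (ℤₚ.*-zeroʳ (+ t)) (sym (ℤₚ.*-zeroʳ (+ r))))
    Dop-shift d t e c (suc zero) = solve 5 (λ r t d e c →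
      (r :* con 1ℤ :+ t) :* (r :* c) :+ (r :* ((con 1ℤ :+ d) :- con 0ℤ) :+ e) :* (r :* con 0ℤ) := r :* ((t :+ r) :* c)) refl
      (+ r) (+ t) (+ d) (+ e) (c 0)
    Dop-shift d t e c (suc (suc k)) = solve 7 (λ r t d e k b c →
      (r :* (con 1ℤ :+ (con 1ℤ :+ k)) :+ t) :* (r :* b) :+ (r :* ((con 1ℤ :+ d) :- (con 1ℤ :+ k)) :+ e) :* (r :* c)
      := r :* ((r :* (con 1ℤ :+ k) :+ (t :+ r)) :* b :+ (r :* (d :- k) :+ e) :* c)) refl
      (+ r) (+ t) (+ d) (+ e) (+ k) (c (suc k)) (c k)

    -- The coefficient at k has the weights r k + a and r (d + 1 - k) + e, which reversal exchanges
    -- together with `a` and `e`.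
    Dop-reverse : ∀ a e d {b c} → (∀ i j → i ℕ.+ j ≡ d → b i ≡ c j) → b (suc d) ≡ 0ℤ → c (suc d) ≡ 0ℤ →
      ∀ i j → i ℕ.+ j ≡ suc d → Dop a e d b i ≡ Dop e a d c j
    Dop-reverse a e d {b} {c} b~c b-vanishes c-vanishes zero .(suc d) refl = sym (trans (Dop-lead e a d c c-vanishes)
      (cong (ℤ._*_ (+ a)) (sym (b~c 0 d refl))))
    Dop-reverse a e d {b} {c} b~c b-vanishes c-vanishes (suc i) zero i+0≡ with trans (sym (ℕₚ.+-identityʳ i)) (ℕₚ.suc-injective i+0≡)
    ... | refl = trans (Dop-lead a e d b b-vanishes) (cong (ℤ._*_ (+ e)) (b~c d 0 (ℕₚ.+-identityʳ d)))
    Dop-reverse a e d {b} {c} b~c b-vanishes c-vanishes (suc i) (suc j) i+j≡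
      with refl ← ℕₚ.suc-injective i+j≡ = begin
        (+ r ℤ.* + suc i ℤ.+ + a) ℤ.* b (suc i) ℤ.+ (+ r ℤ.* (+ (i ℕ.+ suc j) ℤ.- + i) ℤ.+ + e) ℤ.* b i
          ≡⟨ cong₂ (λ x y → (+ r ℤ.* + suc i ℤ.+ + a) ℤ.* x ℤ.+ (+ r ℤ.* (+ (i ℕ.+ suc j) ℤ.- + i) ℤ.+ + e) ℤ.* y)
               (b~c (suc i) j (sym (ℕₚ.+-suc i j))) (b~c i (suc j) refl) ⟩
        (+ r ℤ.* + suc i ℤ.+ + a) ℤ.* c j ℤ.+ (+ r ℤ.* (+ (i ℕ.+ suc j) ℤ.- + i) ℤ.+ + e) ℤ.* c (suc j)
          ≡⟨ solve 7 (λ r i j a e x y →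
               (r :* (con 1ℤ :+ i) :+ a) :* x :+ (r :* ((i :+ (con 1ℤ :+ j)) :- i) :+ e) :* y
               := (r :* (con 1ℤ :+ j) :+ e) :* y :+ (r :* ((i :+ (con 1ℤ :+ j)) :- j) :+ a) :* x) refl
               (+ r) (+ i) (+ j) (+ a) (+ e) (c j) (c (suc j)) ⟩
        (+ r ℤ.* + suc j ℤ.+ + e) ℤ.* c (suc j) ℤ.+ (+ r ℤ.* (+ (i ℕ.+ suc j) ℤ.- + j) ℤ.+ + a) ℤ.* c j ∎

    coef-reverse : ∀ T i j → i ℕ.+ j ≡ length T → coef T i ≡ coef (map swap T) j
    coef-reverse []            zero zero _ = refl
    coef-reverse ((a , e) ∷ T) i    j    p = trans
      (Dop-reverse (suc a) (suc e) (length T) (coef-reverse T) (coef-vanishes T _ ℕₚ.≤-refl)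
        (coef-vanishes (map swap T) _ (≡.subst (ℕ._< suc (length T)) (sym (Listₚ.length-map swap T)) ℕₚ.≤-refl)) i j p)
      (cong (λ d → Dop (suc e) (suc a) d (coef (map swap T)) j) (sym (Listₚ.length-map swap T)))

  module Numerators (q : ℕ) where
    open Blocks q
    open Series r

    p p₀ : ℕ → ℤ
    p  = u 1
    p₀ = u 0

    pow : ℕ → ℕ → ℕ → ℤ
    pow a b m = p₀ m ℤ.^ a ℤ.* p m ℤ.^ b

    coef-∷ : ∀ a e T {d} → length T ≡ d → coef ((a , e) ∷ T) ≗ Dop (suc a) (suc e) d (coef T)
    coef-∷ a e T refl k = refl

    first-series : ∀ N → [1-x]^ suc N * (λ m → p m ℤ.^ N) ≗ coef (replicate N first)
    first-series zero    zero    = refl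
    first-series zero    (suc k) = refl
    first-series (suc N) k = trans (series-step N 1 (suc q) (λ m → p m ℤ.^ N) refl (first-series N) k)
      (sym (coef-∷ 0 q (replicate N first) (Listₚ.length-replicate N) k))

    -- The first factor rm turns 1/(1 - x) into r x/(1 - x)². By `Dop-shift` this r x passes through
    -- all later steps and changes (0 , r) into (r , r).
    middle-series : ∀ a → [1-x]^ suc (suc a) * pow (suc a) 0 ≗ (λ k → + r ℤ.* shift (coef (replicate a middle)) k)
    middle-series zero k = trans
      ([1-x]^-cong 2 {pow 1 0} {p₀ · (λ _ → 1ℤ)}
        (λ m → trans (ℤₚ.*-identityʳ (p₀ m ℤ.* 1ℤ)) refl) k)
      (trans (series-step 0 0 r (λ _ → 1ℤ) refl (first-series 0) k) (base k))
      where
      base : ∀ k → Dop 0 r 0 (coef []) k ≡ + r ℤ.* shift (coef []) k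
      base zero          = sym (ℤₚ.*-zeroʳ (+ r))
      base (suc zero)    = solve 1 (λ r → (r :* con 1ℤ :+ con 0ℤ) :* con 0ℤ :+ (r :* con 0ℤ :+ r) :* con 1ℤ := r :* con 1ℤ) refl (+ r)
      base (suc (suc k)) = solve 3 (λ r x y → x :* con 0ℤ :+ y :* con 0ℤ := r :* con 0ℤ) refl (+ r)
        (+ r ℤ.* + suc (suc k) ℤ.+ + 0) (+ r ℤ.* (+ 0 ℤ.- + suc k) ℤ.+ + r)
    middle-series (suc a) k = trans
      ([1-x]^-cong (suc (suc (suc a))) {pow (suc (suc a)) 0} {p₀ · pow (suc a) 0}
        (λ m → ℤₚ.*-assoc (p₀ m) (p₀ m ℤ.^ suc a) 1ℤ) k)
      (trans (series-step (suc a) 0 r (pow (suc a) 0) refl (middle-series a) k)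
        (trans (Dop-shift a 0 r (coef (replicate a middle)) k)
          (cong (λ c → + r ℤ.* c) (shift-cong (λ j → sym (coef-∷ (suc q) (suc q) (replicate a middle) (Listₚ.length-replicate a) j)) k))))

    above-series : ∀ a b → [1-x]^ suc (suc (b ℕ.+ a)) * pow (suc a) b ≗ (λ k → + r ℤ.* shift (coef (mixed above middle b a)) k)
    above-series a zero    = middle-series a
    above-series a (suc b) k = trans
      ([1-x]^-cong (suc (suc (suc (b ℕ.+ a)))) {pow (suc a) (suc b)} {p · pow (suc a) b}
        (λ m → solve 3 (λ x y z → x :* (y :* z) := y :* (x :* z)) refl (p₀ m ℤ.^ suc a) (p m) (p m ℤ.^ b)) k)
      (trans (series-step (suc (b ℕ.+ a)) 1 (suc q) (pow (suc a) b) refl (above-series a b) k)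
        (trans (Dop-shift (b ℕ.+ a) 1 (suc q) (coef (mixed above middle b a)) k)
          (cong (λ c → + r ℤ.* c) (shift-cong (λ j → sym (coef-∷ (suc (suc q)) q (mixed above middle b a) (length-mixed above middle b a) j)) k))))

    -- Both sides are the numerator of (rm) (rm + 1)^M, with the factor rm multiplied in at the
    -- beginning on the left and at the end on the right.
    above-first : ∀ M k → + r ℤ.* shift (coef (replicate M above)) k ≡ Dop 0 r M (coef (replicate M first)) k
    above-first M k = begin
      + r ℤ.* shift (coef (replicate M above)) k
        ≡⟨ cong (λ T → + r ℤ.* shift (coef T) k) (Listₚ.++-identityʳ (replicate M above)) ⟨
      + r ℤ.* shift (coef (mixed above middle M 0)) k
        ≡⟨ above-series 0 M k ⟨
      ([1-x]^ suc (suc (M ℕ.+ 0)) * pow 1 M) k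
        ≡⟨ cong (λ n → ([1-x]^ suc (suc n) * pow 1 M) k) (ℕₚ.+-identityʳ M) ⟩
      ([1-x]^ suc (suc M) * pow 1 M) k
        ≡⟨ [1-x]^-cong (suc (suc M)) {pow 1 M} {p₀ · (λ m → p m ℤ.^ M)} (λ m → cong (ℤ._* (p m ℤ.^ M)) (ℤₚ.*-identityʳ (p₀ m))) k ⟩
      ([1-x]^ suc (suc M) * (p₀ · (λ m → p m ℤ.^ M))) k
        ≡⟨ series-step M 0 r (λ m → p m ℤ.^ M) refl (first-series M) k ⟩
      Dop 0 r M (coef (replicate M first)) k ∎

    map-swap-mixed : ∀ s t b m → map swap (mixed {ℕ × ℕ} s t b m) ≡ mixed (swap s) (swap t) b m
    map-swap-mixed s t b m = trans (Listₚ.map-++ swap (replicate b s) (replicate m t))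
      (cong₂ _++_ (Listₚ.map-replicate swap b s) (Listₚ.map-replicate swap m t))

    mixed-reverse : ∀ s t b m i j → i ℕ.+ j ≡ b ℕ.+ m → coef (mixed s t b m) i ≡ coef (mixed (swap s) (swap t) b m) j
    mixed-reverse s t b m i j i+j = trans
      (coef-reverse (mixed s t b m) i j (trans i+j (sym (length-mixed s t b m))))
      (cong (λ T → coef T j) (map-swap-mixed s t b m))

    replicate-reverse : ∀ s N i j → i ℕ.+ j ≡ N → coef (replicate N s) i ≡ coef (replicate N (swap s)) j
    replicate-reverse s N i j i+j = trans
      (coef-reverse (replicate N s) i j (trans i+j (sym (Listₚ.length-replicate N))))
      (cong (λ T → coef T j) (Listₚ.map-replicate swap N s))

    -- The reversal of `above-first`, since swapping exchanges `above` with `below` and `first` with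
    -- `last`. Indices beyond M + 1 are out of reach of the reversal and are treated apart.
    below-last : ∀ M k → + r ℤ.* coef (replicate M below) k ≡ Dop r 0 M (coef (replicate M last)) k
    below-last M k with k ℕₚ.≤? suc M
    ... | no k≰ = trans (scaled-zero (replicate-vanishes below M (ℕₚ.<-trans ℕₚ.≤-refl (ℕₚ.≰⇒> k≰))))
                    (sym (Dop-vanishes r 0 M _ (λ j → replicate-vanishes last M) k (ℕₚ.≰⇒> k≰)))
    ... | yes k≤ = reversed k (suc M ℕ.∸ k) (ℕₚ.m+[n∸m]≡n k≤)
      where
      shifted : ∀ k j → k ℕ.+ j ≡ suc M → shift (coef (replicate M above)) j ≡ coef (replicate M below) k
      shifted k zero    k+0 = sym (replicate-vanishes below M (≡.subst (M ℕ.<_) (trans (sym k+0) (ℕₚ.+-identityʳ k)) ℕₚ.≤-refl))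
      shifted k (suc j) k+j = replicate-reverse above M j k
        (trans (ℕₚ.+-comm j k) (ℕₚ.suc-injective (trans (sym (ℕₚ.+-suc k j)) k+j)))
      reversed : ∀ k j → k ℕ.+ j ≡ suc M → + r ℤ.* coef (replicate M below) k ≡ Dop r 0 M (coef (replicate M last)) k
      reversed k j k+j = sym (trans
        (Dop-reverse r 0 M (replicate-reverse last M) (replicate-vanishes last M ℕₚ.≤-refl) (replicate-vanishes first M ℕₚ.≤-refl) k j k+j)
        (trans (sym (above-first M j)) (cong (ℤ._*_ (+ r)) (shifted k j k+j))))

    I-coef-reverse : ∀ N i j → i ℕ.+ j ≡ N → I-coef N i ≡ A-coef N j
    I-coef-reverse N i j i+j = cong₂ ℤ._+_ (replicate-reverse last N i j i+j)
      (Σℤ-cong N (λ b b<N → cong (ℤ._*_ (+ r)) (block b b<N i j i+j)))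
      where
      -- The blocks have degree N - 1 but are reversed with respect to N; the shift makes up for the
      -- difference.
      block : ∀ b → b ℕ.< N → ∀ i j → i ℕ.+ j ≡ N →
        coef (mixed below middle b (N ℕ.∸ suc b)) i ≡ shift (coef (mixed above middle b (N ℕ.∸ suc b))) j
      block b b<N i zero    i+0 = block-vanishes below middle b<N (ℕₚ.≤-reflexive (trans (sym i+0) (ℕₚ.+-identityʳ i)))
      block b b<N i (suc j) i+j = mixed-reverse below middle b (N ℕ.∸ suc b) i j
        (ℕₚ.suc-injective (trans (sym (ℕₚ.+-suc i j)) (trans i+j (sym (ℕₚ.m+[n∸m]≡n b<N)))))

    power-sum : ℕ → ℕ → ℤ
    power-sum N m = p m ℤ.^ N ℤ.+ Σℤ N (λ b → pow (suc (N ℕ.∸ suc b)) b m)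

    p≡p₀+1 : ∀ m → p m ≡ p₀ m ℤ.+ 1ℤ
    p≡p₀+1 m = solve 1 (λ x → x :+ con 1ℤ := (x :+ con 0ℤ) :+ con 1ℤ) refl (+ r ℤ.* + m)

    -- The factorisation of x^(N+1) - y^(N+1), with x - y = 1. The induction rests on S_(N+1) = x
    -- S_N + y^(N+1).
    power-sum≡ : ∀ N m → power-sum N m ≡ p m ℤ.^ suc N ℤ.- p₀ m ℤ.^ suc N
    power-sum≡ zero    m = trans (solve 1 (λ y → con 1ℤ :+ con 0ℤ := (y :+ con 1ℤ) :* con 1ℤ :- y :* con 1ℤ) refl (p₀ m))
      (cong (λ x → x ℤ.* 1ℤ ℤ.- p₀ m ℤ.* 1ℤ) (sym (p≡p₀+1 m)))
    power-sum≡ (suc N) m = begin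
      x ℤ.* x ℤ.^ N ℤ.+ (y ℤ.* y ℤ.^ N ℤ.* 1ℤ ℤ.+ Σℤ N (λ b → pow (suc (N ℕ.∸ suc b)) (suc b) m))
        ≡⟨ cong (λ s → x ℤ.* x ℤ.^ N ℤ.+ (y ℤ.* y ℤ.^ N ℤ.* 1ℤ ℤ.+ s))
             (trans (Σℤ-cong N (λ b _ → solve 3 (λ x y z → y :* (x :* z) := x :* (y :* z)) refl x (y ℤ.^ suc (N ℕ.∸ suc b)) (x ℤ.^ b)))
               (Σℤ-* N x (λ b → pow (suc (N ℕ.∸ suc b)) b m))) ⟩
      x ℤ.* x ℤ.^ N ℤ.+ (y ℤ.* y ℤ.^ N ℤ.* 1ℤ ℤ.+ x ℤ.* S)
        ≡⟨ solve 4 (λ x X Y S → x :* X :+ (Y :* con 1ℤ :+ x :* S) := x :* (X :+ S) :+ Y) refl x (x ℤ.^ N) (y ℤ.* y ℤ.^ N) S ⟩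
      x ℤ.* power-sum N m ℤ.+ y ℤ.* y ℤ.^ N
        ≡⟨ cong (λ s → x ℤ.* s ℤ.+ y ℤ.* y ℤ.^ N) (power-sum≡ N m) ⟩
      x ℤ.* (x ℤ.* x ℤ.^ N ℤ.- y ℤ.* y ℤ.^ N) ℤ.+ y ℤ.* y ℤ.^ N
        ≡⟨ cong (λ z → z ℤ.* (x ℤ.* x ℤ.^ N ℤ.- y ℤ.* y ℤ.^ N) ℤ.+ y ℤ.* y ℤ.^ N) (p≡p₀+1 m) ⟩
      (y ℤ.+ 1ℤ) ℤ.* (x ℤ.* x ℤ.^ N ℤ.- y ℤ.* y ℤ.^ N) ℤ.+ y ℤ.* y ℤ.^ N
        ≡⟨ solve 3 (λ y X Y → (y :+ con 1ℤ) :* (X :- Y) :+ Y := (y :+ con 1ℤ) :* X :- y :* Y) refl y (x ℤ.* x ℤ.^ N) (y ℤ.* y ℤ.^ N) ⟩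
      (y ℤ.+ 1ℤ) ℤ.* (x ℤ.* x ℤ.^ N) ℤ.- y ℤ.* (y ℤ.* y ℤ.^ N)
        ≡⟨ cong (λ z → z ℤ.* (x ℤ.* x ℤ.^ N) ℤ.- y ℤ.* (y ℤ.* y ℤ.^ N)) (p≡p₀+1 m) ⟨
      x ℤ.* (x ℤ.* x ℤ.^ N) ℤ.- y ℤ.* (y ℤ.* y ℤ.^ N) ∎
      where
      x = p m
      y = p₀ m
      S = Σℤ N (λ b → pow (suc (N ℕ.∸ suc b)) b m)

    powerDiff≡ : ∀ N m → powerDiff r (suc N) m ≡ power-sum N m
    powerDiff≡ N m = trans (cong₂ (λ x y → x ℤ.^ suc N ℤ.- y ℤ.^ suc N)
      (cong (ℤ._+ 1ℤ) (ℤₚ.pos-* r m)) (trans (ℤₚ.pos-* r m) (sym (ℤₚ.+-identityʳ _))))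
      (sym (power-sum≡ N m))

    A⁺-series≡A-coef : ∀ N → A⁺-series r (suc N) ≗ A-coef N
    A⁺-series≡A-coef N k = begin
      ([1-x]^ suc N * powerDiff r (suc N)) k
        ≡⟨ [1-x]^-cong (suc N) (powerDiff≡ N) k ⟩
      ([1-x]^ suc N * power-sum N) k
        ≡⟨ [1-x]^-+ (suc N) (λ m → p m ℤ.^ N) (λ m → Σℤ N (λ b → pow (suc (N ℕ.∸ suc b)) b m)) k ⟩
      ([1-x]^ suc N * (λ m → p m ℤ.^ N)) k ℤ.+ ([1-x]^ suc N * (λ m → Σℤ N (λ b → pow (suc (N ℕ.∸ suc b)) b m))) k
        ≡⟨ cong₂ ℤ._+_ (first-series N k) (trans ([1-x]^-Σ (suc N) N (λ b → pow (suc (N ℕ.∸ suc b)) b) k)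
             (Σℤ-cong N (λ b b<N → trans (cong (λ n → ([1-x]^ suc n * pow (suc (N ℕ.∸ suc b)) b) k) (sym (ℕₚ.m+[n∸m]≡n b<N)))
               (above-series (N ℕ.∸ suc b) b k)))) ⟩
      A-coef N k ∎

  -- Symmetric unimodal sequences and Eulerian numbers

  ≤-by : ∀ {d i j} → 0ℤ ℤ.≤ d → d ≡ j ℤ.- i → i ℤ.≤ j
  ≤-by 0≤d refl = ℤₚ.0≤i-j⇒j≤i 0≤d

  gap : ∀ {i j} → i ℤ.≤ j → 0ℤ ℤ.≤ j ℤ.- i
  gap = ℤₚ.i≤j⇒0≤j-i

  -- The centre is s/2. The arguments range over all integers so that reflections and shifts involve
  -- no truncated subtraction.
  record Unimodal (s : ℤ) (χ : ℤ → ℤ) : Set where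
    field
      symmetric : ∀ j → χ (s ℤ.- j) ≡ χ j
      rising    : ∀ j → j ℤ.+ (j ℤ.+ 1ℤ) ℤ.≤ s → χ j ℤ.≤ χ (j ℤ.+ 1ℤ)

    private
      rising-left : ∀ δ a → (a ℤ.+ + δ) ℤ.+ (a ℤ.+ + δ) ℤ.≤ s ℤ.+ 1ℤ → χ a ℤ.≤ χ (a ℤ.+ + δ)
      rising-left zero    a _ = ℤₚ.≤-reflexive (cong χ (sym (ℤₚ.+-identityʳ a)))
      rising-left (suc δ) a h = ℤₚ.≤-trans (rising-left δ a (≤-by (ℤₚ.+-mono-≤ (gap h) (ℤ.+≤+ (z≤n {2})))
          (solve 3 (λ s a δ → (s :+ con 1ℤ :- ((a :+ (con 1ℤ :+ δ)) :+ (a :+ (con 1ℤ :+ δ)))) :+ con (+ 2)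
            := s :+ con 1ℤ :- ((a :+ δ) :+ (a :+ δ))) refl s a (+ δ))))
        (ℤₚ.≤-trans (rising (a ℤ.+ + δ) (≤-by (gap h)
          (solve 3 (λ s a δ → s :+ con 1ℤ :- ((a :+ (con 1ℤ :+ δ)) :+ (a :+ (con 1ℤ :+ δ)))
            := s :- ((a :+ δ) :+ ((a :+ δ) :+ con 1ℤ))) refl s a (+ δ))))
          (ℤₚ.≤-reflexive (cong χ (solve 2 (λ a δ → (a :+ δ) :+ con 1ℤ := a :+ (con 1ℤ :+ δ)) refl a (+ δ)))))

      natural : ∀ {i} → 0ℤ ℤ.≤ i → ∃ λ n → i ≡ + n
      natural {+ n} _ = n , refl

    -- The conditions place `b` no further from the centre than `a`, which lies on the left. If `b`
    -- is beyond the centre, its reflection s - b is reached from `a` instead.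
    monotone : ∀ a b → a ℤ.≤ b → a ℤ.+ b ℤ.≤ s → χ a ℤ.≤ χ b
    -- The step from b - 1 to b is a rising one when (b - 1) + b ≤ s, hence the bound s + 1.
    monotone a b a≤b a+b≤s with (b ℤ.+ b) ℤₚ.≤? (s ℤ.+ 1ℤ)
    ... | yes left = ≡.subst (λ c → χ a ℤ.≤ χ c) a+δ≡b
            (rising-left δ a (≡.subst (λ c → c ℤ.+ c ℤ.≤ s ℤ.+ 1ℤ) (sym a+δ≡b) left))
      where
      δ = proj₁ (natural (gap a≤b))
      a+δ≡b : a ℤ.+ + δ ≡ b
      a+δ≡b = trans (cong (ℤ._+_ a) (sym (proj₂ (natural (gap a≤b))))) (solve 2 (λ a b → a :+ (b :- a) := b) refl a b)
    ... | no ¬left = ≡.subst (χ a ℤ.≤_) (trans (cong χ a+δ≡) (symmetric b))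
            (rising-left δ a (≡.subst (λ c → c ℤ.+ c ℤ.≤ s ℤ.+ 1ℤ) (sym a+δ≡) bound))
      where
      right : 0ℤ ℤ.≤ s ℤ.- b ℤ.- a
      right = ≡.subst (0ℤ ℤ.≤_) (solve 3 (λ s a b → s :- (a :+ b) := s :- b :- a) refl s a b) (gap a+b≤s)
      δ = proj₁ (natural right)
      a+δ≡ : a ℤ.+ + δ ≡ s ℤ.- b
      a+δ≡ = trans (cong (ℤ._+_ a) (sym (proj₂ (natural right)))) (solve 3 (λ s a b → a :+ (s :- b :- a) := s :- b) refl s a b)
      bound : (s ℤ.- b) ℤ.+ (s ℤ.- b) ℤ.≤ s ℤ.+ 1ℤ
      bound = ≤-by (ℤₚ.+-mono-≤ (gap (ℤₚ.<⇒≤ (ℤₚ.≰⇒> ¬left))) (ℤ.+≤+ (z≤n {2})))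
        (solve 2 (λ s b → (b :+ b :- (s :+ con 1ℤ)) :+ con (+ 2) := s :+ con 1ℤ :- ((s :- b) :+ (s :- b))) refl s b)

  Unimodal-cong : ∀ {s χ ξ} → χ ≗ ξ → Unimodal s χ → Unimodal s ξ
  Unimodal-cong {s} χ≗ξ U = record
    { symmetric = λ j → trans (sym (χ≗ξ (s ℤ.- j))) (trans (symmetric j) (χ≗ξ j))
    ; rising    = λ j h → ≡.subst₂ ℤ._≤_ (χ≗ξ j) (χ≗ξ (j ℤ.+ 1ℤ)) (rising j h)
    }
    where open Unimodal U

  Σℤ-last : ∀ n f → Σℤ (suc n) f ≡ Σℤ n f ℤ.+ f n
  Σℤ-last zero    f = ℤₚ.+-comm (f 0) 0ℤ
  Σℤ-last (suc n) f = trans (cong (ℤ._+_ (f 0)) (Σℤ-last n (f ∘ suc))) (sym (ℤₚ.+-assoc (f 0) (Σℤ n (f ∘ suc)) (f (suc n))))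

  Σℤ-reverse : ∀ n f g → (∀ i j → suc (i ℕ.+ j) ≡ n → f i ≡ g j) → Σℤ n f ≡ Σℤ n g
  Σℤ-reverse zero    f g e = refl
  Σℤ-reverse (suc n) f g e = begin
    f 0 ℤ.+ Σℤ n (f ∘ suc) ≡⟨ cong₂ ℤ._+_ (e 0 n refl) (Σℤ-reverse n (f ∘ suc) g (λ i j p → e (suc i) j (cong suc p))) ⟩
    g n ℤ.+ Σℤ n g         ≡⟨ ℤₚ.+-comm (g n) (Σℤ n g) ⟩
    Σℤ n g ℤ.+ g n         ≡⟨ Σℤ-last n g ⟨
    Σℤ (suc n) g           ∎

  Σℤ-- : ∀ n f g → Σℤ n (λ i → f i ℤ.- g i) ≡ Σℤ n f ℤ.- Σℤ n g
  Σℤ-- zero    f g = refl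
  Σℤ-- (suc n) f g = trans (cong (ℤ._+_ (f 0 ℤ.- g 0)) (Σℤ-- n (f ∘ suc) (g ∘ suc)))
    (solve 4 (λ a b c d → (a :- b) :+ (c :- d) := (a :+ c) :- (b :+ d)) refl (f 0) (g 0) (Σℤ n (f ∘ suc)) (Σℤ n (g ∘ suc)))

  -- In terms of generating functions, multiplication by 1 - x^c and by 1 + x + ⋯ + x^(r - 1).
  back : ℕ → (ℤ → ℤ) → ℤ → ℤ
  back c g j = g j ℤ.- g (j ℤ.- + c)

  window : ℕ → (ℤ → ℤ) → ℤ → ℤ
  window r g j = Σℤ r (λ i → g (j ℤ.- + i))

  back^ window^ : ℕ → ℕ → (ℤ → ℤ) → ℤ → ℤ
  back^ c zero    g = g
  back^ c (suc n) g = back c (back^ c n g)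
  window^ r zero    g = g
  window^ r (suc n) g = window r (window^ r n g)

  back-cong : ∀ c {g h} → g ≗ h → back c g ≗ back c h
  back-cong c e j = cong₂ ℤ._-_ (e j) (e (j ℤ.- + c))

  window-cong : ∀ r {g h} → g ≗ h → window r g ≗ window r h
  window-cong r e j = Σℤ-cong r (λ i _ → e (j ℤ.- + i))

  window^-cong : ∀ r n {g h} → g ≗ h → window^ r n g ≗ window^ r n h
  window^-cong r zero    e = e
  window^-cong r (suc n) e = window-cong r (window^-cong r n e)

  window-back : ∀ r g → window r (back 1 g) ≗ back r g
  window-back zero    g j = sym (trans (cong (λ i → g j ℤ.- g i) (ℤₚ.+-identityʳ j)) (ℤₚ.+-inverseʳ (g j)))
  window-back (suc r) g j = trans (Σℤ-last r (λ i → back 1 g (j ℤ.- + i))) (trans (cong (ℤ._+ back 1 g (j ℤ.- + r)) (window-back r g j))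
    (trans (solve 3 (λ a b c → (a :- b) :+ (b :- c) := a :- c) refl (g j) (g (j ℤ.- + r)) (g (j ℤ.- + r ℤ.- 1ℤ)))
      (cong (λ i → g j ℤ.- g i) (solve 2 (λ j r → j :- r :- con 1ℤ := j :- (con 1ℤ :+ r)) refl j (+ r)))))

  back-window : ∀ r g → back 1 (window r g) ≗ window r (back 1 g)
  back-window r g j = sym (trans (Σℤ-- r (λ i → g (j ℤ.- + i)) (λ i → g (j ℤ.- + i ℤ.- 1ℤ)))
    (cong (ℤ._-_ (window r g j)) (Σℤ-cong r (λ i _ → cong g (solve 2 (λ j i → j :- i :- con 1ℤ := j :- con 1ℤ :- i) refl j (+ i))))))

  back-window^ : ∀ r n g → back 1 (window^ r n g) ≗ window^ r n (back 1 g)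
  back-window^ r zero    g j = refl
  back-window^ r (suc n) g j = trans (back-window r (window^ r n g) j) (window-cong r (back-window^ r n g) j)

  -- The n-th power of the factorisation 1 - x^r = (1 - x) (1 + x + ⋯ + x^(r-1)).
  back^≗window^ : ∀ r n g → back^ r n g ≗ window^ r n (back^ 1 n g)
  back^≗window^ r zero    g j = refl
  back^≗window^ r (suc n) g j = begin
    back r (back^ r n g) j                       ≡⟨ back-cong r (back^≗window^ r n g) j ⟩
    back r (window^ r n (back^ 1 n g)) j         ≡⟨ window-back r (window^ r n (back^ 1 n g)) j ⟨
    window r (back 1 (window^ r n (back^ 1 n g))) j ≡⟨ window-cong r (back-window^ r n (back^ 1 n g)) j ⟩
    window r (window^ r n (back 1 (back^ 1 n g))) j ∎

  -- Moving the window by one place gains χ (j + 1) and loses χ (j - r), and `monotone` compares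
  -- exactly these two.
  window-Unimodal : ∀ r {s χ} → Unimodal s χ → Unimodal (s ℤ.+ + r) (window (suc r) χ)
  window-Unimodal r {s} {χ} U = record { symmetric = symmetric′ ; rising = rising′ }
    where
    open Unimodal U
    symmetric′ : ∀ j → window (suc r) χ (s ℤ.+ + r ℤ.- j) ≡ window (suc r) χ j
    symmetric′ j = Σℤ-reverse (suc r) _ _ (λ i k p → trans
      (cong χ (trans (cong (λ n → s ℤ.+ + n ℤ.- j ℤ.- + i) (sym (ℕₚ.suc-injective p)))
        (solve 4 (λ s i k j → s :+ (i :+ k) :- j :- i := s :- (j :- k)) refl s (+ i) (+ k) j)))
      (symmetric (j ℤ.- + k)))

    rising′ : ∀ j → j ℤ.+ (j ℤ.+ 1ℤ) ℤ.≤ s ℤ.+ + r → window (suc r) χ j ℤ.≤ window (suc r) χ (j ℤ.+ 1ℤ)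
    rising′ j h = ≡.subst₂ ℤ._≤_ (sym (Σℤ-last r (λ i → χ (j ℤ.- + i))))
      (trans (ℤₚ.+-comm common (χ (j ℤ.+ 1ℤ))) (cong₂ ℤ._+_ (cong χ (sym (ℤₚ.+-identityʳ _)))
        (Σℤ-cong r (λ i _ → cong χ (solve 2 (λ j i → j :- i := j :+ con 1ℤ :- (con 1ℤ :+ i)) refl j (+ i))))))
      (ℤₚ.+-monoʳ-≤ common (monotone (j ℤ.- + r) (j ℤ.+ 1ℤ)
        (≤-by (ℤ.+≤+ (z≤n {suc r})) (solve 2 (λ j r → con 1ℤ :+ r := j :+ con 1ℤ :- (j :- r)) refl j (+ r)))
        (≤-by (gap h) (solve 3 (λ s j r → s :+ r :- (j :+ (j :+ con 1ℤ)) := s :- ((j :- r) :+ (j :+ con 1ℤ))) refl s j (+ r)))))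
      where
      common : ℤ
      common = Σℤ r (λ i → χ (j ℤ.- + i))

  window^-Unimodal : ∀ r n {s χ} → Unimodal s χ → Unimodal (s ℤ.+ + (n ℕ.* r)) (window^ (suc r) n χ)
  window^-Unimodal r zero    {s} U = ≡.subst (λ t → Unimodal t _) (sym (ℤₚ.+-identityʳ s)) U
  window^-Unimodal r (suc n) {s} U = ≡.subst (λ t → Unimodal t _)
    (solve 3 (λ s r m → s :+ m :+ r := s :+ (r :+ m)) refl s (+ r) (+ (n ℕ.* r))) (window-Unimodal r (window^-Unimodal r n U))

  -- The coefficients of the Eulerian polynomial of degree s, extended by zero.
  eulerian : ℕ → ℤ → ℤ
  eulerian zero    (+ zero)  = 1ℤ
  eulerian zero    (+ suc _) = 0ℤ
  eulerian zero    -[1+ _ ]  = 0ℤ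
  eulerian (suc s) j = (j ℤ.+ 1ℤ) ℤ.* eulerian s j ℤ.+ (+ s ℤ.+ + 2 ℤ.- j) ℤ.* eulerian s (j ℤ.- 1ℤ)

  eulerian-negative : ∀ s k → eulerian s -[1+ k ] ≡ 0ℤ
  eulerian-negative zero    k = refl
  eulerian-negative (suc s) k = trans
    (cong₂ (λ x y → (-[1+ k ] ℤ.+ 1ℤ) ℤ.* x ℤ.+ (+ s ℤ.+ + 2 ℤ.- -[1+ k ]) ℤ.* y) (eulerian-negative s k) (eulerian-negative s (suc (k ℕ.+ 0))))
    (solve 2 (λ x y → x :* con 0ℤ :+ y :* con 0ℤ := con 0ℤ) refl (-[1+ k ] ℤ.+ 1ℤ) (+ s ℤ.+ + 2 ℤ.- -[1+ k ]))

  eulerian-0 : ∀ s → eulerian s 0ℤ ≡ 1ℤ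
  eulerian-0 zero    = refl
  eulerian-0 (suc s) = trans (cong₂ (λ x y → 1ℤ ℤ.* x ℤ.+ (+ s ℤ.+ + 2 ℤ.- 0ℤ) ℤ.* y) (eulerian-0 s) (eulerian-negative s 0))
    (solve 1 (λ y → con 1ℤ :* con 1ℤ :+ y :* con 0ℤ := con 1ℤ) refl (+ s ℤ.+ + 2 ℤ.- 0ℤ))

  eulerian-Unimodal : ∀ s → Unimodal (+ s) (eulerian s)
  eulerian-Unimodal zero = record { symmetric = symmetric ; rising = rising }
    where
    symmetric : ∀ j → eulerian 0 (0ℤ ℤ.- j) ≡ eulerian 0 j
    symmetric (+ zero)  = refl
    symmetric (+ suc k) = refl
    symmetric -[1+ k ]  = refl
    rising : ∀ j → j ℤ.+ (j ℤ.+ 1ℤ) ℤ.≤ 0ℤ → eulerian 0 j ℤ.≤ eulerian 0 (j ℤ.+ 1ℤ)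
    rising (+ zero)      (ℤ.+≤+ ())
    rising (+ suc k)     (ℤ.+≤+ ())
    rising -[1+ zero ]   _ = ℤ.+≤+ z≤n
    rising -[1+ suc k ]  _ = ℤₚ.≤-refl
  eulerian-Unimodal (suc s) = record { symmetric = symmetric′ ; rising = rising′ }
    where
    open Unimodal (eulerian-Unimodal s)
    E = eulerian s

    symmetric′ : ∀ j → eulerian (suc s) (+ suc s ℤ.- j) ≡ eulerian (suc s) j
    symmetric′ j = begin
      (+ suc s ℤ.- j ℤ.+ 1ℤ) ℤ.* E (+ suc s ℤ.- j) ℤ.+ (+ s ℤ.+ + 2 ℤ.- (+ suc s ℤ.- j)) ℤ.* E (+ suc s ℤ.- j ℤ.- 1ℤ)
        ≡⟨ cong₂ (λ x y → (+ suc s ℤ.- j ℤ.+ 1ℤ) ℤ.* x ℤ.+ (+ s ℤ.+ + 2 ℤ.- (+ suc s ℤ.- j)) ℤ.* y)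
             (trans (cong E (solve 2 (λ s j → (con 1ℤ :+ s) :- j := s :- (j :- con 1ℤ)) refl (+ s) j)) (symmetric (j ℤ.- 1ℤ)))
             (trans (cong E (solve 2 (λ s j → (con 1ℤ :+ s) :- j :- con 1ℤ := s :- j) refl (+ s) j)) (symmetric j)) ⟩
      (+ suc s ℤ.- j ℤ.+ 1ℤ) ℤ.* E (j ℤ.- 1ℤ) ℤ.+ (+ s ℤ.+ + 2 ℤ.- (+ suc s ℤ.- j)) ℤ.* E j
        ≡⟨ solve 4 (λ s j x y → ((con 1ℤ :+ s) :- j :+ con 1ℤ) :* y :+ (s :+ con (+ 2) :- ((con 1ℤ :+ s) :- j)) :* x
             := (j :+ con 1ℤ) :* x :+ (s :+ con (+ 2) :- j) :* y) refl (+ s) j (E j) (E (j ℤ.- 1ℤ)) ⟩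
      eulerian (suc s) j ∎

    difference : ∀ j → eulerian (suc s) (j ℤ.+ 1ℤ) ℤ.- eulerian (suc s) j ≡
      (j ℤ.+ + 2) ℤ.* (E (j ℤ.+ 1ℤ) ℤ.- E j) ℤ.+ (+ s ℤ.+ + 2 ℤ.- j) ℤ.* (E j ℤ.- E (j ℤ.- 1ℤ))
    difference j = trans
      (cong (λ i → ((j ℤ.+ 1ℤ ℤ.+ 1ℤ) ℤ.* E (j ℤ.+ 1ℤ) ℤ.+ (+ s ℤ.+ + 2 ℤ.- (j ℤ.+ 1ℤ)) ℤ.* E i) ℤ.- eulerian (suc s) j)
        (solve 1 (λ j → j :+ con 1ℤ :- con 1ℤ := j) refl j))
      (solve 5 (λ s j a b c → ((j :+ con 1ℤ :+ con 1ℤ) :* a :+ (s :+ con (+ 2) :- (j :+ con 1ℤ)) :* b)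
          :- ((j :+ con 1ℤ) :* b :+ (s :+ con (+ 2) :- j) :* c)
        := (j :+ con (+ 2)) :* (a :- b) :+ (s :+ con (+ 2) :- j) :* (b :- c)) refl
        (+ s) j (E (j ℤ.+ 1ℤ)) (E j) (E (j ℤ.- 1ℤ)))

    *-nonNeg : ∀ {i j} → 0ℤ ℤ.≤ i → 0ℤ ℤ.≤ j → 0ℤ ℤ.≤ i ℤ.* j
    *-nonNeg {+ m} {+ n} _ _ = ≡.subst (0ℤ ℤ.≤_) (ℤₚ.pos-* m n) (ℤ.+≤+ z≤n)

    -- If 2k + 1 ≤ s, both differences on the right of `difference` are nonnegative. Otherwise s =
    -- 2k, where symmetry makes them opposite and their weights are both k + 2, so that they cancel.
    rising⁺ : ∀ k → + k ℤ.+ (+ k ℤ.+ 1ℤ) ℤ.≤ + suc s → eulerian (suc s) (+ k) ℤ.≤ eulerian (suc s) (+ k ℤ.+ 1ℤ)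
    rising⁺ k h with (j ℤ.+ (j ℤ.+ 1ℤ)) ℤₚ.≤? + s
      where j = + k
    ... | yes h′ = ≤-by (ℤₚ.+-mono-≤
            (*-nonNeg {+ k ℤ.+ + 2} (ℤ.+≤+ z≤n) (gap (rising (+ k) h′)))
            (*-nonNeg (≡.subst (0ℤ ℤ.≤_) (solve 2 (λ s k → (s :- (k :+ (k :+ con 1ℤ))) :+ (k :+ con (+ 3)) := s :+ con (+ 2) :- k) refl (+ s) (+ k))
                (ℤₚ.+-mono-≤ (gap h′) (ℤ.+≤+ (z≤n {k ℕ.+ 3}))))
              (gap (≡.subst (λ i → E (+ k ℤ.- 1ℤ) ℤ.≤ E i) (solve 1 (λ k → k :- con 1ℤ :+ con 1ℤ := k) refl (+ k))
                (rising (+ k ℤ.- 1ℤ) (≤-by (ℤₚ.+-mono-≤ (gap h′) (ℤ.+≤+ (z≤n {2})))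
                  (solve 2 (λ s k → (s :- (k :+ (k :+ con 1ℤ))) :+ con (+ 2) := s :- ((k :- con 1ℤ) :+ ((k :- con 1ℤ) :+ con 1ℤ))) refl (+ s) (+ k))))))))
            (sym (difference (+ k)))
    ... | no ¬h′ = ≤-by (ℤₚ.≤-refl {0ℤ}) (sym (trans (difference (+ k)) (begin
        (+ k ℤ.+ + 2) ℤ.* (E (+ k ℤ.+ 1ℤ) ℤ.- E (+ k)) ℤ.+ (+ s ℤ.+ + 2 ℤ.- + k) ℤ.* (E (+ k) ℤ.- E (+ k ℤ.- 1ℤ))
          ≡⟨ cong₂ (λ x i → (+ k ℤ.+ + 2) ℤ.* (x ℤ.- E (+ k)) ℤ.+ (i ℤ.+ + 2 ℤ.- + k) ℤ.* (E (+ k) ℤ.- E (+ k ℤ.- 1ℤ)))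
               (trans (sym (symmetric (+ k ℤ.+ 1ℤ))) (cong E (trans (cong (ℤ._- (+ k ℤ.+ 1ℤ)) s≡2k)
                 (solve 1 (λ k → k :+ k :- (k :+ con 1ℤ) := k :- con 1ℤ) refl (+ k))))) s≡2k ⟩
        (+ k ℤ.+ + 2) ℤ.* (E (+ k ℤ.- 1ℤ) ℤ.- E (+ k)) ℤ.+ (+ k ℤ.+ + k ℤ.+ + 2 ℤ.- + k) ℤ.* (E (+ k) ℤ.- E (+ k ℤ.- 1ℤ))
          ≡⟨ solve 3 (λ k a b → (k :+ con (+ 2)) :* (b :- a) :+ (k :+ k :+ con (+ 2) :- k) :* (a :- b) := con 0ℤ) refl
               (+ k) (E (+ k)) (E (+ k ℤ.- 1ℤ)) ⟩
        0ℤ ∎)))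
      where
      s≡2k : + s ≡ + k ℤ.+ + k
      s≡2k = ℤₚ.≤-antisym
        (≤-by (gap (ℤₚ.i<j⇒suc[i]≤j (ℤₚ.≰⇒> ¬h′))) (solve 2 (λ s k → (k :+ (k :+ con 1ℤ)) :- (con 1ℤ :+ s) := k :+ k :- s) refl (+ s) (+ k)))
        (≤-by (gap h) (solve 2 (λ s k → (con 1ℤ :+ s) :- (k :+ (k :+ con 1ℤ)) := s :- (k :+ k)) refl (+ s) (+ k)))

    rising′ : ∀ j → j ℤ.+ (j ℤ.+ 1ℤ) ℤ.≤ + suc s → eulerian (suc s) j ℤ.≤ eulerian (suc s) (j ℤ.+ 1ℤ)
    rising′ (+ k)        h = rising⁺ k h
    rising′ -[1+ zero ]  _ = ≡.subst₂ ℤ._≤_ (sym (eulerian-negative (suc s) 0)) (sym (eulerian-0 (suc s))) (ℤ.+≤+ z≤n)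
    rising′ -[1+ suc k ] _ = ℤₚ.≤-reflexive (trans (eulerian-negative (suc s) (suc k)) (sym (eulerian-negative (suc s) k)))

  -- If h takes every (r + 1)-st value of g, then 1 - x acts on h as 1 - x^(r+1) acts on g. The
  -- vanishing at negative arguments matches the beginning of the series.
  sections : ∀ r n {h g} → (∀ k → h k ≡ g (+ (suc r ℕ.* k))) → (∀ k → g -[1+ k ] ≡ 0ℤ) →
    (∀ k → ([1-x]^ n * h) k ≡ back^ (suc r) n g (+ (suc r ℕ.* k))) × (∀ k → back^ (suc r) n g -[1+ k ] ≡ 0ℤ)
  sections r zero    h≡g g≡0 = h≡g , g≡0
  sections r (suc n) {h} {g} h≡g g≡0 = values , (λ k → cong₂ ℤ._-_ (neg k) (neg (suc (k ℕ.+ r))))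
    where
    val = proj₁ (sections r n h≡g g≡0)
    neg = proj₂ (sections r n {h} h≡g g≡0)
    G = back^ (suc r) n g

    values : ∀ k → ([1-x]^ suc n * h) k ≡ back (suc r) G (+ (suc r ℕ.* k))
    values zero = trans (val zero) (sym (trans (cong (ℤ._-_ (G (+ (suc r ℕ.* 0))))
      (trans (cong (λ m → G (+ m ℤ.- + suc r)) (ℕₚ.*-zeroʳ (suc r))) (neg r))) (ℤₚ.+-identityʳ _)))
    values (suc k) = cong₂ ℤ._-_ (val (suc k)) (trans (val k) (cong G (sym
      (trans (cong (λ m → + m ℤ.- + suc r) (ℕₚ.*-suc (suc r) k))
        (solve 2 (λ r m → r :+ m :- r := m) refl (+ suc r) (+ (suc r ℕ.* k)))))))

  module Sections where
    open Coefficients 1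
    open Series 1

    -- The classical series Σ (m + 1)^n x^m = A_n(x)/(1 - x)^(n+1) with n = s + 1. For r = 1 the
    -- step with t = 1 and e = 0 is the Eulerian recurrence.
    eulerian-series : ∀ s → [1-x]^ suc (suc s) * (λ m → u 1 m ℤ.^ suc s) ≗ eulerian s ∘ +_
    eulerian-series zero k = trans (series-step 0 1 0 (λ _ → 1ℤ) refl δ-series k) (base k)
      where
      δ-series : [1-x]^ 1 * (λ _ → 1ℤ) ≗ δ
      δ-series zero    = refl
      δ-series (suc k) = refl
      base : ∀ k → Dop 1 0 0 δ k ≡ eulerian 0 (+ k)
      base zero          = refl
      base (suc zero)    = refl
      base (suc (suc k)) = solve 2 (λ x y → x :* con 0ℤ :+ y :* con 0ℤ := con 0ℤ) refl
        (1ℤ ℤ.* + suc (suc k) ℤ.+ 1ℤ) (1ℤ ℤ.* (0ℤ ℤ.- + suc k) ℤ.+ 0ℤ)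
    eulerian-series (suc s) k = trans (series-step (suc s) 1 0 (λ m → u 1 m ℤ.^ suc s) refl (eulerian-series s) k) (step k)
      where
      step : ∀ k → Dop 1 0 (suc s) (eulerian s ∘ +_) k ≡ eulerian (suc s) (+ k)
      step zero    = trans (solve 2 (λ x y → con 1ℤ :* x := con 1ℤ :* x :+ y :* con 0ℤ) refl (eulerian s 0ℤ) (+ s ℤ.+ + 2 ℤ.- 0ℤ))
        (cong (λ y → 1ℤ ℤ.* eulerian s 0ℤ ℤ.+ (+ s ℤ.+ + 2 ℤ.- 0ℤ) ℤ.* y) (sym (eulerian-negative s 0)))
      step (suc k) = solve 4 (λ s k x y →
        (con 1ℤ :* (con 1ℤ :+ k) :+ con 1ℤ) :* x :+ (con 1ℤ :* ((con 1ℤ :+ s) :- k) :+ con 0ℤ) :* y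
        := ((con 1ℤ :+ k) :+ con 1ℤ) :* x :+ (s :+ con (+ 2) :- (con 1ℤ :+ k)) :* y) refl
        (+ s) (+ k) (eulerian s (+ suc k)) (eulerian s (+ k))

    -- The fine sequence of which `powerDiff r n` takes every r-th value, whatever r is.
    extended : ℕ → ℤ → ℤ
    extended n (+ j)    = (+ (j ℕ.+ 1)) ℤ.^ n ℤ.- (+ j) ℤ.^ n
    extended n -[1+ _ ] = 0ℤ

    powerDiff₁ : ∀ s → powerDiff 1 (suc s) ≗ [1-x]* (λ m → u 1 m ℤ.^ suc s)
    powerDiff₁ s zero    = ℤₚ.+-identityʳ _
    powerDiff₁ s (suc m) = cong₂ (λ x y → x ℤ.^ suc s ℤ.- y ℤ.^ suc s)
      (cong (ℤ._+ 1ℤ) (ℤₚ.pos-* 1 (suc m)))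
      (trans (cong +_ (trans (ℕₚ.*-identityˡ (suc m)) (sym (trans (cong (ℕ._+ 1) (ℕₚ.*-identityˡ m)) (ℕₚ.+-comm m 1)))))
        (cong (ℤ._+ 1ℤ) (ℤₚ.pos-* 1 m)))

    eulerian-extended : ∀ s → eulerian s ≗ back^ 1 (suc s) (extended (suc s))
    eulerian-extended s (+ k) = begin
      eulerian s (+ k)                                            ≡⟨ eulerian-series s k ⟨
      ([1-x]^ suc (suc s) * (λ m → u 1 m ℤ.^ suc s)) k            ≡⟨ [1-x]^-suc (suc s) (λ m → u 1 m ℤ.^ suc s) k ⟨
      ([1-x]^ suc s * ([1-x]* (λ m → u 1 m ℤ.^ suc s))) k         ≡⟨ [1-x]^-cong (suc s) (powerDiff₁ s) k ⟨
      ([1-x]^ suc s * powerDiff 1 (suc s)) k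
        ≡⟨ proj₁ (sections 0 (suc s) {powerDiff 1 (suc s)} {extended (suc s)} (λ _ → refl) (λ _ → refl)) k ⟩
      back^ 1 (suc s) (extended (suc s)) (+ (1 ℕ.* k))            ≡⟨ cong (λ m → back^ 1 (suc s) (extended (suc s)) (+ m)) (ℕₚ.*-identityˡ k) ⟩
      back^ 1 (suc s) (extended (suc s)) (+ k)                    ∎
    eulerian-extended s -[1+ k ] = trans (eulerian-negative s k)
      (sym (proj₂ (sections 0 (suc s) {powerDiff 1 (suc s)} {extended (suc s)} (λ _ → refl) (λ _ → refl)) k))

  -- The alternatingly increasing property

  module AlternatingIncrease (r d : ℕ) where
    open Sections

    ψ : ℤ → ℤ
    ψ = window^ (suc r) (suc d) (back^ 1 (suc d) (extended (suc d)))

    s : ℤ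
    s = + d ℤ.+ + (suc d ℕ.* r)

    open Unimodal (window^-Unimodal r (suc d) (Unimodal-cong (eulerian-extended d) (eulerian-Unimodal d)))
      using (symmetric; monotone)

    A⁺≡ψ : ∀ k → A⁺-series (suc r) (suc d) k ≡ ψ (+ (suc r ℕ.* k))
    A⁺≡ψ k = trans
      (proj₁ (sections r (suc d) {powerDiff (suc r) (suc d)} {extended (suc d)} (λ _ → refl) (λ _ → refl)) k)
      (back^≗window^ (suc r) (suc d) (extended (suc d)) (+ (suc r ℕ.* k)))

    s≡ : ∀ i j → i ℕ.+ j ≡ d → s ≡ + (suc r ℕ.* i) ℤ.+ + (suc r ℕ.* j) ℤ.+ + r
    s≡ i j refl = cong +_ (ℕ-lemma r i j)
      where
      open ℕ-Solver.+-*-Solver using () renaming (solve to solveℕ; _:+_ to _⊕_; _:*_ to _⊛_; con to conℕ; _:=_ to _⊜_)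
      ℕ-lemma : ∀ r i j → i ℕ.+ j ℕ.+ suc (i ℕ.+ j) ℕ.* r ≡ suc r ℕ.* i ℕ.+ suc r ℕ.* j ℕ.+ r
      ℕ-lemma = solveℕ 3 (λ r i j → (i ⊕ j) ⊕ ((conℕ 1 ⊕ (i ⊕ j)) ⊛ r)
        ⊜ (((conℕ 1 ⊕ r) ⊛ i) ⊕ ((conℕ 1 ⊕ r) ⊛ j)) ⊕ r) refl

    left≤right : ∀ i j → i ℕ.+ j ≡ d → i ℕ.≤ j → A⁺-series (suc r) (suc d) i ℤ.≤ A⁺-series (suc r) (suc d) j
    left≤right i j i+j i≤j = ≡.subst₂ ℤ._≤_ (sym (A⁺≡ψ i)) (sym (A⁺≡ψ j)) (monotone _ _
      (ℤ.+≤+ (ℕₚ.*-monoʳ-≤ (suc r) i≤j))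
      (≡.subst (+ (suc r ℕ.* i) ℤ.+ + (suc r ℕ.* j) ℤ.≤_) (sym (s≡ i j i+j)) (ℤ.+≤+ (ℕₚ.m≤m+n _ r))))

    -- As s = (r + 1) (i + j) + r, symmetry carries (r + 1) j to (r + 1) i + r. This is one less
    -- than (r + 1) (i + 1), and i < j keeps the sum of these two arguments within s.
    right≤left : ∀ i j → i ℕ.+ j ≡ d → i ℕ.< j → A⁺-series (suc r) (suc d) j ℤ.≤ A⁺-series (suc r) (suc d) (suc i)
    right≤left i j i+j i<j = ≡.subst₂ ℤ._≤_ (trans reflected (sym (A⁺≡ψ j))) (sym (A⁺≡ψ (suc i)))
      (monotone (R ℤ.+ + r) (+ (suc r ℕ.* suc i)) R+r≤ sum≤)
      where
      R = + (suc r ℕ.* i)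
      J = + (suc r ℕ.* j)

      reflected : ψ (R ℤ.+ + r) ≡ ψ J
      reflected = trans (cong ψ (trans (solve 3 (λ R J r → R :+ r := R :+ J :+ r :- J) refl R J (+ r))
        (cong (ℤ._- J) (sym (s≡ i j i+j))))) (symmetric J)

      R+r≤ : R ℤ.+ + r ℤ.≤ + (suc r ℕ.* suc i)
      R+r≤ = ℤ.+≤+ (≡.subst (suc r ℕ.* i ℕ.+ r ℕ.≤_) (trans (ℕₚ.+-comm (suc r ℕ.* i) (suc r)) (sym (ℕₚ.*-suc (suc r) i)))
        (ℕₚ.+-monoʳ-≤ (suc r ℕ.* i) (ℕₚ.n≤1+n r)))

      sum≤ : R ℤ.+ + r ℤ.+ + (suc r ℕ.* suc i) ℤ.≤ s
      sum≤ = ≡.subst (R ℤ.+ + r ℤ.+ + (suc r ℕ.* suc i) ℤ.≤_)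
        (trans (solve 3 (λ R J r → R :+ r :+ J := R :+ J :+ r) refl R J (+ r)) (sym (s≡ i j i+j)))
        (ℤₚ.+-monoʳ-≤ (R ℤ.+ + r) (ℤ.+≤+ (ℕₚ.*-monoʳ-≤ (suc r) i<j)))

-- The Cauchy reals

module CauchyReals where
  open R using (ℝ; seq; cauchy)
  open ≡ using (refl; sym; trans; cong; cong₂; subst; subst₂)
  open ℚ-Solver.+-*-Solver using (solve; _:+_; _:*_; _:-_; :-_; con; _:=_)

  module Rational where
    open import Data.Rational.Base using (_≤_; _<_; _+_; _-_; _*_; -_; ∣_∣)

    -- Linear arithmetic by certificates: q - p is exhibited as a nonnegative quantity and the ring
    -- solver checks the identity. The variants that follow add up several hypotheses.
    lin : ∀ d {p q} → 0ℚ ≤ d → d ≡ q - p → p ≤ q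
    lin d {p} {q} 0≤d e = subst₂ _≤_ (ℚₚ.+-identityˡ p)
      (trans (cong (_+ p) e) (solve 2 (λ p q → q :- p :+ p := q) refl p q)) (ℚₚ.+-monoˡ-≤ p 0≤d)

    gap : ∀ p q → p ≤ q → 0ℚ ≤ q - p
    gap p q p≤q = subst (_≤ q - p) (ℚₚ.+-inverseʳ p) (ℚₚ.+-monoˡ-≤ (- p) p≤q)

    lin₂ : ∀ a b {p q} → 0ℚ ≤ a → 0ℚ ≤ b → a + b ≡ q - p → p ≤ q
    lin₂ a b ha hb = lin (a + b) (ℚₚ.+-mono-≤ ha hb)

    lin₃ : ∀ a b c {p q} → 0ℚ ≤ a → 0ℚ ≤ b → 0ℚ ≤ c → a + (b + c) ≡ q - p → p ≤ q
    lin₃ a b c ha hb hc = lin₂ a (b + c) ha (ℚₚ.+-mono-≤ hb hc)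

    lin₄ : ∀ a b c d {p q} → 0ℚ ≤ a → 0ℚ ≤ b → 0ℚ ≤ c → 0ℚ ≤ d → a + (b + (c + d)) ≡ q - p → p ≤ q
    lin₄ a b c d ha hb hc hd = lin₃ a b (c + d) ha hb (ℚₚ.+-mono-≤ hc hd)

    lin₅ : ∀ a b c d e {p q} → 0ℚ ≤ a → 0ℚ ≤ b → 0ℚ ≤ c → 0ℚ ≤ d → 0ℚ ≤ e → a + (b + (c + (d + e))) ≡ q - p → p ≤ q
    lin₅ a b c d e ha hb hc hd he = lin₄ a b c (d + e) ha hb hc (ℚₚ.+-mono-≤ hd he)

    *-nonNeg : ∀ p q → 0ℚ ≤ p → 0ℚ ≤ q → 0ℚ ≤ p * q
    *-nonNeg p q 0≤p 0≤q = subst (_≤ p * q) (ℚₚ.*-zeroʳ p) (ℚₚ.*-monoˡ-≤-nonNeg p {{ℚ.nonNegative 0≤p}} 0≤q)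

    *-pos : ∀ p q → 0ℚ < p → 0ℚ < q → 0ℚ < p * q
    *-pos p q 0<p 0<q = subst (_< p * q) (ℚₚ.*-zeroʳ p) (ℚₚ.*-monoʳ-<-pos p {{ℚ.positive 0<p}} 0<q)

    *-mono-≤ : ∀ p q r s → 0ℚ ≤ p → 0ℚ ≤ s → p ≤ q → r ≤ s → p * r ≤ q * s
    *-mono-≤ p q r s 0≤p 0≤s p≤q r≤s = lin₂ (p * (s - r)) ((q - p) * s)
      (*-nonNeg p (s - r) 0≤p (gap r s r≤s)) (*-nonNeg (q - p) s (gap p q p≤q) 0≤s)
      (solve 4 (λ p q r s → p :* (s :- r) :+ (q :- p) :* s := q :* s :- p :* r) refl p q r s)

    0<1 : 0ℚ < 1ℚ
    0<1 = ℚₚ.positive⁻¹ 1ℚ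

    halve : ∀ ε → 0ℚ < ε → ∃ λ η → 0ℚ < η × η + η ≡ ε
    halve ε 0<ε = ½ * ε , *-pos ½ ε (ℚₚ.positive⁻¹ ½) 0<ε ,
      trans (sym (ℚₚ.*-distribʳ-+ ε ½ ½)) (ℚₚ.*-identityˡ ε)

    eighth : ∀ ε → 0ℚ < ε → ∃ λ η → 0ℚ < η × ((η + η) + (η + η)) + ((η + η) + (η + η)) ≡ ε
    eighth ε 0<ε with halve ε 0<ε
    ... | δ , 0<δ , refl with halve δ 0<δ
    ...   | γ , 0<γ , refl with halve γ 0<γ
    ...     | η , 0<η , refl = η , 0<η , refl

    p≤∣p∣ : ∀ p → p ≤ ∣ p ∣
    p≤∣p∣ p with ℚₚ.≤-total 0ℚ p
    ... | inj₁ 0≤p = ℚₚ.≤-reflexive (sym (ℚₚ.0≤p⇒∣p∣≡p 0≤p))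
    ... | inj₂ p≤0 = ℚₚ.≤-trans p≤0 (ℚₚ.0≤∣p∣ p)

    upper : ∀ p ε → ∣ p ∣ ≤ ε → 0ℚ ≤ ε - p
    upper p ε ∣p∣≤ε = gap p ε (ℚₚ.≤-trans (p≤∣p∣ p) ∣p∣≤ε)

    lower : ∀ p ε → ∣ p ∣ ≤ ε → 0ℚ ≤ ε + p
    lower p ε ∣p∣≤ε = subst (0ℚ ≤_) (solve 2 (λ ε p → ε :- (:- p) := ε :+ p) refl ε p)
      (gap (- p) ε (ℚₚ.≤-trans (subst (- p ≤_) (ℚₚ.∣-p∣≡∣p∣ p) (p≤∣p∣ (- p))) ∣p∣≤ε))

    abs-≤ : ∀ p ε → 0ℚ ≤ ε - p → 0ℚ ≤ ε + p → ∣ p ∣ ≤ ε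
    abs-≤ p ε up lo with ℚₚ.∣p∣≡p∨∣p∣≡-p p
    ... | inj₁ e = subst (_≤ ε) (sym e) (lin (ε - p) up refl)
    ... | inj₂ e = subst (_≤ ε) (sym e) (lin (ε + p) lo (solve 2 (λ ε p → ε :+ p := ε :- (:- p)) refl ε p))

    triangle : ∀ p q r η θ → p + q ≡ r → ∣ p ∣ ≤ η → ∣ q ∣ ≤ θ → ∣ r ∣ ≤ η + θ
    triangle p q r η θ refl hp hq = ℚₚ.≤-trans (ℚₚ.∣p+q∣≤∣p∣+∣q∣ p q) (ℚₚ.+-mono-≤ hp hq)

    near-sym : ∀ a b ε → ∣ a - b ∣ ≤ ε → ∣ b - a ∣ ≤ ε
    near-sym a b ε = subst (_≤ ε) (trans (sym (ℚₚ.∣-p∣≡∣p∣ (a - b)))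
      (cong ∣_∣ (solve 2 (λ a b → :- (a :- b) := b :- a) refl a b)))

    near-neg : ∀ a b ε → ∣ a - b ∣ ≤ ε → ∣ (- a) - (- b) ∣ ≤ ε
    near-neg a b ε = subst (_≤ ε) (trans (sym (ℚₚ.∣-p∣≡∣p∣ (a - b)))
      (cong ∣_∣ (solve 2 (λ a b → :- (a :- b) := :- a :- :- b) refl a b)))

    divide : ∀ M ε → 0ℚ < M → 0ℚ < ε → ∃ λ δ → 0ℚ < δ × M * δ ≡ ε
    divide M ε 0<M 0<ε = ε * i , *-pos ε i 0<ε (ℚₚ.positive⁻¹ i {{ℚₚ.1/pos⇒pos M {{pos}}}}) ,
      trans (solve 3 (λ M ε i → M :* (ε :* i) := ε :* (M :* i)) refl M ε i)
        (trans (cong (ε *_) (ℚₚ.*-inverseʳ M {{nz}})) (ℚₚ.*-identityʳ ε))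
      where
      pos = ℚ.positive 0<M
      nz = ℚₚ.pos⇒nonZero M {{pos}}
      i = ℚ.1/_ M {{nz}}

    eightfold : ℚ → ℚ
    eightfold e = ((e + e) + (e + e)) + ((e + e) + (e + e))

    -- Of the gap 3e, two parts absorb the errors of a and b, and one remains to witness strictness.
    separate : ∀ e a A b B → ∣ a - A ∣ ≤ e → ∣ b - B ∣ ≤ e → A + (e + (e + e)) ≤ B → a + e ≤ b
    separate e a A b B ha hb g = lin₃ (e - (a - A)) (e + (b - B)) (B - (A + (e + (e + e))))
      (upper (a - A) e ha) (lower (b - B) e hb) (gap _ B g)
      (solve 5 (λ e a A b B → (e :- (a :- A)) :+ ((e :+ (b :- B)) :+ (B :- (A :+ (e :+ (e :+ e))))) := b :- (a :+ e)) refl e a A b B)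

    near-≤ : ∀ e a A b B → 0ℚ ≤ e → ∣ a - A ∣ ≤ e → ∣ b - B ∣ ≤ e → A ≤ B + (e + (e + e)) → a ≤ b + eightfold e
    near-≤ e a A b B 0≤e ha hb g = lin₄ (e - (a - A)) (e + (b - B)) (B + (e + (e + e)) - A) (e + (e + e))
      (upper (a - A) e ha) (lower (b - B) e hb) (gap A _ g) (ℚₚ.+-mono-≤ 0≤e (ℚₚ.+-mono-≤ 0≤e 0≤e))
      (solve 5 (λ e a A b B → (e :- (a :- A)) :+ ((e :+ (b :- B)) :+ ((B :+ (e :+ (e :+ e)) :- A) :+ (e :+ (e :+ e))))
        := b :+ (((e :+ e) :+ (e :+ e)) :+ ((e :+ e) :+ (e :+ e))) :- a) refl e a A b B)

    squeeze : ∀ ε a b → a ≤ b + ε → b ≤ a + ε → ∣ a - b ∣ ≤ ε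
    squeeze ε a b h k = abs-≤ (a - b) ε
      (subst (0ℚ ≤_) (solve 3 (λ ε a b → b :+ ε :- a := ε :- (a :- b)) refl ε a b) (gap a (b + ε) h))
      (subst (0ℚ ≤_) (solve 3 (λ ε a b → a :+ ε :- b := ε :+ (a :- b)) refl ε a b) (gap b (a + ε) k))

    <-near : ∀ e a a′ b b′ → 0ℚ ≤ e → ∣ a - a′ ∣ ≤ e → ∣ b - b′ ∣ ≤ e → a + ((e + e) + (e + e)) ≤ b → a′ + e ≤ b′
    <-near e a a′ b b′ 0≤e ha hb g = lin₄ (b - (a + ((e + e) + (e + e)))) (e + (a - a′)) (e - (b - b′)) e
      (gap _ b g) (lower (a - a′) e ha) (upper (b - b′) e hb) 0≤e
      (solve 5 (λ e a a′ b b′ → (b :- (a :+ ((e :+ e) :+ (e :+ e)))) :+ ((e :+ (a :- a′)) :+ ((e :- (b :- b′)) :+ e))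
        := b′ :- (a′ :+ e)) refl e a a′ b b′)

    chain : ∀ ε δ a b c → 0ℚ ≤ δ → a + ε ≤ b → b + δ ≤ c → a + ε ≤ c
    chain ε δ a b c 0≤δ h k = lin₃ (b - (a + ε)) (c - (b + δ)) δ (gap _ b h) (gap _ c k) 0≤δ
      (solve 5 (λ ε δ a b c → (b :- (a :+ ε)) :+ ((c :- (b :+ δ)) :+ δ) := c :- (a :+ ε)) refl ε δ a b c)

    below-gap : ∀ e z Z x X y → 0ℚ ≤ e → Z ≤ X + ((e + e) + (e + e)) → ∣ z - Z ∣ ≤ e → ∣ x - X ∣ ≤ e →
      x + eightfold e ≤ y → z + e ≤ y
    below-gap e z Z x X y 0≤e h hz hx g = lin₅ (X + ((e + e) + (e + e)) - Z) (e - (z - Z)) (e + (x - X)) (y - (x + eightfold e)) e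
      (gap Z _ h) (upper (z - Z) e hz) (lower (x - X) e hx) (gap _ y g) 0≤e
      (solve 6 (λ e z Z x X y → (X :+ ((e :+ e) :+ (e :+ e)) :- Z) :+ ((e :- (z :- Z)) :+ ((e :+ (x :- X)) :+
          ((y :- (x :+ (((e :+ e) :+ (e :+ e)) :+ ((e :+ e) :+ (e :+ e))))) :+ e)))
        := y :- (z :+ e)) refl e z Z x X y)

    above-gap : ∀ e z Z x X → 0ℚ ≤ e → X + ((e + e) + (e + e)) ≤ Z → ∣ z - Z ∣ ≤ e → ∣ x - X ∣ ≤ e → x + e ≤ z
    above-gap e z Z x X 0≤e h hz hx = lin₄ (Z - (X + ((e + e) + (e + e)))) (e + (z - Z)) (e - (x - X)) e
      (gap _ Z h) (lower (z - Z) e hz) (upper (x - X) e hx) 0≤e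
      (solve 5 (λ e z Z x X → (Z :- (X :+ ((e :+ e) :+ (e :+ e)))) :+ ((e :+ (z :- Z)) :+ ((e :- (x :- X)) :+ e))
        := z :- (x :+ e)) refl e z Z x X)

    fromℤ : ℤ → ℚ
    fromℤ z = z ℚ./ 1

    toℚᵘ-fromℤ : ∀ z → ℚ.toℚᵘ (fromℤ z) ℚᵘ.≃ ℚᵘ.mkℚᵘ z 0
    toℚᵘ-fromℤ z = ℚₚ.toℚᵘ-fromℚᵘ (ℚᵘ.mkℚᵘ z 0)

    fromℤ-+ : ∀ a b → fromℤ (a ℤ.+ b) ≡ fromℤ a + fromℤ b
    fromℤ-+ a b = ℚₚ.toℚᵘ-injective (ℚᵘₚ.≃-trans (toℚᵘ-fromℤ (a ℤ.+ b)) (ℚᵘₚ.≃-trans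
      (ℚᵘ.*≡* (cong (ℤ._* ℤ.1ℤ) (sym (cong₂ ℤ._+_ (ℤₚ.*-identityʳ a) (ℤₚ.*-identityʳ b)))))
      (ℚᵘₚ.≃-sym (ℚᵘₚ.≃-trans (ℚₚ.toℚᵘ-homo-+ (fromℤ a) (fromℤ b)) (ℚᵘₚ.+-cong (toℚᵘ-fromℤ a) (toℚᵘ-fromℤ b))))))

    fromℤ-* : ∀ a b → fromℤ (a ℤ.* b) ≡ fromℤ a * fromℤ b
    fromℤ-* a b = ℚₚ.toℚᵘ-injective (ℚᵘₚ.≃-trans (toℚᵘ-fromℤ (a ℤ.* b))
      (ℚᵘₚ.≃-sym (ℚᵘₚ.≃-trans (ℚₚ.toℚᵘ-homo-* (fromℤ a) (fromℤ b)) (ℚᵘₚ.*-cong (toℚᵘ-fromℤ a) (toℚᵘ-fromℤ b)))))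

    fromℤ-neg : ∀ a → fromℤ (ℤ.- a) ≡ - fromℤ a
    fromℤ-neg a = ℚₚ.toℚᵘ-injective (ℚᵘₚ.≃-trans (toℚᵘ-fromℤ (ℤ.- a))
      (ℚᵘₚ.≃-sym (ℚᵘₚ.≃-trans (ℚₚ.toℚᵘ-homo‿- (fromℤ a)) (ℚᵘₚ.-‿cong (toℚᵘ-fromℤ a)))))

    fromℤ-mono-≤ : ∀ {a b} → a ℤ.≤ b → fromℤ a ≤ fromℤ b
    fromℤ-mono-≤ {a} {b} a≤b = ℚₚ.toℚᵘ-cancel-≤ (ℚᵘₚ.≤-respˡ-≃ (ℚᵘₚ.≃-sym (toℚᵘ-fromℤ a))
      (ℚᵘₚ.≤-respʳ-≃ (ℚᵘₚ.≃-sym (toℚᵘ-fromℤ b)) (ℚᵘ.*≤* (ℤₚ.*-monoʳ-≤-nonNeg ℤ.1ℤ a≤b))))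

    -- Denominators are at least 1. This yields an integer above a given rational, hence the
    -- Archimedean property.
    numerator-bound : ∀ q → q ≤ fromℤ (+ ℤ.∣ ℚ.↥ q ∣)
    numerator-bound q = ℚₚ.toℚᵘ-cancel-≤ (ℚᵘₚ.≤-respʳ-≃ (ℚᵘₚ.≃-sym (toℚᵘ-fromℤ (+ ℤ.∣ ℚ.↥ q ∣))) (bound q))
      where
      bound : ∀ q → ℚ.toℚᵘ q ℚᵘ.≤ ℚᵘ.mkℚᵘ (+ ℤ.∣ ℚ.↥ q ∣) 0
      bound (mkℚ (+ n)    d _) = ℚᵘ.*≤* (subst₂ ℤ._≤_ (ℤₚ.pos-* n 1) (ℤₚ.pos-* n (suc d)) (ℤ.+≤+ (ℕₚ.*-monoʳ-≤ n (s≤s z≤n))))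
      bound (mkℚ -[1+ n ] d _) = ℚᵘ.*≤* ℤ.-≤+

  module Real where
    open import Data.Rational.Base using (_≤_; _<_; _+_; _-_; _*_; -_; ∣_∣)
    open Rational

    Eventually : (ℕ → Set) → Set
    Eventually P = ∃ λ N → ∀ n → N ℕ.≤ n → P n

    both : ∀ {P Q R : ℕ → Set} → (∀ n → P n → Q n → R n) → Eventually P → Eventually Q → Eventually R
    both f (N , p) (M , q) = N ℕ.⊔ M , λ n h →
      f n (p n (ℕₚ.m⊔n≤o⇒m≤o N M h)) (q n (ℕₚ.m⊔n≤o⇒n≤o N M h))

    always : ∀ {P Q : ℕ → Set} → (∀ n → P n → Q n) → Eventually P → Eventually Q
    always f (N , p) = N , λ n h → f n (p n h)

    ≈-pointwise : ∀ x y → (∀ n → seq x n ≡ seq y n) → x R.≈ y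
    ≈-pointwise x y e ε 0<ε = 0 , λ n _ → subst (λ z → ∣ seq x n - z ∣ ≤ ε) (e n)
      (subst (λ z → ∣ z ∣ ≤ ε) (sym (ℚₚ.+-inverseʳ (seq x n))) (ℚₚ.<⇒≤ 0<ε))

    ≈-sym : ∀ x y → x R.≈ y → y R.≈ x
    ≈-sym x y e ε 0<ε = always (λ n → near-sym (seq x n) (seq y n) ε) (e ε 0<ε)

    ≈-trans : ∀ x y z → x R.≈ y → y R.≈ z → x R.≈ z
    ≈-trans x y z e f ε 0<ε with halve ε 0<ε
    ... | η , 0<η , refl = both (λ n → triangle (seq x n - seq y n) (seq y n - seq z n) (seq x n - seq z n) η η
      (solve 3 (λ a b c → (a :- b) :+ (b :- c) := a :- c) refl (seq x n) (seq y n) (seq z n))) (e η 0<η) (f η 0<η)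

    +-cong : ∀ x x′ y y′ → x R.≈ x′ → y R.≈ y′ → (x R.+ y) R.≈ (x′ R.+ y′)
    +-cong x x′ y y′ e f ε 0<ε with halve ε 0<ε
    ... | η , 0<η , refl = both (λ n → triangle (seq x n - seq x′ n) (seq y n - seq y′ n)
        (seq x n + seq y n - (seq x′ n + seq y′ n)) η η
        (solve 4 (λ a b c d → (a :- b) :+ (c :- d) := a :+ c :- (b :+ d)) refl (seq x n) (seq x′ n) (seq y n) (seq y′ n)))
      (e η 0<η) (f η 0<η)

    -‿cong : ∀ x y → x R.≈ y → (R.- x) R.≈ (R.- y)
    -‿cong x y e ε 0<ε = always (λ n → near-neg (seq x n) (seq y n) ε) (e ε 0<ε)

    bounded : ∀ x → ∃ λ M → 0ℚ < M × Eventually (λ n → ∣ seq x n ∣ ≤ M)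
    bounded x with cauchy x 1ℚ 0<1
    ... | N , h = 1ℚ + ∣ seq x N ∣ , ℚₚ.+-mono-<-≤ 0<1 (ℚₚ.0≤∣p∣ (seq x N)) , N , λ n N≤n →
      triangle (seq x n - seq x N) (seq x N) (seq x n) 1ℚ (∣ seq x N ∣)
        (solve 2 (λ a b → a :- b :+ b := a) refl (seq x n) (seq x N)) (h n N N≤n ℕₚ.≤-refl) ℚₚ.≤-refl

    bounded-*-small : ∀ (x d : ℕ → ℚ) M → 0ℚ < M → Eventually (λ n → ∣ x n ∣ ≤ M) →
      (∀ ε → 0ℚ < ε → Eventually (λ n → ∣ d n ∣ ≤ ε)) → ∀ ε → 0ℚ < ε → Eventually (λ n → ∣ x n * d n ∣ ≤ ε)
    bounded-*-small x d M 0<M bound small ε 0<ε = from (divide M ε 0<M 0<ε)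
      where
      from : (∃ λ δ → 0ℚ < δ × M * δ ≡ ε) → Eventually (λ n → ∣ x n * d n ∣ ≤ ε)
      from (δ , 0<δ , M*δ≡ε) = both {λ n → ∣ x n ∣ ≤ M} {λ n → ∣ d n ∣ ≤ δ} (λ n h k →
        ℚₚ.≤-trans (ℚₚ.≤-reflexive (ℚₚ.∣p*q∣≡∣p∣*∣q∣ (x n) (d n)))
          (ℚₚ.≤-trans (*-mono-≤ (∣ x n ∣) M (∣ d n ∣) δ (ℚₚ.0≤∣p∣ (x n)) (ℚₚ.<⇒≤ 0<δ) h k) (ℚₚ.≤-reflexive M*δ≡ε)))
        bound (small δ 0<δ)

    *-cong : ∀ x x′ y y′ → x R.≈ x′ → y R.≈ y′ → (x R.* y) R.≈ (x′ R.* y′)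
    *-cong x x′ y y′ e f ε 0<ε = from (halve ε 0<ε) (bounded x) (bounded y′)
      where
      p q t : ℕ → ℚ
      p n = seq x n * (seq y n - seq y′ n)
      q n = seq y′ n * (seq x n - seq x′ n)
      t n = seq x n * seq y n - seq x′ n * seq y′ n

      p+q≡t : ∀ n → p n + q n ≡ t n
      p+q≡t n = solve 4 (λ a b c d → a :* (c :- d) :+ d :* (a :- b) := a :* c :- b :* d) refl
        (seq x n) (seq x′ n) (seq y n) (seq y′ n)

      from : (∃ λ η → 0ℚ < η × η + η ≡ ε) → (∃ λ M → 0ℚ < M × Eventually (λ n → ∣ seq x n ∣ ≤ M)) →
        (∃ λ M → 0ℚ < M × Eventually (λ n → ∣ seq y′ n ∣ ≤ M)) → Eventually (λ n → ∣ t n ∣ ≤ ε)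
      from (η , 0<η , η+η≡ε) (M , 0<M , x≤M) (M′ , 0<M′ , y′≤M′) =
        both {λ n → ∣ p n ∣ ≤ η} {λ n → ∣ q n ∣ ≤ η}
          (λ n h k → ℚₚ.≤-trans (triangle (p n) (q n) (t n) η η (p+q≡t n) h k) (ℚₚ.≤-reflexive η+η≡ε))
          (bounded-*-small (seq x) (λ n → seq y n - seq y′ n) M 0<M x≤M f η 0<η)
          (bounded-*-small (seq y′) (λ n → seq x n - seq x′ n) M′ 0<M′ y′≤M′ e η 0<η)

    separated : ∀ x y e N → 0ℚ < e →
      (∀ n → N ℕ.≤ n → ∣ seq x n - seq x N ∣ ≤ e) → (∀ n → N ℕ.≤ n → ∣ seq y n - seq y N ∣ ≤ e) →
      seq x N + (e + (e + e)) ≤ seq y N → x R.< y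
    separated x y e N 0<e hx hy g = e , 0<e , N , λ n N≤n →
      separate e (seq x n) (seq x N) (seq y n) (seq y N) (hx n N≤n) (hy n N≤n) g

    common : ∀ x y ε → 0ℚ < ε → ∃ λ N →
      (∀ n → N ℕ.≤ n → ∣ seq x n - seq x N ∣ ≤ ε) × (∀ n → N ℕ.≤ n → ∣ seq y n - seq y N ∣ ≤ ε)
    common x y ε 0<ε with cauchy x ε 0<ε | cauchy y ε 0<ε
    ... | N , hx | M , hy = N ℕ.⊔ M ,
      (λ n h → hx n (N ℕ.⊔ M) (ℕₚ.m⊔n≤o⇒m≤o N M h) (ℕₚ.m≤m⊔n N M)) ,
      (λ n h → hy n (N ℕ.⊔ M) (ℕₚ.m⊔n≤o⇒n≤o N M h) (ℕₚ.m≤n⊔m N M))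

    -- At one late index N the comparison is rational and decidable. A gap of 3e there would already
    -- give y < x; without it the sequences stay within the allowance ε = 8e.
    ≮⇒≥ : ∀ x y → ¬ y R.< x → x R.≤ y
    ≮⇒≥ x y y≮x ε 0<ε with eighth ε 0<ε
    ... | e , 0<e , refl with common x y e 0<e
    ...   | N , hx , hy with seq y N + (e + (e + e)) ℚₚ.≤? seq x N
    ...     | yes h = ⊥-elim (y≮x (separated y x e N 0<e hy hx h))
    ...     | no ¬h = N , λ n N≤n → near-≤ e (seq x n) (seq x N) (seq y n) (seq y N) (ℚₚ.<⇒≤ 0<e)
      (hx n N≤n) (hy n N≤n) (ℚₚ.<⇒≤ (ℚₚ.≰⇒> ¬h))

    ≤-antisym : ∀ x y → x R.≤ y → y R.≤ x → x R.≈ y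
    ≤-antisym x y x≤y y≤x ε 0<ε = both (λ n → squeeze ε (seq x n) (seq y n)) (x≤y ε 0<ε) (y≤x ε 0<ε)

    <-resp-≈ : ∀ x x′ y y′ → x R.≈ x′ → y R.≈ y′ → x R.< y → x′ R.< y′
    <-resp-≈ x x′ y y′ e f (ε , 0<ε , x<y) with halve ε 0<ε
    ... | δ , 0<δ , refl with halve δ 0<δ
    ...   | η , 0<η , refl = η , 0<η , both (λ n g (h , k) →
        <-near η (seq x n) (seq x′ n) (seq y n) (seq y′ n) (ℚₚ.<⇒≤ 0<η) h k g)
      x<y (both (λ _ k l → k , l) (e η 0<η) (f η 0<η))

    <-irrefl : ∀ x → ¬ x R.< x
    <-irrefl x (ε , 0<ε , N , h) = ℚₚ.<-irrefl refl (ℚₚ.<-≤-trans 0<ε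
      (lin (seq x N - (seq x N + ε)) (gap (seq x N + ε) (seq x N) (h N ℕₚ.≤-refl))
        (solve 2 (λ ε a → a :- (a :+ ε) := con 0ℚ :- ε) refl ε (seq x N))))

    <-trans : ∀ x y z → x R.< y → y R.< z → x R.< z
    <-trans x y z (ε , 0<ε , x<y) (δ , 0<δ , y<z) = ε , 0<ε ,
      both (λ n → chain ε δ (seq x n) (seq y n) (seq z n) (ℚₚ.<⇒≤ 0<δ)) x<y y<z

    -- At a single late index z is compared with x + 4e, the middle of the guaranteed gap 8e, so
    -- that either answer leaves room for the errors e.
    <-cotrans : ∀ x y → x R.< y → ∀ z → x R.< z ⊎ z R.< y
    <-cotrans x y (ε , 0<ε , K , x<y) z with eighth ε 0<ε
    ... | e , 0<e , refl = cases (seq z M ℚₚ.≤? seq x M + ((e + e) + (e + e)))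
      where
      cx = cauchy x e 0<e
      cz = cauchy z e 0<e
      M = K ℕ.⊔ (proj₁ cx ℕ.⊔ proj₁ cz)

      x-near : ∀ n → M ℕ.≤ n → ∣ seq x n - seq x M ∣ ≤ e
      x-near n M≤n = proj₂ cx n M (ℕₚ.≤-trans x≤M M≤n) x≤M
        where x≤M = ℕₚ.≤-trans (ℕₚ.m≤m⊔n (proj₁ cx) (proj₁ cz)) (ℕₚ.m≤n⊔m K _)

      z-near : ∀ n → M ℕ.≤ n → ∣ seq z n - seq z M ∣ ≤ e
      z-near n M≤n = proj₂ cz n M (ℕₚ.≤-trans z≤M M≤n) z≤M
        where z≤M = ℕₚ.≤-trans (ℕₚ.m≤n⊔m (proj₁ cx) (proj₁ cz)) (ℕₚ.m≤n⊔m K _)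

      cases : Dec (seq z M ≤ seq x M + ((e + e) + (e + e))) → x R.< z ⊎ z R.< y
      cases (yes z≤) = inj₂ (e , 0<e , M , λ n M≤n →
        below-gap e (seq z n) (seq z M) (seq x n) (seq x M) (seq y n) (ℚₚ.<⇒≤ 0<e) z≤ (z-near n M≤n) (x-near n M≤n)
          (x<y n (ℕₚ.≤-trans (ℕₚ.m≤m⊔n K _) M≤n)))
      cases (no z≰) = inj₁ (e , 0<e , M , λ n M≤n →
        above-gap e (seq z n) (seq z M) (seq x n) (seq x M) (ℚₚ.<⇒≤ 0<e) (ℚₚ.<⇒≤ (ℚₚ.≰⇒> z≰)) (z-near n M≤n) (x-near n M≤n))

    +-monoʳ-< : ∀ z x y → x R.< y → (z R.+ x) R.< (z R.+ y)
    +-monoʳ-< z x y (ε , 0<ε , x<y) = ε , 0<ε , always (λ n h →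
      lin (seq y n - (seq x n + ε)) (gap (seq x n + ε) (seq y n) h)
        (solve 4 (λ ε a b c → b :- (a :+ ε) := c :+ b :- (c :+ a :+ ε)) refl ε (seq x n) (seq y n) (seq z n))) x<y

    0<*-real : ∀ x y → R.0ℝ R.< x → R.0ℝ R.< y → R.0ℝ R.< (x R.* y)
    0<*-real x y (ε , 0<ε , 0<x) (δ , 0<δ , 0<y) = ε * δ , *-pos ε δ 0<ε 0<δ , both (λ n h k →
      let ε≤x = subst (_≤ seq x n) (ℚₚ.+-identityˡ ε) h
          δ≤y = subst (_≤ seq y n) (ℚₚ.+-identityˡ δ) k
      in subst (_≤ seq x n * seq y n) (sym (ℚₚ.+-identityˡ (ε * δ)))
        (*-mono-≤ ε (seq x n) δ (seq y n) (ℚₚ.<⇒≤ 0<ε) (ℚₚ.≤-trans (ℚₚ.<⇒≤ 0<δ) δ≤y) ε≤x δ≤y)) 0<x 0<y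

    ι-mono-< : ∀ {a b} → a ℤ.< b → R.fromℤ a R.< R.fromℤ b
    ι-mono-< {a} {b} a<b = 1ℚ , 0<1 , 0 , λ _ _ → subst (_≤ fromℤ b)
      (trans (fromℤ-+ ℤ.1ℤ a) (ℚₚ.+-comm 1ℚ (fromℤ a))) (fromℤ-mono-≤ (ℤₚ.i<j⇒suc[i]≤j a<b))

    archimedean : ∀ x → ∃ λ m → R.fromℤ (ℤ.- (+ m)) R.< x
    archimedean x = from (bounded x)
      where
      from : (∃ λ M → 0ℚ < M × Eventually (λ n → ∣ seq x n ∣ ≤ M)) → ∃ λ m → R.fromℤ (ℤ.- (+ m)) R.< x
      from (M , 0<M , x≤M) = suc m , 1ℚ , 0<1 ,
        always {λ n → ∣ seq x n ∣ ≤ M} {λ n → fromℤ (ℤ.- (+ suc m)) + 1ℚ ≤ seq x n}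
          (λ n h → subst (_≤ seq x n) (sym shifted) (bound (seq x n) h)) x≤M
        where
        m = ℤ.∣ ℚ.↥ M ∣
        shifted : fromℤ (ℤ.- (+ suc m)) + 1ℚ ≡ - fromℤ (+ m)
        shifted = trans (cong (_+ 1ℚ) (trans (fromℤ-neg (+ suc m)) (cong -_ (fromℤ-+ ℤ.1ℤ (+ m)))))
          (cancel 1ℚ (fromℤ (+ m)))
          where
          cancel : ∀ a b → - (a + b) + a ≡ - b
          cancel = solve 2 (λ a b → :- (a :+ b) :+ a := :- b) refl
        bound : ∀ a → ∣ a ∣ ≤ M → - fromℤ (+ m) ≤ a
        bound a h = lin₂ (M + a) (fromℤ (+ m) - M) (lower a M h) (gap M (fromℤ (+ m)) (numerator-bound M))
          (sum M (fromℤ (+ m)) a)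
          where
          sum : ∀ M m a → (M + a) + (m - M) ≡ a - (- m)
          sum = solve 3 (λ M m a → (M :+ a) :+ (m :- M) := a :- (:- m)) refl

    commutativeRing : CommutativeRing 0ℓ 0ℓ
    commutativeRing = record
      { Carrier = ℝ ; _≈_ = R._≈_ ; _+_ = R._+_ ; _*_ = R._*_ ; -_ = R.-_ ; 0# = R.0ℝ ; 1# = R.1ℝ
      ; isCommutativeRing = record
        { isRing = record
          { +-isAbelianGroup = record
            { isGroup = record
              { isMonoid = record
                { isSemigroup = record
                  { isMagma = record
                    { isEquivalence = isEquivalence
                    ; ∙-cong = λ {x} {y} {u} {v} → +-cong x y u v }
                  ; assoc = λ x y z → ≈-pointwise (x R.+ y R.+ z) (x R.+ (y R.+ z)) (λ n → ℚₚ.+-assoc (seq x n) (seq y n) (seq z n)) }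
                ; identity = (λ x → ≈-pointwise (R.0ℝ R.+ x) x (λ n → ℚₚ.+-identityˡ (seq x n)))
                           , (λ x → ≈-pointwise (x R.+ R.0ℝ) x (λ n → ℚₚ.+-identityʳ (seq x n))) }
              ; inverse = (λ x → ≈-pointwise (R.- x R.+ x) R.0ℝ (λ n → ℚₚ.+-inverseˡ (seq x n)))
                        , (λ x → ≈-pointwise (x R.+ (R.- x)) R.0ℝ (λ n → ℚₚ.+-inverseʳ (seq x n)))
              ; ⁻¹-cong = λ {x} {y} → -‿cong x y }
            ; comm = λ x y → ≈-pointwise (x R.+ y) (y R.+ x) (λ n → ℚₚ.+-comm (seq x n) (seq y n)) }
          ; *-cong = λ {x} {y} {u} {v} → *-cong x y u v
          ; *-assoc = λ x y z → ≈-pointwise (x R.* y R.* z) (x R.* (y R.* z)) (λ n → ℚₚ.*-assoc (seq x n) (seq y n) (seq z n))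
          ; *-identity = (λ x → ≈-pointwise (R.1ℝ R.* x) x (λ n → ℚₚ.*-identityˡ (seq x n)))
                       , (λ x → ≈-pointwise (x R.* R.1ℝ) x (λ n → ℚₚ.*-identityʳ (seq x n)))
          ; distrib = (λ x y z → ≈-pointwise (x R.* (y R.+ z)) (x R.* y R.+ x R.* z) (λ n → ℚₚ.*-distribˡ-+ (seq x n) (seq y n) (seq z n)))
                    , (λ x y z → ≈-pointwise ((y R.+ z) R.* x) (y R.* x R.+ z R.* x) (λ n → ℚₚ.*-distribʳ-+ (seq x n) (seq y n) (seq z n))) }
        ; *-comm = λ x y → ≈-pointwise (x R.* y) (y R.* x) (λ n → ℚₚ.*-comm (seq x n) (seq y n)) } }
      where
      isEquivalence : IsEquivalence R._≈_
      isEquivalence = record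
        { refl = λ {x} → R.≈-refl {x} ; sym = λ {x} {y} → ≈-sym x y ; trans = λ {x} {y} {z} → ≈-trans x y z }

    heytingRing : HeytingRing
    heytingRing = record
      { commutativeRing = commutativeRing
      ; _<_       = R._<_
      ; <-resp-≈  = λ {x} {x′} {y} {y′} → <-resp-≈ x x′ y y′
      ; <-irrefl  = λ {x} → <-irrefl x
      ; <-trans   = λ {x} {y} {z} → <-trans x y z
      ; <-cotrans = λ {x} {y} → <-cotrans x y
      ; <-tight   = λ {x} {y} x≮y y≮x → ≤-antisym x y (≮⇒≥ x y y≮x) (≮⇒≥ y x x≮y)
      ; +-monoʳ-< = λ z {x} {y} → +-monoʳ-< z x y
      ; *-pos     = λ {x} {y} → 0<*-real x y
      ; ι         = R.fromℤ
      ; ι-+       = λ a b → ≈-pointwise (R.fromℤ (a ℤ.+ b)) (R.fromℤ a R.+ R.fromℤ b) (λ _ → fromℤ-+ a b)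
      ; ι-*       = λ a b → ≈-pointwise (R.fromℤ (a ℤ.* b)) (R.fromℤ a R.* R.fromℤ b) (λ _ → fromℤ-* a b)
      ; ι-neg     = λ a → ≈-pointwise (R.fromℤ (ℤ.- a)) (R.- R.fromℤ a) (λ _ → fromℤ-neg a)
      ; ι-0       = ≈-pointwise (R.fromℤ ℤ.0ℤ) R.0ℝ (λ _ → refl)
      ; ι-1       = ≈-pointwise (R.fromℤ ℤ.1ℤ) R.1ℝ (λ _ → refl)
      ; ι-mono-<  = ι-mono-<
      ; archimedean = archimedean
      }

  -- Lipschitz bounds, bisection and the intermediate value theorem

  module RationalEvaluation where
    open import Data.Rational.Base using (_≤_; _<_; _+_; _-_; _*_; -_; ∣_∣)
    open Rational
    open Real

    evℚ : ℕ → (ℕ → ℚ) → ℚ → ℚ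
    evℚ zero    c x = 0ℚ
    evℚ (suc n) c x = c 0 + x * evℚ n (c ∘ suc) x

    abs-* : ∀ p q P Q → 0ℚ ≤ Q → ∣ p ∣ ≤ P → ∣ q ∣ ≤ Q → ∣ p * q ∣ ≤ P * Q
    abs-* p q P Q 0≤Q hp hq = ℚₚ.≤-trans (ℚₚ.≤-reflexive (ℚₚ.∣p*q∣≡∣p∣*∣q∣ p q))
      (*-mono-≤ (∣ p ∣) P (∣ q ∣) Q (ℚₚ.0≤∣p∣ p) 0≤Q hp hq)

    0≤+ : ∀ p q → 0ℚ ≤ p → 0ℚ ≤ q → 0ℚ ≤ p + q
    0≤+ p q = ℚₚ.+-mono-≤

    record Lipschitz (f : ℚ → ℚ) (B : ℚ) : Set where
      field
        K L  : ℚ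
        0≤K  : 0ℚ ≤ K
        0≤L  : 0ℚ ≤ L
        size : ∀ p → ∣ p ∣ ≤ B → ∣ f p ∣ ≤ K
        slope : ∀ p q → ∣ p ∣ ≤ B → ∣ q ∣ ≤ B → ∣ f p - f q ∣ ≤ L * ∣ p - q ∣

    -- The Horner step c₀ + p E has slope at most B L + K, so a bound K on the size is carried along
    -- with the Lipschitz constant L.
    lipschitz : ∀ n c B → 0ℚ ≤ B → Lipschitz (evℚ n c) B
    lipschitz zero c B 0≤B = record
      { K = 0ℚ ; L = 0ℚ ; 0≤K = ℚₚ.≤-refl ; 0≤L = ℚₚ.≤-refl
      ; size = λ _ _ → ℚₚ.≤-refl
      ; slope = λ p q _ _ → ℚₚ.≤-reflexive (sym (ℚₚ.*-zeroˡ (∣ p - q ∣)))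
      }
    lipschitz (suc n) c B 0≤B = record
      { K = ∣ c 0 ∣ + B * K ; L = B * L + K
      ; 0≤K = 0≤+ (∣ c 0 ∣) (B * K) (ℚₚ.0≤∣p∣ (c 0)) (*-nonNeg B K 0≤B 0≤K)
      ; 0≤L = 0≤+ (B * L) K (*-nonNeg B L 0≤B 0≤L) 0≤K
      ; size = λ p hp → triangle (c 0) (p * E p) (c 0 + p * E p) (∣ c 0 ∣) (B * K) refl ℚₚ.≤-refl
          (abs-* p (E p) B K 0≤K hp (size p hp))
      ; slope = λ p q hp hq → ℚₚ.≤-trans
          (triangle (p * (E p - E q)) (E q * (p - q)) (c 0 + p * E p - (c 0 + q * E q)) (B * (L * ∣ p - q ∣)) (K * ∣ p - q ∣)
            (split (c 0) p q (E p) (E q))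
            (abs-* p (E p - E q) B (L * ∣ p - q ∣) (*-nonNeg L (∣ p - q ∣) 0≤L (ℚₚ.0≤∣p∣ (p - q))) hp (slope p q hp hq))
            (abs-* (E q) (p - q) K (∣ p - q ∣) (ℚₚ.0≤∣p∣ (p - q)) (size q hq) ℚₚ.≤-refl))
          (ℚₚ.≤-reflexive (collect B L K (∣ p - q ∣)))
      }
      where
      E = evℚ n (c ∘ suc)
      open Lipschitz (lipschitz n (c ∘ suc) B 0≤B)
      split : ∀ c p q E F → p * (E - F) + F * (p - q) ≡ c + p * E - (c + q * F)
      split = solve 5 (λ c p q E F → p :* (E :- F) :+ F :* (p :- q) := c :+ p :* E :- (c :+ q :* F)) refl
      collect : ∀ B L K d → B * (L * d) + K * d ≡ (B * L + K) * d
      collect = solve 4 (λ B L K d → B :* (L :* d) :+ K :* d := (B :* L :+ K) :* d) refl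

  module Bisection (f : ℚ → ℚ) (a b : ℚ) where
    open import Data.Rational.Base using (_≤_; _<_; _+_; _-_; _*_; -_; ∣_∣)
    open Rational

    midpoint : ℚ → ℚ → ℚ
    midpoint p q = ½ * (p + q)

    next : (p q : ℚ) → Dec (0ℚ ≤ f (midpoint p q)) → ℚ × ℚ
    next p q (yes _) = p , midpoint p q
    next p q (no _)  = midpoint p q , q

    interval : ℕ → ℚ × ℚ
    interval zero    = a , b
    interval (suc n) = next (proj₁ (interval n)) (proj₂ (interval n)) (0ℚ ℚₚ.≤? _)

    lo hi width : ℕ → ℚ
    lo n = proj₁ (interval n)
    hi n = proj₂ (interval n)
    width n = hi n - lo n

    module Properties (a≤b : a ≤ b) (fa≤0 : f a ≤ 0ℚ) (0≤fb : 0ℚ ≤ f b) where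

      record Bracket (p q : ℚ) : Set where
        field
          ordered  : p ≤ q
          negative : f p ≤ 0ℚ
          positive : 0ℚ ≤ f q

      record Halved (p q p′ q′ : ℚ) : Set where
        field
          lower-≤ : p ≤ p′
          upper-≤ : q′ ≤ q
          half    : (q′ - p′) + (q′ - p′) ≡ q - p

      double : ∀ p q → midpoint p q + midpoint p q ≡ p + q
      double p q = trans (sym (ℚₚ.*-distribʳ-+ (p + q) ½ ½)) (ℚₚ.*-identityˡ (p + q))

      ≤-half : ∀ p q → p + p ≤ q + q → p ≤ q
      ≤-half p q h with ℚₚ.≤-total p q
      ... | inj₁ p≤q = p≤q
      ... | inj₂ q≤p = lin₂ (q + q - (p + p)) (p - q) (gap (p + p) (q + q) h) (gap q p q≤p)
        (solve 2 (λ p q → (q :+ q :- (p :+ p)) :+ (p :- q) := q :- p) refl p q)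

      midpoint-lower : ∀ p q → p ≤ q → p ≤ midpoint p q
      midpoint-lower p q p≤q = ≤-half p (midpoint p q) (subst (p + p ≤_) (sym (double p q)) (ℚₚ.+-monoʳ-≤ p p≤q))

      midpoint-upper : ∀ p q → p ≤ q → midpoint p q ≤ q
      midpoint-upper p q p≤q = ≤-half (midpoint p q) q (subst (_≤ q + q) (sym (double p q)) (ℚₚ.+-monoˡ-≤ q p≤q))

      next-bracket : ∀ p q d → Bracket p q → Bracket (proj₁ (next p q d)) (proj₂ (next p q d))
      next-bracket p q (yes 0≤fm) B = record
        { ordered = midpoint-lower p q (Bracket.ordered B) ; negative = Bracket.negative B ; positive = 0≤fm }
      next-bracket p q (no ¬0≤fm) B = record
        { ordered = midpoint-upper p q (Bracket.ordered B) ; negative = ℚₚ.<⇒≤ (ℚₚ.≰⇒> ¬0≤fm) ; positive = Bracket.positive B }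

      next-halved : ∀ p q d → p ≤ q → Halved p q (proj₁ (next p q d)) (proj₂ (next p q d))
      next-halved p q (yes _) p≤q = record
        { lower-≤ = ℚₚ.≤-refl ; upper-≤ = midpoint-upper p q p≤q
        ; half = trans (solve 2 (λ m p → (m :- p) :+ (m :- p) := (m :+ m) :- (p :+ p)) refl (midpoint p q) p)
            (trans (cong (_- (p + p)) (double p q)) (solve 2 (λ p q → p :+ q :- (p :+ p) := q :- p) refl p q)) }
      next-halved p q (no _) p≤q = record
        { lower-≤ = midpoint-lower p q p≤q ; upper-≤ = ℚₚ.≤-refl
        ; half = trans (solve 2 (λ m q → (q :- m) :+ (q :- m) := (q :+ q) :- (m :+ m)) refl (midpoint p q) q)
            (trans (cong (λ s → q + q - s) (double p q)) (solve 2 (λ p q → q :+ q :- (p :+ q) := q :- p) refl p q)) }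

      bracket : ∀ n → Bracket (lo n) (hi n)
      bracket zero    = record { ordered = a≤b ; negative = fa≤0 ; positive = 0≤fb }
      bracket (suc n) = next-bracket (lo n) (hi n) (0ℚ ℚₚ.≤? _) (bracket n)

      halved : ∀ n → Halved (lo n) (hi n) (lo (suc n)) (hi (suc n))
      halved n = next-halved (lo n) (hi n) (0ℚ ℚₚ.≤? _) (Bracket.ordered (bracket n))

      lo-mono : ∀ m k → lo m ≤ lo (k ℕ.+ m)
      lo-mono m zero    = ℚₚ.≤-refl
      lo-mono m (suc k) = ℚₚ.≤-trans (lo-mono m k) (Halved.lower-≤ (halved (k ℕ.+ m)))

      hi-mono : ∀ m k → hi (k ℕ.+ m) ≤ hi m
      hi-mono m zero    = ℚₚ.≤-refl
      hi-mono m (suc k) = ℚₚ.≤-trans (Halved.upper-≤ (halved (k ℕ.+ m))) (hi-mono m k)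

      lo-≤ : ∀ {m n} → m ℕ.≤ n → lo m ≤ lo n
      lo-≤ {m} {n} m≤n = subst (λ j → lo m ≤ lo j) (ℕₚ.m∸n+n≡m m≤n) (lo-mono m (n ℕ.∸ m))

      hi-≤ : ∀ {m n} → m ℕ.≤ n → hi n ≤ hi m
      hi-≤ {m} {n} m≤n = subst (λ j → hi j ≤ hi m) (ℕₚ.m∸n+n≡m m≤n) (hi-mono m (n ℕ.∸ m))

      0≤width : ∀ n → 0ℚ ≤ width n
      0≤width n = gap (lo n) (hi n) (Bracket.ordered (bracket n))

      -- Halving to w leaves (n + 2) w ≤ (n + 1) 2w. The resulting decay like 1/(n + 1) is slower
      -- than the true one but sufficient, and it avoids powers of 2.
      width-bound : ∀ n → fromℤ (+ suc n) * width n ≤ width 0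
      width-bound zero    = ℚₚ.≤-reflexive (ℚₚ.*-identityˡ (width 0))
      width-bound (suc n) = ℚₚ.≤-trans (lin (s * w) (*-nonNeg s w (fromℤ-mono-≤ {+ 0} {+ n} (ℤ.+≤+ z≤n)) (0≤width (suc n)))
          (identity s w (fromℤ (+ suc n)) (fromℤ (+ suc (suc n))) (width n) (fromℤ-+ ℤ.1ℤ (+ n)) (fromℤ-+ (+ 2) (+ n)) (Halved.half (halved n))))
        (width-bound n)
        where
        s = fromℤ (+ n)
        w = width (suc n)
        identity : ∀ s w s₁ s₂ w₀ → s₁ ≡ 1ℚ + s → s₂ ≡ (1ℚ + 1ℚ) + s → w + w ≡ w₀ → s * w ≡ s₁ * w₀ - s₂ * w
        identity s w _ _ _ refl refl refl =
          solve 2 (λ s w → s :* w := (con 1ℚ :+ s) :* (w :+ w) :- ((con 1ℚ :+ con 1ℚ) :+ s) :* w) refl s w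

      width-small : ∀ ε → 0ℚ < ε → ∃ λ N → ∀ n → N ℕ.≤ n → width n ≤ ε
      -- With ε t = width 0 + 1 and n + 1 ≥ t, a width of at least ε would give width 0 + 1 ≤ (n +
      -- 1) width n ≤ width 0.
      width-small ε 0<ε = from (divide ε (width 0 + 1ℚ) 0<ε (ℚₚ.+-mono-≤-< (0≤width 0) 0<1))
        where
        from : (∃ λ t → 0ℚ < t × ε * t ≡ width 0 + 1ℚ) → ∃ λ N → ∀ n → N ℕ.≤ n → width n ≤ ε
        from (t , 0<t , εt) = N , small
          where
          N = ℤ.∣ ℚ.↥ t ∣
          small : ∀ n → N ℕ.≤ n → width n ≤ ε
          small n N≤n with ℚₚ.≤-total (width n) ε
          ... | inj₁ h = h
          ... | inj₂ ε≤w = ⊥-elim (ℚₚ.<-irrefl refl (ℚₚ.<-≤-trans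
              (subst (_< width 0 + 1ℚ) (ℚₚ.+-identityʳ (width 0)) (ℚₚ.+-monoʳ-< (width 0) 0<1))
              (ℚₚ.≤-trans (ℚₚ.≤-reflexive (trans (sym εt) (ℚₚ.*-comm ε t)))
                (ℚₚ.≤-trans (*-mono-≤ t (fromℤ (+ suc n)) ε (width n) (ℚₚ.<⇒≤ 0<t) (0≤width n)
                  (ℚₚ.≤-trans (numerator-bound t) (fromℤ-mono-≤ (ℤ.+≤+ (ℕₚ.m≤n⇒m≤1+n N≤n)))) ε≤w)
                  (width-bound n)))))

      within : ∀ p q r s → p ≤ r → r ≤ q → p ≤ s → s ≤ q → ∣ r - s ∣ ≤ q - p
      within p q r s p≤r r≤q p≤s s≤q = abs-≤ (r - s) (q - p)
        (lin₂ (q - r) (s - p) (gap r q r≤q) (gap p s p≤s)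
          (solve 4 (λ p q r s → (q :- r) :+ (s :- p) := q :- p :- (r :- s) :- con 0ℚ) refl p q r s))
        (lin₂ (q - s) (r - p) (gap s q s≤q) (gap p r p≤r)
          (solve 4 (λ p q r s → (q :- s) :+ (r :- p) := q :- p :+ (r :- s) :- con 0ℚ) refl p q r s))

      lo-cauchy : R.IsCauchy lo
      lo-cauchy ε 0<ε = proj₁ (width-small ε 0<ε) , λ m n N≤m N≤n →
        let N = proj₁ (width-small ε 0<ε) in
        ℚₚ.≤-trans (within (lo N) (hi N) (lo m) (lo n)
            (lo-≤ N≤m) (ℚₚ.≤-trans (Bracket.ordered (bracket m)) (hi-≤ N≤m))
            (lo-≤ N≤n) (ℚₚ.≤-trans (Bracket.ordered (bracket n)) (hi-≤ N≤n)))
          (proj₂ (width-small ε 0<ε) N ℕₚ.≤-refl)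

      limit : ℝ
      limit = R.mkℝ lo lo-cauchy

      a≤lo : ∀ n → a ≤ lo n
      a≤lo n = lo-≤ {0} {n} z≤n

      hi≤b : ∀ n → hi n ≤ b
      hi≤b n = hi-≤ {0} {n} z≤n

      lo≤b : ∀ n → lo n ≤ b
      lo≤b n = ℚₚ.≤-trans (Bracket.ordered (bracket n)) (hi≤b n)

      -- Because f (lo n) ≤ 0 ≤ f (hi n). The Lipschitz bound then makes the value as small as the
      -- width.
      value-small : ∀ n → ∣ f (lo n) ∣ ≤ ∣ f (hi n) - f (lo n) ∣
      value-small n = abs-≤ (f (lo n)) d
          (lin₂ (0ℚ - f (lo n)) d (gap (f (lo n)) 0ℚ (Bracket.negative (bracket n))) (ℚₚ.0≤∣p∣ (f (hi n) - f (lo n)))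
            (solve 2 (λ d x → (con 0ℚ :- x) :+ d := d :- x :- con 0ℚ) refl d (f (lo n))))
          (lin₂ (f (hi n) - 0ℚ) (d - (f (hi n) - f (lo n))) (gap 0ℚ (f (hi n)) (Bracket.positive (bracket n)))
            (upper (f (hi n) - f (lo n)) d ℚₚ.≤-refl)
            (solve 3 (λ d x y → (y :- con 0ℚ) :+ (d :- (y :- x)) := d :+ x :- con 0ℚ) refl d (f (lo n)) (f (hi n))))
        where d = ∣ f (hi n) - f (lo n) ∣

  module Root where
    open import Data.Rational.Base using (_≤_; _<_; _+_; _-_; _*_; -_; ∣_∣)
    open Rational
    open Real
    open RationalEvaluation
    open IntegerPolynomials heytingRing using (evℤ)

    seq-evℤ : ∀ n c x m → seq (evℤ n c x) m ≡ evℚ n (fromℤ ∘ c) (seq x m)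
    seq-evℤ zero    c x m = refl
    seq-evℤ (suc n) c x m = cong (λ y → fromℤ (c 0) + seq x m * y) (seq-evℤ n (c ∘ suc) x m)

    -- The N-th approximations of l and u, moved towards each other by 2e, bracket a root between l and u.
    record Approximation (f : ℚ → ℚ) (l u : ℝ) : Set where
      field
        N              : ℕ
        e              : ℚ
        0<e            : 0ℚ < e
        l-near         : ∀ n → N ℕ.≤ n → ∣ seq l n - seq l N ∣ ≤ e
        u-near         : ∀ n → N ℕ.≤ n → ∣ seq u n - seq u N ∣ ≤ e
        B              : ℚ
        a-bound        : ∣ seq l N + (e + e) ∣ ≤ B
        b-bound        : ∣ seq u N - (e + e) ∣ ≤ B
        ordered        : seq l N + (e + e) ≤ seq u N - (e + e)
        negative       : f (seq l N + (e + e)) ≤ 0ℚ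
        positive       : 0ℚ ≤ f (seq u N - (e + e))

    between-bound : ∀ p q B x → ∣ p ∣ ≤ B → ∣ q ∣ ≤ B → p ≤ x → x ≤ q → ∣ x ∣ ≤ B
    between-bound p q B x hp hq p≤x x≤q = abs-≤ x B
      (subst (0ℚ ≤_) (solve 3 (λ B q x → (B :- q) :+ (q :- x) := B :- x) refl B q x)
        (ℚₚ.+-mono-≤ (upper q B hq) (gap x q x≤q)))
      (subst (0ℚ ≤_) (solve 3 (λ B p x → (B :+ p) :+ (x :- p) := B :+ x) refl B p x)
        (ℚₚ.+-mono-≤ (lower p B hp) (gap p x p≤x)))

    root : ∀ n c (l u : ℝ) (A : Approximation (evℚ n (fromℤ ∘ c)) l u) → ∃ λ z → l R.< z × z R.< u × (evℤ n c z R.≈ R.0ℝ)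
    root n c l u A = limit , (e , 0<e , N , l<) , (e , 0<e , N , <u) , vanishes
      where
      open Approximation A
      f = evℚ n (fromℤ ∘ c)
      a = seq l N + (e + e)
      b = seq u N - (e + e)
      open Bisection f a b
      open Properties ordered negative positive

      0≤B : 0ℚ ≤ B
      0≤B = ℚₚ.≤-trans (ℚₚ.0≤∣p∣ a) a-bound

      open Lipschitz (lipschitz n (fromℤ ∘ c) B 0≤B)

      l< : ∀ k → N ℕ.≤ k → seq l k + e ≤ lo k
      l< k N≤k = ℚₚ.≤-trans (lin (e - (seq l k - seq l N)) (upper (seq l k - seq l N) e (l-near k N≤k))
        (solve 3 (λ e x X → e :- (x :- X) := X :+ (e :+ e) :- (x :+ e)) refl e (seq l k) (seq l N))) (a≤lo k)

      <u : ∀ k → N ℕ.≤ k → lo k + e ≤ seq u k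
      <u k N≤k = lin₂ (b - lo k) (e + (seq u k - seq u N)) (gap (lo k) b (lo≤b k)) (lower (seq u k - seq u N) e (u-near k N≤k))
        (solve 4 (λ e x X y → (X :- (e :+ e) :- y) :+ (e :+ (x :- X)) := x :- (y :+ e)) refl e (seq u k) (seq u N) (lo k))

      lo-bound : ∀ k → ∣ lo k ∣ ≤ B
      lo-bound k = between-bound a b B (lo k) a-bound b-bound (a≤lo k) (lo≤b k)

      hi-bound : ∀ k → ∣ hi k ∣ ≤ B
      hi-bound k = between-bound a b B (hi k) a-bound b-bound (ℚₚ.≤-trans (a≤lo k) (Bracket.ordered (bracket k))) (hi≤b k)

      value-bound : ∀ k → ∣ f (lo k) ∣ ≤ L * width k
      value-bound k = ℚₚ.≤-trans (value-small k) (ℚₚ.≤-trans (slope (hi k) (lo k) (hi-bound k) (lo-bound k))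
        (ℚₚ.≤-reflexive (cong (L *_) (ℚₚ.0≤p⇒∣p∣≡p (0≤width k)))))

      vanishes : evℤ n c limit R.≈ R.0ℝ
      -- L + 1 in place of L, so that the divisor is positive.
      vanishes ε 0<ε = from (divide (L + 1ℚ) ε (ℚₚ.+-mono-≤-< 0≤L 0<1) 0<ε)
        where
        from : (∃ λ δ → 0ℚ < δ × (L + 1ℚ) * δ ≡ ε) → Eventually (λ k → ∣ seq (evℤ n c limit) k - 0ℚ ∣ ≤ ε)
        from (δ , 0<δ , e′) = proj₁ (width-small δ 0<δ) , λ k M≤k →
          subst (_≤ ε) (cong ∣_∣ (sym (trans (cong (_- 0ℚ) (seq-evℤ n c limit k)) (ℚₚ.+-identityʳ (f (lo k))))))
            (ℚₚ.≤-trans (value-bound k)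
              (ℚₚ.≤-trans (*-mono-≤ L (L + 1ℚ) (width k) δ 0≤L (ℚₚ.<⇒≤ 0<δ)
                  (subst (_≤ L + 1ℚ) (ℚₚ.+-identityʳ L) (ℚₚ.+-monoʳ-≤ L (ℚₚ.<⇒≤ 0<1)))
                  (proj₂ (width-small δ 0<δ) k M≤k))
                (ℚₚ.≤-reflexive e′)))

    smaller : ∀ p q → 0ℚ < p → 0ℚ < q → ∃ λ m → 0ℚ < m × m ≤ p × m ≤ q
    smaller p q 0<p 0<q with ℚₚ.≤-total p q
    ... | inj₁ p≤q = p , 0<p , ℚₚ.≤-refl , p≤q
    ... | inj₂ q≤p = q , 0<q , q≤p , ℚₚ.≤-refl

    bound-left : ∀ p M M′ e → 0ℚ < e → 0ℚ < M′ → (e + e) + (e + e) ≤ 1ℚ → ∣ p ∣ ≤ M → ∣ p + (e + e) ∣ ≤ M + M′ + 1ℚ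
    bound-left p M M′ e 0<e 0<M′ e₄≤1 hp = ℚₚ.≤-trans
      (triangle p (e + e) (p + (e + e)) M (e + e) refl hp (ℚₚ.≤-reflexive (ℚₚ.0≤p⇒∣p∣≡p 0≤e₂)))
      (lin₃ (1ℚ - ((e + e) + (e + e))) (e + e) M′ (gap _ 1ℚ e₄≤1) 0≤e₂ (ℚₚ.<⇒≤ 0<M′)
        (solve 4 (λ o e M M′ → (o :- ((e :+ e) :+ (e :+ e))) :+ ((e :+ e) :+ M′) := M :+ M′ :+ o :- (M :+ (e :+ e))) refl 1ℚ e M M′))
      where
      0≤e₂ : 0ℚ ≤ e + e
      0≤e₂ = ℚₚ.+-mono-≤ (ℚₚ.<⇒≤ 0<e) (ℚₚ.<⇒≤ 0<e)

    bound-right : ∀ p M M′ e → 0ℚ < e → 0ℚ < M → (e + e) + (e + e) ≤ 1ℚ → ∣ p ∣ ≤ M′ → ∣ p - (e + e) ∣ ≤ M + M′ + 1ℚ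
    bound-right p M M′ e 0<e 0<M e₄≤1 hp = subst₂ _≤_
      (trans (sym (ℚₚ.∣-p∣≡∣p∣ (- p + (e + e)))) (cong ∣_∣ (solve 2 (λ p d → :- (:- p :+ d) := p :- d) refl p (e + e))))
      (cong (_+ 1ℚ) (ℚₚ.+-comm M′ M))
      (bound-left (- p) M′ M e 0<e 0<M e₄≤1 (subst (_≤ M′) (sym (ℚₚ.∣-p∣≡∣p∣ p)) hp))

    -- The number e satisfies 4e ≤ δ and 4e ≤ 1, where (L + 1) δ = ε. Moving an end by 2e thus
    -- changes f by at most ε, which preserves the signs, and stays within the bound M + M′ + 1. One
    -- e absorbs the error of the approximation, the other makes the inequalities l < z < u strict.
    approximation : ∀ f l u M M′ ε → 0ℚ < M → 0ℚ < M′ → 0ℚ < ε → Lipschitz f (M + M′ + 1ℚ) →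
      Eventually (λ n → ∣ seq l n ∣ ≤ M) → Eventually (λ n → ∣ seq u n ∣ ≤ M′) →
      Eventually (λ n → f (seq l n) + ε ≤ 0ℚ) → Eventually (λ n → ε ≤ f (seq u n)) →
      ¬ u R.< l → Approximation f l u
    approximation f l u M M′ ε 0<M 0<M′ 0<ε lip (N₁ , l≤M) (N₂ , u≤M′) (N₃ , fl) (N₄ , fu) u≮l =
      from (divide (L + 1ℚ) ε 0<L+1 0<ε)
      where
      open Lipschitz lip
      0<L+1 : 0ℚ < L + 1ℚ
      0<L+1 = ℚₚ.+-mono-≤-< 0≤L 0<1

      from : (∃ λ δ → 0ℚ < δ × (L + 1ℚ) * δ ≡ ε) → Approximation f l u
      from (δ , 0<δ , Lδ≡ε) = from₂ (smaller δ 1ℚ 0<δ 0<1)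
        where
        from₂ : (∃ λ m → 0ℚ < m × m ≤ δ × m ≤ 1ℚ) → Approximation f l u
        from₂ (m , 0<m , m≤δ , m≤1) = from₃ (halve m 0<m)
          where
          from₃ : (∃ λ η → 0ℚ < η × η + η ≡ m) → Approximation f l u
          from₃ (η , 0<η , η₂≡m) = from₄ (halve η 0<η)
            where
            from₄ : (∃ λ e → 0ℚ < e × e + e ≡ η) → Approximation f l u
            from₄ (e , 0<e , e₂≡η) = record
              { N = N ; e = e ; 0<e = 0<e ; l-near = near l (proj₂ cl) l-index ; u-near = near u (proj₂ cu) u-index
              ; B = M + M′ + 1ℚ
              ; a-bound = bound-left p M M′ e 0<e 0<M′ e₄≤1 p-bound
              ; b-bound = bound-right q M M′ e 0<e 0<M e₄≤1 q-bound
              ; ordered = ordered′ (p + (e + e) ℚₚ.≤? q - (e + e))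
              ; negative = lin₂ (ε - (f a - f p)) (0ℚ - (f p + ε)) (upper (f a - f p) ε (rise a p a-p a-bound′ p-bound′)) (gap (f p + ε) 0ℚ fp)
                  (solve 3 (λ ε x y → (ε :- (x :- y)) :+ (con 0ℚ :- (y :+ ε)) := con 0ℚ :- x) refl ε (f a) (f p))
              ; positive = lin₂ (ε + (f b - f q)) (f q - ε) (lower (f b - f q) ε (rise b q b-q b-bound′ q-bound′)) (gap ε (f q) fq)
                  (solve 3 (λ ε x y → (ε :+ (x :- y)) :+ (y :- ε) := x :- con 0ℚ) refl ε (f b) (f q))
              }
              where
              cl = cauchy l e 0<e
              cu = cauchy u e 0<e
              N = (N₁ ℕ.⊔ N₂) ℕ.⊔ (N₃ ℕ.⊔ N₄) ℕ.⊔ (proj₁ cl ℕ.⊔ proj₁ cu)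
              first-part : (N₁ ℕ.⊔ N₂) ℕ.⊔ (N₃ ℕ.⊔ N₄) ℕ.≤ N
              first-part = ℕₚ.m≤m⊔n _ _
              l-index : proj₁ cl ℕ.≤ N
              l-index = ℕₚ.≤-trans (ℕₚ.m≤m⊔n (proj₁ cl) (proj₁ cu)) (ℕₚ.m≤n⊔m ((N₁ ℕ.⊔ N₂) ℕ.⊔ (N₃ ℕ.⊔ N₄)) _)
              u-index : proj₁ cu ℕ.≤ N
              u-index = ℕₚ.≤-trans (ℕₚ.m≤n⊔m (proj₁ cl) (proj₁ cu)) (ℕₚ.m≤n⊔m ((N₁ ℕ.⊔ N₂) ℕ.⊔ (N₃ ℕ.⊔ N₄)) _)
              near : ∀ x {K} → (∀ m n → K ℕ.≤ m → K ℕ.≤ n → ∣ seq x m - seq x n ∣ ≤ e) → K ℕ.≤ N →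
                ∀ n → N ℕ.≤ n → ∣ seq x n - seq x N ∣ ≤ e
              near x h K≤N n N≤n = h n N (ℕₚ.≤-trans K≤N N≤n) K≤N

              p = seq l N
              q = seq u N
              a = p + (e + e)
              b = q - (e + e)

              p-bound : ∣ p ∣ ≤ M
              p-bound = l≤M N (ℕₚ.≤-trans (ℕₚ.≤-trans (ℕₚ.m≤m⊔n N₁ N₂) (ℕₚ.m≤m⊔n (N₁ ℕ.⊔ N₂) (N₃ ℕ.⊔ N₄))) first-part)
              q-bound : ∣ q ∣ ≤ M′
              q-bound = u≤M′ N (ℕₚ.≤-trans (ℕₚ.≤-trans (ℕₚ.m≤n⊔m N₁ N₂) (ℕₚ.m≤m⊔n (N₁ ℕ.⊔ N₂) (N₃ ℕ.⊔ N₄))) first-part)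
              fp : f p + ε ≤ 0ℚ
              fp = fl N (ℕₚ.≤-trans (ℕₚ.≤-trans (ℕₚ.m≤m⊔n N₃ N₄) (ℕₚ.m≤n⊔m (N₁ ℕ.⊔ N₂) (N₃ ℕ.⊔ N₄))) first-part)
              fq : ε ≤ f q
              fq = fu N (ℕₚ.≤-trans (ℕₚ.≤-trans (ℕₚ.m≤n⊔m N₃ N₄) (ℕₚ.m≤n⊔m (N₁ ℕ.⊔ N₂) (N₃ ℕ.⊔ N₄))) first-part)

              e₄ = (e + e) + (e + e)
              e₄≡m : e₄ ≡ m
              e₄≡m = trans (cong₂ _+_ e₂≡η e₂≡η) η₂≡m
              e₄≤1 : e₄ ≤ 1ℚ
              e₄≤1 = subst (_≤ 1ℚ) (sym e₄≡m) m≤1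
              0≤e₂ : 0ℚ ≤ e + e
              0≤e₂ = ℚₚ.+-mono-≤ (ℚₚ.<⇒≤ 0<e) (ℚₚ.<⇒≤ 0<e)
              0≤1 : 0ℚ ≤ 1ℚ
              0≤1 = ℚₚ.<⇒≤ 0<1
              e₂≤e₄ : e + e ≤ e₄
              e₂≤e₄ = subst (_≤ e₄) (ℚₚ.+-identityʳ (e + e)) (ℚₚ.+-monoʳ-≤ (e + e) 0≤e₂)

              p-bound′ : ∣ p ∣ ≤ M + M′ + 1ℚ
              p-bound′ = ℚₚ.≤-trans p-bound (lin₂ M′ 1ℚ (ℚₚ.<⇒≤ 0<M′) 0≤1
                (solve 3 (λ o M M′ → M′ :+ o := M :+ M′ :+ o :- M) refl 1ℚ M M′))
              q-bound′ : ∣ q ∣ ≤ M + M′ + 1ℚ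
              q-bound′ = ℚₚ.≤-trans q-bound (lin₂ M 1ℚ (ℚₚ.<⇒≤ 0<M) 0≤1
                (solve 3 (λ o M M′ → M :+ o := M :+ M′ :+ o :- M′) refl 1ℚ M M′))
              a-bound′ : ∣ a ∣ ≤ M + M′ + 1ℚ
              a-bound′ = bound-left p M M′ e 0<e 0<M′ e₄≤1 p-bound
              b-bound′ : ∣ b ∣ ≤ M + M′ + 1ℚ
              b-bound′ = bound-right q M M′ e 0<e 0<M e₄≤1 q-bound

              rise : ∀ x y → ∣ x - y ∣ ≤ e₄ → ∣ x ∣ ≤ M + M′ + 1ℚ → ∣ y ∣ ≤ M + M′ + 1ℚ → ∣ f x - f y ∣ ≤ ε
              rise x y h hx hy = ℚₚ.≤-trans (slope x y hx hy) (ℚₚ.≤-trans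
                (*-mono-≤ L (L + 1ℚ) (∣ x - y ∣) δ 0≤L (ℚₚ.<⇒≤ 0<δ)
                  (subst (_≤ L + 1ℚ) (ℚₚ.+-identityʳ L) (ℚₚ.+-monoʳ-≤ L 0≤1))
                  (ℚₚ.≤-trans h (subst (_≤ δ) (sym e₄≡m) m≤δ)))
                (ℚₚ.≤-reflexive Lδ≡ε))

              a-p : ∣ a - p ∣ ≤ e₄
              a-p = subst (_≤ e₄) (trans (sym (ℚₚ.0≤p⇒∣p∣≡p 0≤e₂)) (cong ∣_∣ (solve 2 (λ p d → d := p :+ d :- p) refl p (e + e)))) e₂≤e₄
              b-q : ∣ b - q ∣ ≤ e₄
              b-q = near-sym q b e₄ (subst (_≤ e₄) (trans (sym (ℚₚ.0≤p⇒∣p∣≡p 0≤e₂))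
                (cong ∣_∣ (solve 2 (λ q d → d := q :- (q :- d)) refl q (e + e)))) e₂≤e₄)

              -- Otherwise p and q would be so close that f, which jumps by at least 2ε between them, could not do so.
              ordered′ : Dec (a ≤ b) → a ≤ b
              ordered′ (yes a≤b) = a≤b
              ordered′ (no a≰b) = ⊥-elim (close (q + (e + (e + e)) ℚₚ.≤? p))
                where
                close : Dec (q + (e + (e + e)) ≤ p) → ⊥
                close (yes h) = u≮l (separated u l e N 0<e (near u (proj₂ cu) u-index) (near l (proj₂ cl) l-index) h)
                close (no h) = ℚₚ.<-irrefl refl (ℚₚ.<-≤-trans 0<ε
                  (lin₃ (ε - (f q - f p)) (0ℚ - (f p + ε)) (f q - ε) (upper (f q - f p) ε (rise q p q-p q-bound′ p-bound′))
                    (gap (f p + ε) 0ℚ fp) (gap ε (f q) fq)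
                    (solve 3 (λ ε x y → (ε :- (y :- x)) :+ ((con 0ℚ :- (x :+ ε)) :+ (y :- ε)) := con 0ℚ :- ε) refl ε (f p) (f q))))
                  where
                  q-p : ∣ q - p ∣ ≤ e₄
                  q-p = abs-≤ (q - p) e₄
                    (lin (a - b) (gap b a (ℚₚ.<⇒≤ (ℚₚ.≰⇒> a≰b)))
                      (solve 3 (λ e p q → (p :+ (e :+ e)) :- (q :- (e :+ e)) := ((e :+ e) :+ (e :+ e)) :- (q :- p) :- con 0ℚ) refl e p q))
                    (lin₂ (q + (e + (e + e)) - p) e (gap p _ (ℚₚ.<⇒≤ (ℚₚ.≰⇒> h))) (ℚₚ.<⇒≤ 0<e)
                      (solve 3 (λ e p q → (q :+ (e :+ (e :+ e)) :- p) :+ e := ((e :+ e) :+ (e :+ e)) :+ (q :- p) :- con 0ℚ) refl e p q))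

    intermediateValue : IntermediateValue heytingRing
    intermediateValue n c {l} {u} u≮l fl<0 0<fu = from fl<0 0<fu (bounded l) (bounded u)
      where
      f = evℚ n (fromℤ ∘ c)
      from : evℤ n c l R.< R.0ℝ → R.0ℝ R.< evℤ n c u →
        (∃ λ M → 0ℚ < M × Eventually (λ n → ∣ seq l n ∣ ≤ M)) → (∃ λ M → 0ℚ < M × Eventually (λ n → ∣ seq u n ∣ ≤ M)) →
        ∃ λ z → l R.< z × z R.< u × (evℤ n c z R.≈ R.0ℝ)
      from (ε₁ , 0<ε₁ , N₁ , h₁) (ε₂ , 0<ε₂ , N₂ , h₂) (M , 0<M , hl) (M′ , 0<M′ , hu) = from₂ (smaller ε₁ ε₂ 0<ε₁ 0<ε₂)
        where
        from₂ : (∃ λ m → 0ℚ < m × m ≤ ε₁ × m ≤ ε₂) → ∃ λ z → l R.< z × z R.< u × (evℤ n c z R.≈ R.0ℝ)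
        from₂ (ε , 0<ε , ε≤ε₁ , ε≤ε₂) = root n c l u
          (approximation f l u M M′ ε 0<M 0<M′ 0<ε (lipschitz n (fromℤ ∘ c) (M + M′ + 1ℚ) 0≤B) hl hu
            (N₁ , λ k N₁≤k → ℚₚ.≤-trans (ℚₚ.+-monoʳ-≤ (f (seq l k)) ε≤ε₁) (subst (λ y → y + ε₁ ≤ 0ℚ) (seq-evℤ n c l k) (h₁ k N₁≤k)))
            (N₂ , λ k N₂≤k → ℚₚ.≤-trans ε≤ε₂ (subst₂ _≤_ (ℚₚ.+-identityˡ ε₂) (seq-evℤ n c u k) (h₂ k N₂≤k)))
            u≮l)
          where
          0≤B : 0ℚ ≤ M + M′ + 1ℚ
          0≤B = ℚₚ.+-mono-≤ (ℚₚ.+-mono-≤ (ℚₚ.<⇒≤ 0<M) (ℚₚ.<⇒≤ 0<M′)) (ℚₚ.<⇒≤ 0<1)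

-- Transfer to the polynomials of the theorem

module Conclusion (q N : ℕ) where
  open R using (ℝ; seq; Poly; coeff; finite; A⁺; A⁺-series; A⁺-degree≤; 𝓘; HasDegree; HasZeros; AlternatinglyIncreasing; _≪_; ∏[x-_])
  open ≡ using (refl; sym; trans; cong; cong₂; subst; subst₂)
  open IntegerSeries
  open CauchyReals
  open Rational using (fromℤ-mono-≤)

  fromℤ-cong : ∀ a b → a ≡ b → R.fromℤ a ≡ R.fromℤ b
  fromℤ-cong a .a refl = refl

  𝓘-inside : ∀ d p deg k → k ≤ℕ d → coeff (𝓘 d p deg) k ≡ coeff p (d ∸ k)
  𝓘-inside d p deg k k≤d with k ℕₚ.≤? d
  ... | yes _  = refl
  ... | no k≰d = ⊥-elim (k≰d k≤d)

  𝓘-outside : ∀ d p deg k → ¬ k ≤ℕ d → coeff (𝓘 d p deg) k ≡ R.0ℝ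
  𝓘-outside d p deg k k≰d with k ℕₚ.≤? d
  ... | yes k≤d = ⊥-elim (k≰d k≤d)
  ... | no _    = refl

  open Blocks q
  open Numerators q using (A⁺-series≡A-coef; I-coef-reverse; above-first; below-last)
  open Real using (heytingRing; ≮⇒≥; ι-mono-<)
  open Root using (intermediateValue)
  open Interlacing heytingRing intermediateValue q above-first below-last
  open Polynomials heytingRing using (π)
  open InterlacingZeros (interlacingZeros N)

  A : Poly
  A = A⁺ (suc (suc q)) (suc N)

  I : Poly
  I = 𝓘 N (A⁺ (suc (suc q)) (suc N)) (A⁺-degree≤ (suc (suc q)) (suc N))

  coeff-A : ∀ k → coeff A k ≡ R.fromℤ (A-coef N k)
  coeff-A k = fromℤ-cong (A⁺-series (suc (suc q)) (suc N) k) (A-coef N k) (A⁺-series≡A-coef N k)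

  coeff-I : ∀ k → coeff I k ≡ R.fromℤ (I-coef N k)
  coeff-I k = cases (k ℕₚ.≤? N)
    where
    cases : Dec (k ≤ℕ N) → coeff I k ≡ R.fromℤ (I-coef N k)
    cases (yes k≤N) = trans (𝓘-inside N A (A⁺-degree≤ (suc (suc q)) (suc N)) k k≤N) (trans (coeff-A (N ∸ k))
      (fromℤ-cong (A-coef N (N ∸ k)) (I-coef N k) (sym (I-coef-reverse N k (N ∸ k) (ℕₚ.m+[n∸m]≡n k≤N)))))
    cases (no k≰N) = trans (𝓘-outside N A (A⁺-degree≤ (suc (suc q)) (suc N)) k k≰N)
      (fromℤ-cong ℤ.0ℤ (I-coef N k) (sym (I-coef-vanishes N k (ℕₚ.≰⇒> k≰N))))

  -- By reversal this is the constant term of I, a sum of nonnegative integers whose first is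
  -- positive.
  0<A-lead : R.0ℝ R.< coeff A N
  0<A-lead = subst (R.0ℝ R.<_) (sym (trans (coeff-A N) (cong R.fromℤ (sym (I-coef-reverse N 0 N refl)))))
    (ι-mono-< {ℤ.0ℤ} {I-coef N 0} (I-coef-const N))

  0<I-lead : R.0ℝ R.< coeff I N
  0<I-lead = subst (R.0ℝ R.<_) (sym (coeff-I N)) (ι-mono-< {ℤ.0ℤ} {I-coef N N} (I-coef-lead N))

  A-degree : HasDegree A N
  A-degree = inj₂ 0<A-lead , A⁺-degree≤ (suc (suc q)) (suc N)

  I-degree : HasDegree I N
  I-degree = inj₂ 0<I-lead , proj₂ (finite I)

  toVec : (ℕ → ℝ) → ∀ n → Vec ℝ n
  toVec z zero    = []
  toVec z (suc n) = z 0 ∷ toVec (z ∘ suc) n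

  -- Both sides perform the same rational operations at each index, so their sequences agree exactly
  -- and estimates carry over unchanged.
  π≡∏ : ∀ z n k m → seq (π z n k) m ≡ seq (∏[x- toVec z n ] k) m
  π≡∏ z zero    zero    m = refl
  π≡∏ z zero    (suc k) m = refl
  π≡∏ z (suc n) zero    m = neg-* (seq (z 0) m) (seq (π (z ∘ suc) n zero) m) (seq (∏[x- toVec (z ∘ suc) n ] zero) m)
    (π≡∏ (z ∘ suc) n zero m)
    where
    neg-* : ∀ a s t → s ≡ t → ℚ.- (a ℚ.* s) ≡ ℚ.- (a ℚ.* t)
    neg-* a s .s refl = refl
  π≡∏ z (suc n) (suc k) m = minus-* (seq (z 0) m)
    (seq (π (z ∘ suc) n k) m) (seq (∏[x- toVec (z ∘ suc) n ] k) m)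
    (seq (π (z ∘ suc) n (suc k)) m) (seq (∏[x- toVec (z ∘ suc) n ] (suc k)) m)
    (π≡∏ (z ∘ suc) n k m) (π≡∏ (z ∘ suc) n (suc k) m)
    where
    minus-* : ∀ a s t s′ t′ → s ≡ t → s′ ≡ t′ → s ℚ.- a ℚ.* s′ ≡ t ℚ.- a ℚ.* t′
    minus-* a s .s s′ .s′ refl refl = refl

  hasZeros : ∀ p (c : ℕ → ℤ) (z : ℕ → ℝ) → (∀ k → coeff p k ≡ R.fromℤ (c k)) → HasDegree p N →
    (∀ k → R.fromℤ (c k) R.≈ (R.fromℤ (c N) R.* π z N k)) → HasZeros p (toVec z N)
  hasZeros p c z p≡c degree factors = degree , λ k ε 0<ε → proj₁ (factors k ε 0<ε) , λ m M≤m →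
    replace (c k ℚ./ 1) (seq (coeff p k) m) (c N ℚ./ 1) (seq (coeff p N) m) (seq (π z N k) m) (seq (∏[x- toVec z N ] k) m) ε
      (sym (cong (λ x → seq x m) (p≡c k))) (sym (cong (λ x → seq x m) (p≡c N))) (π≡∏ z N k m)
      (proj₂ (factors k ε 0<ε) m M≤m)
    where
    replace : ∀ (x x′ y y′ w w′ ε : ℚ.ℚ) → x ≡ x′ → y ≡ y′ → w ≡ w′ →
      ℚ.∣ x ℚ.- y ℚ.* w ∣ ℚ.≤ ε → ℚ.∣ x′ ℚ.- y′ ℚ.* w′ ∣ ℚ.≤ ε
    replace x .x y .y w .w ε refl refl refl h = h

  linked-⋎ : ∀ n (x y : ℕ → ℝ) → (∀ i → i ℕ.< n → y i R.≤ x i) → (∀ i → suc i ℕ.< n → x (suc i) R.≤ y i) →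
    Linked R._≥_ (toVec x n ⋎ toVec y n)
  linked-⋎ zero          x y y≤x x≤y = []
  linked-⋎ (suc zero)    x y y≤x x≤y = y≤x 0 (s≤s z≤n) ∷ [-]
  linked-⋎ (suc (suc n)) x y y≤x x≤y = y≤x 0 (s≤s z≤n) ∷ (x≤y 0 (s≤s (s≤s z≤n)) ∷
    linked-⋎ (suc n) (x ∘ suc) (y ∘ suc) (λ i i<n → y≤x (suc i) (s≤s i<n)) (λ i i<n → x≤y (suc i) (s≤s i<n)))

  I≪A : I ≪ A
  -- The case of equal degrees, with both leading coefficients positive.
  I≪A = inj₁ (inj₂ (N , toVec ρ N , toVec σ N ,
      hasZeros A (A-coef N) ρ coeff-A A-degree A-factors , hasZeros I (I-coef N) σ coeff-I I-degree I-factors ,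
      linked-⋎ N ρ σ (λ i i<N → ≮⇒≥ (σ i) (ρ i) (σ≤ρ i i<N)) (λ i i<N → ≮⇒≥ (ρ (suc i)) (σ i) (ρ≤σ i i<N))) ,
    (N , N , I-degree , A-degree , inj₁ (0<I-lead , 0<A-lead)))

  fromℤ-≤ : ∀ a b → a ℤ.≤ b → R.fromℤ a R.≤ R.fromℤ b
  fromℤ-≤ a b a≤b ε 0<ε = 0 , λ _ _ → ℚₚ.≤-trans (fromℤ-mono-≤ a≤b)
    (subst (ℚ._≤ b ℚ./ 1 ℚ.+ ε) (ℚₚ.+-identityʳ (b ℚ./ 1)) (ℚₚ.+-monoʳ-≤ (b ℚ./ 1) (ℚₚ.<⇒≤ 0<ε)))

  A-≤ : ∀ i j → A⁺-series (suc (suc q)) (suc N) i ℤ.≤ A⁺-series (suc (suc q)) (suc N) j → coeff A i R.≤ coeff A j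
  A-≤ i j = fromℤ-≤ (A⁺-series (suc (suc q)) (suc N) i) (A⁺-series (suc (suc q)) (suc N) j)

  double : ∀ i → 2 ℕ.* i ≡ i ℕ.+ i
  double i = cong (i ℕ.+_) (ℕₚ.+-identityʳ i)

  open AlternatingIncrease (suc q) N

  0≤A-const : R.0ℝ R.≤ coeff A 0
  0≤A-const = fromℤ-≤ ℤ.0ℤ (A⁺-series (suc (suc q)) (suc N) 0) (subst (ℤ.0ℤ ℤ.≤_) (sym (A⁺-series≡A-coef N 0)) (ℤₚ.<⇒≤ (A-coef-const N)))

  alternatinglyIncreasing : AlternatinglyIncreasing A
  alternatinglyIncreasing = N , A-degree , 0≤A-const ,
    (λ i 2i≤N → A-≤ i (N ∸ i) (left≤right i (N ∸ i) (ℕₚ.m+[n∸m]≡n (i≤N i 2i≤N))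
      (ℕₚ.m+n≤o⇒m≤o∸n i (subst (ℕ._≤ N) (double i) 2i≤N)))) ,
    (λ i 2i<N → A-≤ (N ∸ i) (suc i) (right≤left i (N ∸ i) (ℕₚ.m+[n∸m]≡n (i≤N i (ℕₚ.<⇒≤ 2i<N)))
      (ℕₚ.m+n≤o⇒m≤o∸n (suc i) (subst (ℕ._< N) (double i) 2i<N))))
    where
    i≤N : ∀ i → 2 ℕ.* i ℕ.≤ N → i ℕ.≤ N
    i≤N i 2i≤N = ℕₚ.≤-trans (ℕₚ.m≤m+n i (1 ℕ.* i)) 2i≤N

open import Defs

proposition5p8 : (r n : ℕ) → 2 ≤ℕ r → 1 ≤ℕ n →
    (𝓘 (n ∸ 1) (A⁺ r n) (A⁺-degree≤ r n) ≪ A⁺ r n) ×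
    AlternatinglyIncreasing (A⁺ r n)
proposition5p8 (suc (suc q)) (suc N) (s≤s (s≤s z≤n)) (s≤s z≤n) =
  Conclusion.I≪A q N , Conclusion.alternatinglyIncreasing q N
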